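{- Let $M$ be a combinatorial $3$-manifold and $S$ a slicing of $M$ which is a weakly neighborly polyhedral map. Then $S$ is combinatorially isomorphic to one of the following: the boundary of the $3$-simplex; the boundary of the triangular prism $\Delta^1\times\Delta^2$ (6 vertices, 2 triangles, 3 quadrilaterals); or the $3\times 3$-grid torus (the quadrangulated torus with vertex set $\mathbb{Z}_3\times\mathbb{Z}_3$ and the nine quadrilaterals $\{(i,j),(i+1,j),(i+1,j+1),(i,j+1)\}$, $i,j\in\mathbb{Z}_3$).
   Context: A combinatorial $3$-manifold is a finite pure $3$-dimensional simplicial complex in which the link of every vertex is a combinatorial $2$-sphere. A function $f:M\to\mathbb{R}$ is regular simplexwise linear (rsl) if it is linear on every simplex and takes pairwise distinct values on the vertices. A slicing of $M$ is a level set $f^{ -1}(x)$ of an rsl-function $f$ at a value $x$ not equal to $f(v)$ for any vertex $v$; it is a polyhedral surface whose facets are triangles and quadrilaterals, obtained by intersecting $f^{ -1}(x)$ with the tetrahedra of $M$. A polyhedral map is weakly neighborly if any two of its vertices lie in a common face. -}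

module Defs where

open import Algebra.Bundles using (CommutativeRing)
import Algebra.Properties.Monoid.Sum as MonoidSum
open import Data.Fin.Base using (Fin; zero; suc)
open import Data.Fin.Subset
  using (Subset; inside; outside; ⊤; ⁅_⁆; ∣_∣; Nonempty; _∈_; _∉_; _∪_)
  renaming (_⊆_ to _⊆ₛ_)
open import Data.Fin.Subset.Properties
  using (⊆-poset; _∈?_; _⊆?_; p⊆q⇒∣p∣≤∣q∣; x∈p∪q⁻; x∈p∪q⁺;
         drop-∷-⊆)
open import Data.List.Base using (List; []; _∷_)
open import Data.List.Relation.Binary.Subset.Propositional
  using () renaming (_⊆_ to _⊆ₗ_)
open import Data.Nat.Base as ℕ using (ℕ; zero; suc; _∸_)
import Data.Nat.Properties as ℕ
open import Data.Product.Base using (Σ; ∃; ∃₂; _×_; _,_; proj₁; proj₂)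
open import Data.Product.Relation.Binary.Pointwise.NonDependent using (×-poset)
open import Data.Sum.Base as Sum using (_⊎_; inj₁; inj₂)
open import Data.Vec.Base using (_∷_; here; there)
open import Function.Base using (id; _∘_)
open import Level using (Level; _⊔_; 0ℓ) renaming (suc to lsuc)
open import Relation.Binary.Bundles using (Poset)
open import Relation.Binary.Construct.Closure.ReflexiveTransitive using (Star)
import Relation.Binary.Construct.Interior.Symmetric as Interior
import Relation.Binary.Construct.On as On
open import Relation.Binary.Core using (Rel)
open import Relation.Binary.Morphism.Structures using (IsOrderIsomorphism)
open import Relation.Binary.PropositionalEquality.Core using (_≡_)
open import Relation.Binary.Structures using (IsStrictTotalOrder)
open import Relation.Nullary.Decidable.Core using (_×-dec_; ¬?)
open import Relation.Nullary.Negation.Core using (¬_)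
open import Relation.Unary using (Pred; Decidable)

private
  variable
    c ℓ₁ ℓ₂ c′ ℓ₁′ ℓ₂′ p : Level
    m n k : ℕ

-- A cell complex is given by its face poset, without an empty cell.

record CellComplex c ℓ₁ ℓ₂ : Set (lsuc (c ⊔ ℓ₁ ⊔ ℓ₂)) where
  field
    cells : Poset c ℓ₁ ℓ₂
  open Poset cells public
  field
    dim : Carrier → ℕ

  IsVertex IsEdge IsFacet : Carrier → Set
  IsVertex x = dim x ≡ 0
  IsEdge   x = dim x ≡ 1
  IsFacet  x = dim x ≡ 2

  ExactlyTwo : Pred Carrier p → Set (c ⊔ ℓ₁ ⊔ p)
  ExactlyTwo P = ∃₂ λ a b → P a × P b × ¬ a ≈ b ×
                            (∀ x → P x → x ≈ a ⊎ x ≈ b)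

  Connected : Pred Carrier p → Set (c ⊔ ℓ₂ ⊔ p)
  Connected P = ∀ x y → P x → P y → Star (λ a b → P b × (a ≤ b ⊎ b ≤ a)) x y

record _≅_ (X : CellComplex c ℓ₁ ℓ₂) (Y : CellComplex c′ ℓ₁′ ℓ₂′)
         : Set (c ⊔ ℓ₁ ⊔ ℓ₂ ⊔ c′ ⊔ ℓ₁′ ⊔ ℓ₂′) where
  private
    module X = CellComplex X
    module Y = CellComplex Y
  field
    to    : X.Carrier → Y.Carrier
    isIso : IsOrderIsomorphism X._≈_ Y._≈_ X._≤_ Y._≤_ to
    dim≡  : ∀ x → Y.dim (to x) ≡ X.dim x

-- A finite cell decomposition of a connected closed
-- surface into polygons such that two cells meet, if at all, in a
-- common cell.

record IsPolyhedralMap (X : CellComplex c ℓ₁ ℓ₂) : Set (c ⊔ ℓ₁ ⊔ ℓ₂) where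
  open CellComplex X
  field
    finite   : ∃₂ λ k (enum : Fin k → Carrier) → ∀ x → ∃ λ i → enum i ≈ x
    nonempty : Carrier
    dim≤2    : ∀ x → dim x ℕ.≤ 2
    dim-cong : ∀ {x y} → x ≈ y → dim x ≡ dim y
    dim-mono : ∀ {x y} → x ≤ y → ¬ x ≈ y → dim x ℕ.< dim y

    edge-vertices : ∀ e → IsEdge e → ExactlyTwo (λ v → IsVertex v × v ≤ e)

    -- The vertices and edges of a facet form a cycle.
    facet-nonempty  : ∀ f → IsFacet f → ∃ λ v → IsVertex v × v ≤ f
    facet-2-regular : ∀ v f → IsVertex v → IsFacet f → v ≤ f →
                      ExactlyTwo (λ e → IsEdge e × v ≤ e × e ≤ f)
    facet-connected : ∀ f → IsFacet f → Connected (λ x → dim x ℕ.< 2 × x ≤ f)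

    -- The link of a vertex is a cycle: its nodes are the edges at v and
    -- its arcs are the facets at v, each of which contains exactly two
    -- edges at v by facet-2-regular.
    edge-facets    : ∀ e → IsEdge e → ExactlyTwo (λ f → IsFacet f × e ≤ f)
    link-nonempty  : ∀ v → IsVertex v → ∃ λ f → IsFacet f × v ≤ f
    link-connected : ∀ v → IsVertex v → Connected (λ x → 0 ℕ.< dim x × v ≤ x)

    connected : ∀ x y → Star (λ a b → a ≤ b ⊎ b ≤ a) x y

    intersection : ∀ x y z → z ≤ x → z ≤ y →
                   ∃ λ w → w ≤ x × w ≤ y × (∀ u → u ≤ x → u ≤ y → u ≤ w)

WeaklyNeighborly : CellComplex c ℓ₁ ℓ₂ → Set (c ⊔ ℓ₂)
WeaklyNeighborly X = ∀ u v → IsVertex u → IsVertex v →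
                     ∃ λ f → IsFacet f × u ≤ f × v ≤ f
  where open CellComplex X

-- The vertices are those v : Fin n for which ⁅ v ⁆ is a face; other
-- elements of Fin n are unused labels.  The empty simplex counts as a
-- face of every complex that has a face.
record SimplicialComplex (n : ℕ) : Set₁ where
  field
    Face   : Pred (Subset n) 0ℓ
    face?  : Decidable Face
    closed : ∀ {s t} → s ⊆ₛ t → Face t → Face s

open SimplicialComplex

simplicialCells : SimplicialComplex n → CellComplex 0ℓ 0ℓ 0ℓ
simplicialCells {n} K = record
  { cells = On.poset {B = Σ (Subset n) λ s → Face K s × Nonempty s}
                     (⊆-poset n) proj₁
  ; dim   = λ s → ∣ proj₁ s ∣ ∸ 1
  }

private
  ∪-monoʳ : (s : Subset n) {t u : Subset n} → t ⊆ₛ u → s ∪ t ⊆ₛ s ∪ u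
  ∪-monoʳ s t⊆u = x∈p∪q⁺ ∘ Sum.map₂ t⊆u ∘ x∈p∪q⁻ s _

link : SimplicialComplex n → Fin n → SimplicialComplex n
link K v = record
  { Face   = λ s → v ∉ s × Face K (⁅ v ⁆ ∪ s)
  ; face?  = λ s → ¬? (v ∈? s) ×-dec face? K (⁅ v ⁆ ∪ s)
  ; closed = λ s⊆t (v∉t , face) →
      v∉t ∘ s⊆t , closed K (∪-monoʳ ⁅ v ⁆ s⊆t) face
  }

∂Δ : (d : ℕ) → SimplicialComplex (suc d)
∂Δ d = record
  { Face   = λ s → ∣ s ∣ ℕ.≤ d
  ; face?  = λ s → ∣ s ∣ ℕ.≤? d
  ; closed = λ s⊆t → ℕ.≤-trans (p⊆q⇒∣p∣≤∣q∣ s⊆t)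
  }

-- Stellar subdivision at the face σ, with zero as the new vertex: the
-- open star of σ is replaced by the cone over ∂σ ∗ lk σ, and s is a
-- simplex of ∂σ ∗ lk σ iff σ ⊈ s and s ∪ σ is a simplex of K.
module _ (K : SimplicialComplex n) (σ : Subset n) where
  private
    StarFace : Pred (Subset (suc n)) 0ℓ
    StarFace (outside ∷ s) = ¬ (σ ⊆ₛ s) × Face K s
    StarFace (inside  ∷ s) = ¬ (σ ⊆ₛ s) × Face K (σ ∪ s)

    starFace? : Decidable StarFace
    starFace? (outside ∷ s) = ¬? (σ ⊆? s) ×-dec face? K s
    starFace? (inside  ∷ s) = ¬? (σ ⊆? s) ×-dec face? K (σ ∪ s)

    starClosed : ∀ {s t} → s ⊆ₛ t → StarFace t → StarFace s
    starClosed {outside ∷ s} {outside ∷ t} s⊆t (σ⊈t , face) =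
      (λ σ⊆s → σ⊈t (drop-∷-⊆ s⊆t ∘ σ⊆s)) , closed K (drop-∷-⊆ s⊆t) face
    starClosed {outside ∷ s} {inside ∷ t} s⊆t (σ⊈t , face) =
      (λ σ⊆s → σ⊈t (drop-∷-⊆ s⊆t ∘ σ⊆s)) ,
      closed K (x∈p∪q⁺ ∘ inj₂ ∘ drop-∷-⊆ s⊆t) face
    starClosed {inside ∷ s} {inside ∷ t} s⊆t (σ⊈t , face) =
      (λ σ⊆s → σ⊈t (drop-∷-⊆ s⊆t ∘ σ⊆s)) ,
      closed K (∪-monoʳ σ (drop-∷-⊆ s⊆t)) face
    starClosed {inside ∷ s} {outside ∷ t} s⊆t with s⊆t here
    ... | ()

  subdivide : SimplicialComplex (suc n)
  subdivide = record
    { Face = StarFace ; face? = starFace? ; closed = starClosed }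

-- Stellar equivalence; by Alexander's theorem two complexes are related
-- iff they are PL homeomorphic.
data _∼_ : SimplicialComplex m → SimplicialComplex n → Set₁ where
  iso     : {K : SimplicialComplex m} {L : SimplicialComplex n} →
            simplicialCells K ≅ simplicialCells L → K ∼ L
  stellar : {K : SimplicialComplex n} (σ : Subset n) →
            Nonempty σ → Face K σ → K ∼ subdivide K σ
  ∼-sym   : {K : SimplicialComplex m} {L : SimplicialComplex n} →
            K ∼ L → L ∼ K
  ∼-trans : {K : SimplicialComplex m} {L : SimplicialComplex n}
            {N : SimplicialComplex k} → K ∼ L → L ∼ N → K ∼ N

IsCombinatorialSphere : ℕ → SimplicialComplex n → Set₁
IsCombinatorialSphere d K = K ∼ ∂Δ (suc d)

IsPure : ℕ → SimplicialComplex n → Set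
IsPure d K = ∀ s → Face K s → ∃ λ t → Face K t × s ⊆ₛ t × ∣ t ∣ ≡ suc d

record IsCombinatorial3Manifold (M : SimplicialComplex n) : Set₁ where
  field
    pure  : IsPure 3 M
    links : ∀ v → Face M ⁅ v ⁆ → IsCombinatorialSphere 2 (link M v)

-- Functions take values in an arbitrary ordered field, of which the field
-- of real numbers is an instance.

record OrderedField c ℓ₁ ℓ₂ : Set (lsuc (c ⊔ ℓ₁ ⊔ ℓ₂)) where
  field
    commutativeRing : CommutativeRing c ℓ₁
  open CommutativeRing commutativeRing public
  field
    _<_                : Rel Carrier ℓ₂
    isStrictTotalOrder : IsStrictTotalOrder _≈_ _<_
    0<1                : 0# < 1#
    +-monoʳ-<          : ∀ z {x y} → x < y → (z + x) < (z + y)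
    *-positive         : ∀ {x y} → 0# < x → 0# < y → 0# < (x * y)
    inverse            : ∀ x → ¬ x ≈ 0# → ∃ λ y → (x * y) ≈ 1#

  _≤_ : Rel Carrier (ℓ₁ ⊔ ℓ₂)
  x ≤ y = x < y ⊎ x ≈ y

  open MonoidSum +-monoid public using (sum)

module _ (𝕂 : OrderedField c ℓ₁ ℓ₂) where
  open OrderedField 𝕂

  -- A simplexwise linear function is determined by its values on the
  -- vertices; the values at unused labels play no role.
  record RSL (M : SimplicialComplex n) : Set (c ⊔ ℓ₁) where
    field
      value   : Fin n → Carrier
      regular : ∀ u v → Face M ⁅ u ⁆ → Face M ⁅ v ⁆ → value u ≈ value v → u ≡ v

    -- The linear extension to a point in barycentric coordinates.
    eval : (Fin n → Carrier) → Carrier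
    eval a = sum λ v → a v * value v

  open RSL

  -- Points of the geometric simplex σ, in barycentric coordinates.
  record _∈∣_∣ (a : Fin n → Carrier) (σ : Subset n) : Set (ℓ₁ ⊔ ℓ₂) where
    field
      nonneg  : ∀ v → 0# ≤ a v
      total   : sum a ≈ 1#
      support : ∀ v → v ∉ σ → a v ≈ 0#

  InLevel : {M : SimplicialComplex n} → RSL M → Carrier → Subset n →
            (Fin n → Carrier) → Set (ℓ₁ ⊔ ℓ₂)
  InLevel f x σ a = a ∈∣ σ ∣ × eval f a ≈ x

  IsRegularValue : {M : SimplicialComplex n} → RSL M → Carrier → Set ℓ₁
  IsRegularValue {M = M} f x = ∀ v → Face M ⁅ v ⁆ → ¬ x ≈ value f v

  -- The cells are the nonempty sets f⁻¹(x) ∩ |σ| for faces σ of M, ordered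
  -- by inclusion and identified when equal as sets.  At a regular value x
  -- the level set meets σ transversally in its relative interior, so
  -- f⁻¹(x) ∩ |σ| has dimension dim σ - 1 = |σ| - 2.
  slicing : {M : SimplicialComplex n} → RSL M → Carrier →
            CellComplex (c ⊔ ℓ₁ ⊔ ℓ₂) (c ⊔ ℓ₁ ⊔ ℓ₂) (c ⊔ ℓ₁ ⊔ ℓ₂)
  slicing {n} {M} f x = record
    { cells = Interior.poset {R = _⊑_}
        (λ _ → id) (λ s⊑t t⊑u a → t⊑u a ∘ s⊑t a)
    ; dim   = λ s → ∣ proj₁ s ∣ ∸ 2
    }
    where
    _⊑_ : Rel (Σ (Subset n) λ σ → Face M σ × ∃ (InLevel f x σ))
              (c ⊔ ℓ₁ ⊔ ℓ₂)
    (σ , _) ⊑ (τ , _) = ∀ a → InLevel f x σ a → InLevel f x τ a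

simplexBoundary : CellComplex 0ℓ 0ℓ 0ℓ
simplexBoundary = simplicialCells (∂Δ 3)

-- The cells of Δ¹ × Δ² are the products of nonempty faces.
prismBoundary : CellComplex 0ℓ 0ℓ 0ℓ
prismBoundary = record
  { cells = On.poset
      {B = Σ (Subset 2 × Subset 3) λ (s , t) →
             Nonempty s × Nonempty t × ¬ (s ≡ ⊤ × t ≡ ⊤)}
      (×-poset (⊆-poset 2) (⊆-poset 3)) proj₁
  ; dim   = λ ((s , t) , _) → (∣ s ∣ ∸ 1) ℕ.+ (∣ t ∣ ∸ 1)
  }

ℤ₃ : Set
ℤ₃ = Fin 3

1+_ : ℤ₃ → ℤ₃
1+ zero           = suc zero
1+ suc zero       = suc (suc zero)
1+ suc (suc zero) = zero

data GridCell : Set where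
  vertex horizontal vertical quad : (i j : ℤ₃) → GridCell

gridVertices : GridCell → List (ℤ₃ × ℤ₃)
gridVertices (vertex i j)     = (i , j) ∷ []
gridVertices (horizontal i j) = (i , j) ∷ (1+ i , j) ∷ []
gridVertices (vertical i j)   = (i , j) ∷ (i , 1+ j) ∷ []
gridVertices (quad i j)       =
  (i , j) ∷ (1+ i , j) ∷ (1+ i , 1+ j) ∷ (i , 1+ j) ∷ []

gridDim : GridCell → ℕ
gridDim (vertex _ _)     = 0
gridDim (horizontal _ _) = 1
gridDim (vertical _ _)   = 1
gridDim (quad _ _)       = 2

gridTorus : CellComplex 0ℓ 0ℓ 0ℓ
gridTorus = record
  { cells = Interior.poset {R = λ a b → gridVertices a ⊆ₗ gridVertices b}
              id (λ a⊆b b⊆c → b⊆c ∘ a⊆b)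
  ; dim   = gridDim
  }

{-# OPTIONS --safe #-}

-- A cell of the slicing is a face of M with vertices on both sides of the level,
-- and its vertices are the crossing edges.  If any two crossing edges lie in a
-- common tetrahedron, then the crossing edges are all pairs ab with a in A below
-- and b in B above the level, and all aa′bb′ are faces.  An edge of the slicing
-- lies in just two facets, so A and B have at most three elements once both have
-- at least two; the facets that the quadrilaterals leave open then force the
-- prism (2 × 3) or the grid (3 × 3) and exclude 2 × 2.  If A = {a}, the slicing
-- is the link of a, a sphere in which any two of its V vertices are joined by an
-- edge.  Stellar subdivision preserves the Euler characteristic (toggling a
-- vertex of σ cancels the terms in which the complexes differ) and
-- connectedness, so V² - 7 V + 12 = 0; as V ≥ 4, the link is the boundary of the
-- 3-simplex.

module Submission where

open import Defs
open import Algebra.Bundles using (CommutativeSemiring)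
import Algebra.Properties.CommutativeMonoid.Sum as CommutativeMonoidSum
import Algebra.Properties.Group as GroupProperties
import Algebra.Properties.Semiring.Sum as SemiringSum
import Algebra.Solver.Ring.NaturalCoefficients.Default as SemiringSolver
open import Data.Bool.Base using (Bool; true; false; if_then_else_; _∨_)
import Data.Bool.Properties as Bool
import Data.Empty as Empty
open import Data.Fin.Base using (Fin; zero; suc)
open import Data.Fin.Properties using (any?; _≟_)
open import Data.Fin.Subset
  using (Subset; inside; outside; ⊤; ⊥; ⁅_⁆; ∣_∣; Nonempty; _∈_; _∉_; _⊆_; _∪_; ⋃)
open import Data.Fin.Subset.Properties
open import Data.Integer.Base as ℤ using (ℤ; 0ℤ; 1ℤ; -1ℤ; +_)
import Data.Integer.Properties as ℤ
open import Data.Integer.Solver using (module +-*-Solver)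
open import Data.List.Base as List using (List; []; _∷_; length; _++_; allFin)
open import Data.List.Membership.Propositional using () renaming (_∈_ to _∈ₗ_)
open import Data.List.Membership.Propositional.Properties
  using (∈-map⁺; ∈-map⁻; ∈-++⁺ˡ; ∈-++⁺ʳ; ∈-allFin)
import Data.List.Properties as List
open import Data.List.Relation.Unary.All as All using (All; []; _∷_)
open import Data.List.Relation.Unary.AllPairs using ([]; _∷_)
open import Data.List.Relation.Unary.Any using (here; there)
open import Data.List.Relation.Unary.Unique.Propositional using (Unique)
import Data.List.Relation.Unary.Unique.Propositional.Properties as Unique
open import Data.Nat.Base as ℕ using (ℕ; zero; suc; _∸_; s≤s; z≤n)
import Data.Nat.Properties as ℕ
import Data.Nat.Solver
open import Data.Product.Base using (Σ; ∃; ∃₂; _×_; _,_; proj₁; proj₂)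
open import Data.Product.Relation.Binary.Pointwise.NonDependent using (×-poset)
open import Data.Sum.Base as Sum using (_⊎_; inj₁; inj₂; [_,_]′)
open import Data.Vec.Base as Vec using (Vec; []; _∷_; here; there; lookup)
open import Data.Vec.Properties as Vec using (lookup-map; []=⇒lookup; lookup⇒[]=)
open import Data.Vec.Relation.Unary.All using ([]; _∷_)
import Data.Vec.Relation.Unary.All.Properties as VAll
open import Data.Vec.Relation.Unary.AllPairs using ([]; _∷_)
import Data.Vec.Relation.Unary.Unique.Propositional as Vec
import Data.Vec.Relation.Unary.Unique.Propositional.Properties as Vec
open import Function.Base using (id; _∘_)
open import Level using (Level; 0ℓ)
open import Relation.Binary.Construct.Closure.ReflexiveTransitive as Star
  using (Star; ε; _◅_; _◅◅_)
open import Relation.Binary.Construct.Interior.Symmetric using (lhs≤rhs; rhs≤lhs)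
import Relation.Binary.Construct.On as On
open import Relation.Binary.Definitions using (tri<; tri≈; tri>)
open import Relation.Binary.Morphism.Structures using (IsOrderIsomorphism)
open import Relation.Binary.PropositionalEquality
  using (_≡_; _≢_; refl; sym; trans; cong; cong₂; subst; ≢-sym; module ≡-Reasoning)
import Relation.Binary.Reasoning.Setoid as SetoidReasoning
open import Relation.Binary.Structures using (IsStrictTotalOrder)
open import Relation.Nullary using (¬_; Dec; yes; no; does; contradiction)
open import Relation.Nullary.Decidable as Dec using (_×-dec_; ¬?; decidable-stable)

open SimplicialComplex

-- The case A = {a} is not settled by counting at edges alone: in the six-vertex projective plane
-- and the seven-vertex torus any two vertices are also joined by an edge, and every edge lies in
-- two triangles. The topology of the link has to enter. It is given as a chain of isomorphisms,
-- stellar subdivisions and their inverses, so it is used through properties that survive each move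
-- in both directions. With V vertices, V (V - 1) / 2 edges and two thirds as many triangles, χ = 2
-- becomes the quadratic equation, with roots 3 and 4; the root 3 falls to the two distinct
-- triangles at an edge. Connectedness serves another purpose: the link of a in M might contain
-- vertices on the side of a that lie on no crossing edge, and a path in the link to the opposite
-- side rules them out. All pairs ab occur because a tetrahedron containing the crossing edges ab
-- and a′b′ also contains ab′ and a′b.

private
  variable
    a b ℓ ℓ₁ ℓ₂ c′ ℓ₁′ ℓ₂′ c″ ℓ₁″ ℓ₂″ : Level
    A : Set a
    B : Set b
    m n k : ℕ

-- Isomorphisms of cell complexes

module _ {X : CellComplex ℓ ℓ₁ ℓ₂} {Y : CellComplex c′ ℓ₁′ ℓ₂′} where
  private
    module X = CellComplex X
    module Y = CellComplex Y

  -- The order carries everything: antisymmetry recovers `≈` from `≤`, so congruence follows from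
  -- monotonicity and injectivity from its converse.
  order-iso : (to : X.Carrier → Y.Carrier) →
              (∀ {x y} → x X.≤ y → to x Y.≤ to y) →
              (∀ {x y} → to x Y.≤ to y → x X.≤ y) →
              (∀ y → ∃ λ x → to x Y.≈ y) →
              (∀ x → Y.dim (to x) ≡ X.dim x) → X ≅ Y
  order-iso to mono cancel surj dim = record
    { to = to
    ; isIso = record
      { isOrderMonomorphism = record
        { isOrderHomomorphism = record { cong = to-cong ; mono = mono }
        ; injective = λ eq → X.antisym (cancel (Y.reflexive eq))
                                       (cancel (Y.reflexive (Y.Eq.sym eq)))
        ; cancel = cancel
        }
      ; surjective = λ y → let x , tox≈y = surj y in
          x , λ z≈x → Y.Eq.trans (to-cong z≈x) tox≈y
      }
    ; dim≡ = dim
    }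
    where
    to-cong : ∀ {x y} → x X.≈ y → to x Y.≈ to y
    to-cong eq = Y.antisym (mono (X.reflexive eq)) (mono (X.reflexive (X.Eq.sym eq)))

≅-trans : {X : CellComplex ℓ ℓ₁ ℓ₂} {Y : CellComplex c′ ℓ₁′ ℓ₂′}
          {Z : CellComplex c″ ℓ₁″ ℓ₂″} → X ≅ Y → Y ≅ Z → X ≅ Z
≅-trans {X = X} f g = order-iso (G.to ∘ F.to) (G′.mono ∘ F′.mono) (F′.cancel ∘ G′.cancel)
  (λ z → let y , gy = G′.surjective z ; x , fx = F′.surjective y in
         x , gy (fx (CellComplex.Eq.refl X)))
  (λ x → trans (G.dim≡ (F.to x)) (F.dim≡ x))
  where
  module F = _≅_ f
  module G = _≅_ g
  module F′ = IsOrderIsomorphism F.isIso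
  module G′ = IsOrderIsomorphism G.isIso

-- Finite subsets, their images and restrictions

∣⁅x⁆∪p∣ : {x : Fin n} {p : Subset n} → x ∉ p → ∣ ⁅ x ⁆ ∪ p ∣ ≡ suc ∣ p ∣
∣⁅x⁆∪p∣ {x = zero}  {inside  ∷ p} x∉p = contradiction here x∉p
∣⁅x⁆∪p∣ {x = zero}  {outside ∷ p} x∉p = cong (suc ∘ ∣_∣) (∪-identityˡ p)
∣⁅x⁆∪p∣ {x = suc x} {inside  ∷ p} x∉p = cong suc (∣⁅x⁆∪p∣ (x∉p ∘ there))
∣⁅x⁆∪p∣ {x = suc x} {outside ∷ p} x∉p = ∣⁅x⁆∪p∣ (x∉p ∘ there)

∣p∣<∣q∣⇒q⊈p : {p q : Subset n} → ∣ p ∣ ℕ.< ∣ q ∣ → ∃ λ x → x ∈ q × x ∉ p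
∣p∣<∣q∣⇒q⊈p {p = p} {q} lt with any? (λ x → (x ∈? q) ×-dec ¬? (x ∈? p))
... | yes found = found
... | no ¬found = contradiction lt (ℕ.≤⇒≯ (p⊆q⇒∣p∣≤∣q∣ λ {x} x∈q →
        decidable-stable (x ∈? p) λ x∉p → ¬found (x , x∈q , x∉p)))

p⊆q∧∣q∣≤∣p∣⇒p≡q : {p q : Subset n} → p ⊆ q → ∣ q ∣ ℕ.≤ ∣ p ∣ → p ≡ q
p⊆q∧∣q∣≤∣p∣⇒p≡q {p = p} {q} p⊆q le = ⊆-antisym p⊆q λ {x} x∈q →
  decidable-stable (x ∈? p) λ x∉p → ℕ.<⇒≱ (p⊂q⇒∣p∣<∣q∣ (p⊆q , x , x∈q , x∉p)) le

nonempty⇒1≤∣p∣ : {p : Subset n} → Nonempty p → 1 ℕ.≤ ∣ p ∣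
nonempty⇒1≤∣p∣ {p = p} (x , x∈p) = subst (ℕ._≤ ∣ p ∣) (∣⁅x⁆∣≡1 x)
  (p⊆q⇒∣p∣≤∣q∣ λ y∈ → subst (_∈ p) (sym (x∈⁅y⁆⇒x≡y x y∈)) x∈p)

⟦_⟧ : List (Fin n) → Subset n
⟦ xs ⟧ = ⋃ (List.map ⁅_⁆ xs)

∈⟦⟧⁺ : {x : Fin n} {xs : List (Fin n)} → x ∈ₗ xs → x ∈ ⟦ xs ⟧
∈⟦⟧⁺ {x = x} (here refl) = x∈p∪q⁺ (inj₁ (x∈⁅x⁆ x))
∈⟦⟧⁺         (there x∈xs) = x∈p∪q⁺ (inj₂ (∈⟦⟧⁺ x∈xs))

∈⟦⟧⁻ : {x : Fin n} (xs : List (Fin n)) → x ∈ ⟦ xs ⟧ → x ∈ₗ xs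
∈⟦⟧⁻ []       x∈ = contradiction x∈ ∉⊥
∈⟦⟧⁻ (y ∷ xs) x∈ = [ here ∘ x∈⁅y⁆⇒x≡y y , there ∘ ∈⟦⟧⁻ xs ]′ (x∈p∪q⁻ ⁅ y ⁆ _ x∈)

⟦⟧⊆ : {xs : List (Fin n)} {p : Subset n} → All (_∈ p) xs → ⟦ xs ⟧ ⊆ p
⟦⟧⊆ {xs = xs} xs∈p x∈ = All.lookup xs∈p (∈⟦⟧⁻ xs x∈)

∉⟦⟧⇒fresh : {x : Fin n} {xs : List (Fin n)} → x ∉ ⟦ xs ⟧ → All (x ≢_) xs
∉⟦⟧⇒fresh {xs = xs} x∉ = All.tabulate λ { y∈ refl → x∉ (∈⟦⟧⁺ {xs = xs} y∈) }

∣⟦⟧∣ : {xs : List (Fin n)} → Unique xs → ∣ ⟦ xs ⟧ ∣ ≡ length xs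
∣⟦⟧∣ {n = n} []      = ∣⊥∣≡0 n
∣⟦⟧∣ {xs = x ∷ xs} (x∉xs ∷ uniq) =
  trans (∣⁅x⁆∪p∣ λ x∈ → All.lookup x∉xs (∈⟦⟧⁻ xs x∈) refl) (cong suc (∣⟦⟧∣ uniq))

image : Vec (Fin n) m → Subset m → Subset n
image []       []            = ⊥
image (x ∷ xs) (inside  ∷ p) = ⁅ x ⁆ ∪ image xs p
image (x ∷ xs) (outside ∷ p) = image xs p

∈image⁺ : (xs : Vec (Fin n) m) {p : Subset m} {i : Fin m} → i ∈ p → lookup xs i ∈ image xs p
∈image⁺ (x ∷ xs) here = x∈p∪q⁺ (inj₁ (x∈⁅x⁆ x))
∈image⁺ (x ∷ xs) {inside  ∷ p} (there i∈p) = x∈p∪q⁺ (inj₂ (∈image⁺ xs i∈p))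
∈image⁺ (x ∷ xs) {outside ∷ p} (there i∈p) = ∈image⁺ xs i∈p

∈image⁻ : (xs : Vec (Fin n) m) (p : Subset m) {x : Fin n} → x ∈ image xs p →
          ∃ λ i → i ∈ p × lookup xs i ≡ x
∈image⁻ []       []            x∈ = contradiction x∈ ∉⊥
∈image⁻ (y ∷ xs) (inside  ∷ p) x∈ with x∈p∪q⁻ ⁅ y ⁆ _ x∈
... | inj₁ x∈y = zero , here , sym (x∈⁅y⁆⇒x≡y y x∈y)
... | inj₂ x∈  = let i , i∈ , eq = ∈image⁻ xs p x∈ in suc i , there i∈ , eq
∈image⁻ (y ∷ xs) (outside ∷ p) x∈ = let i , i∈ , eq = ∈image⁻ xs p x∈ in suc i , there i∈ , eq

-- The summand `p` lets one induction serve both factors of a join: it is applied with the image of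
-- the other list, and then with `⊥`.
∣image∪p∣ : {xs : Vec (Fin n) m} → Vec.Unique xs → (t : Subset m) {p : Subset n} →
            (∀ i → lookup xs i ∉ p) → ∣ image xs t ∪ p ∣ ≡ ∣ t ∣ ℕ.+ ∣ p ∣
∣image∪p∣ [] [] {p} ∉p = cong ∣_∣ (∪-identityˡ p)
∣image∪p∣ {xs = x ∷ xs} (x∉xs ∷ uniq) (inside ∷ t) {p} ∉p = begin
  ∣ (⁅ x ⁆ ∪ image xs t) ∪ p ∣ ≡⟨ cong ∣_∣ (∪-assoc ⁅ x ⁆ (image xs t) p) ⟩
  ∣ ⁅ x ⁆ ∪ (image xs t ∪ p) ∣ ≡⟨ ∣⁅x⁆∪p∣ x∉ ⟩
  suc ∣ image xs t ∪ p ∣       ≡⟨ cong suc (∣image∪p∣ uniq t (∉p ∘ suc)) ⟩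
  suc (∣ t ∣ ℕ.+ ∣ p ∣)        ∎
  where
  open ≡-Reasoning
  x∉ : x ∉ image xs t ∪ p
  x∉ x∈ with x∈p∪q⁻ (image xs t) p x∈
  ... | inj₁ x∈xs = let i , _ , eq = ∈image⁻ xs t x∈xs in VAll.lookup⁺ x∉xs i (sym eq)
  ... | inj₂ x∈p  = ∉p zero x∈p
∣image∪p∣ (_ ∷ uniq) (outside ∷ t) ∉p = ∣image∪p∣ uniq t (∉p ∘ suc)

restrict : Vec (Fin n) m → Subset n → Subset m
restrict xs p = Vec.map (lookup p) xs

∈restrict⁺ : (xs : Vec (Fin n) m) {p : Subset n} {i : Fin m} → lookup xs i ∈ p → i ∈ restrict xs p
∈restrict⁺ xs {p} {i} ∈p = lookup⇒[]= i _ (trans (lookup-map i (lookup p) xs) ([]=⇒lookup ∈p))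

∈restrict⁻ : (xs : Vec (Fin n) m) {p : Subset n} {i : Fin m} → i ∈ restrict xs p → lookup xs i ∈ p
∈restrict⁻ xs {p} {i} i∈ = lookup⇒[]= _ _ (trans (sym (lookup-map i (lookup p) xs)) ([]=⇒lookup i∈))

-- The Euler characteristic

∑ : List A → (A → ℤ) → ℤ
∑ []       f = 0ℤ
∑ (x ∷ xs) f = f x ℤ.+ ∑ xs f

∑-cong : (xs : List A) {f g : A → ℤ} → (∀ x → f x ≡ g x) → ∑ xs f ≡ ∑ xs g
∑-cong []       eq = refl
∑-cong (x ∷ xs) eq = cong₂ ℤ._+_ (eq x) (∑-cong xs eq)

∑-zero : (xs : List A) → ∑ xs (λ _ → 0ℤ) ≡ 0ℤ
∑-zero []       = refl
∑-zero (x ∷ xs) = trans (ℤ.+-identityˡ (∑ xs _)) (∑-zero xs)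

∑-+ : (xs : List A) (f g : A → ℤ) → ∑ xs (λ x → f x ℤ.+ g x) ≡ ∑ xs f ℤ.+ ∑ xs g
∑-+ []       f g = refl
∑-+ (x ∷ xs) f g = trans (cong (ℤ._+_ (f x ℤ.+ g x)) (∑-+ xs f g))
  (solve 4 (λ a b c d → (a :+ b) :+ (c :+ d) := (a :+ c) :+ (b :+ d)) refl
     (f x) (g x) (∑ xs f) (∑ xs g))
  where open +-*-Solver

∑-*ˡ : (xs : List A) (k : ℤ) (f : A → ℤ) → ∑ xs (λ x → k ℤ.* f x) ≡ k ℤ.* ∑ xs f
∑-*ˡ []       k f = sym (ℤ.*-zeroʳ k)
∑-*ˡ (x ∷ xs) k f = trans (cong (ℤ._+_ (k ℤ.* f x)) (∑-*ˡ xs k f)) (sym (ℤ.*-distribˡ-+ k (f x) (∑ xs f)))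

∑-*ʳ : (xs : List A) (k : ℤ) (f : A → ℤ) → ∑ xs (λ x → f x ℤ.* k) ≡ ∑ xs f ℤ.* k
∑-*ʳ xs k f = trans (∑-cong xs λ x → ℤ.*-comm (f x) k)
                    (trans (∑-*ˡ xs k f) (ℤ.*-comm k (∑ xs f)))

∑-swap : (xs : List A) (ys : List B) (f : A → B → ℤ) →
         ∑ xs (λ x → ∑ ys (f x)) ≡ ∑ ys (λ y → ∑ xs (λ x → f x y))
∑-swap []       ys f = sym (∑-zero ys)
∑-swap (x ∷ xs) ys f = trans (cong (ℤ._+_ (∑ ys (f x))) (∑-swap xs ys f))
                              (sym (∑-+ ys (f x) (λ y → ∑ xs λ x → f x y)))

∑-++ : (xs ys : List A) (f : A → ℤ) → ∑ (xs ++ ys) f ≡ ∑ xs f ℤ.+ ∑ ys f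
∑-++ []       ys f = sym (ℤ.+-identityˡ (∑ ys f))
∑-++ (x ∷ xs) ys f = trans (cong (ℤ._+_ (f x)) (∑-++ xs ys f)) (sym (ℤ.+-assoc (f x) (∑ xs f) (∑ ys f)))

∑-map : (h : A → B) (xs : List A) (f : B → ℤ) → ∑ (List.map h xs) f ≡ ∑ xs (f ∘ h)
∑-map h []       f = refl
∑-map h (x ∷ xs) f = cong (ℤ._+_ (f (h x))) (∑-map h xs f)

𝟙 : {P : Set a} → Dec P → ℤ
𝟙 P? = if does P? then 1ℤ else 0ℤ

𝟙-yes : {P : Set a} (P? : Dec P) → P → 𝟙 P? ≡ 1ℤ
𝟙-yes (yes _) p = refl
𝟙-yes (no ¬p) p = contradiction p ¬p

𝟙-no : {P : Set a} (P? : Dec P) → ¬ P → 𝟙 P? ≡ 0ℤ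
𝟙-no (yes p) ¬p = contradiction p ¬p
𝟙-no (no _)  ¬p = refl

𝟙-cong : {P : Set a} {Q : Set b} (P? : Dec P) (Q? : Dec Q) → (P → Q) → (Q → P) → 𝟙 P? ≡ 𝟙 Q?
𝟙-cong (yes p) Q? f g = sym (𝟙-yes Q? (f p))
𝟙-cong (no ¬p) Q? f g = sym (𝟙-no Q? (¬p ∘ g))

Enumerates : {A : Set a} → List A → Set a
Enumerates xs = Unique xs × ∀ x → x ∈ₗ xs

∑-𝟙-none : {P : A → Set b} (P? : ∀ x → Dec (P x)) (xs : List A) → (∀ x → x ∈ₗ xs → ¬ P x) →
           ∑ xs (𝟙 ∘ P?) ≡ 0ℤ
∑-𝟙-none P? []       none = refl
∑-𝟙-none P? (x ∷ xs) none = cong₂ ℤ._+_ (𝟙-no (P? x) (none x (here refl)))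
                              (∑-𝟙-none P? xs λ y → none y ∘ there)

∑-𝟙-one : {P : A → Set b} (P? : ∀ x → Dec (P x)) {xs : List A} → Unique xs →
          ∀ {x} → x ∈ₗ xs → P x → (∀ y → P y → y ≡ x) → ∑ xs (𝟙 ∘ P?) ≡ 1ℤ
∑-𝟙-one P? {x ∷ xs} (x∉xs ∷ uniq) (here refl) px only = cong₂ ℤ._+_ (𝟙-yes (P? x) px)
  (∑-𝟙-none P? xs λ y y∈ py → All.lookup x∉xs y∈ (sym (only y py)))
∑-𝟙-one P? {y ∷ xs} (y∉xs ∷ uniq) (there x∈) px only = cong₂ ℤ._+_
  (𝟙-no (P? y) λ py → All.lookup y∉xs x∈ (only y py))
  (∑-𝟙-one P? uniq x∈ px only)

-- The device for double counting: an indicator is expanded into a sum over its unique witness,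
-- after which the order of summation can be exchanged.
∑-𝟙 : {P : A → Set b} {Q : Set ℓ} (P? : ∀ x → Dec (P x)) (Q? : Dec Q) {xs : List A} →
      Enumerates xs → (∀ x → P x → Q) → (Q → ∃ λ x → P x × ∀ y → P y → y ≡ x) →
      ∑ xs (𝟙 ∘ P?) ≡ 𝟙 Q?
∑-𝟙 P? (yes q) (uniq , all) P⇒Q Q⇒P = let x , px , only = Q⇒P q in
                                      ∑-𝟙-one P? uniq (all x) px only
∑-𝟙 P? (no ¬q) {xs} _ P⇒Q Q⇒P = ∑-𝟙-none P? xs λ x _ → ¬q ∘ P⇒Q x

subsets : ∀ n → List (Subset n)
subsets zero    = [] ∷ []
subsets (suc n) = List.map (outside ∷_) (subsets n) ++ List.map (inside ∷_) (subsets n)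

enumerates-subsets : ∀ n → Enumerates (subsets n)
enumerates-subsets zero    = ([] ∷ []) , λ { [] → here refl }
enumerates-subsets (suc n) = let uniq , all = enumerates-subsets n in
  Unique.++⁺ (Unique.map⁺ Vec.∷-injectiveʳ uniq) (Unique.map⁺ Vec.∷-injectiveʳ uniq)
    (λ (s∈ , s∈′) → disjoint s∈ s∈′) ,
  λ { (outside ∷ s) → ∈-++⁺ˡ (∈-map⁺ (outside ∷_) (all s))
    ; (inside  ∷ s) → ∈-++⁺ʳ _ (∈-map⁺ (inside ∷_) (all s)) }
  where
  disjoint : ∀ {s} → s ∈ₗ List.map (outside ∷_) (subsets n) →
             ¬ (s ∈ₗ List.map (inside ∷_) (subsets n))
  disjoint s∈ s∈′ with ∈-map⁻ (outside ∷_) s∈ | ∈-map⁻ (inside ∷_) s∈′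
  ... | _ , _ , refl | _ , _ , ()

_≟ₛ_ : (s t : Subset n) → Dec (s ≡ t)
_≟ₛ_ = Vec.≡-dec Bool._≟_

∑-subsets-suc : (f : Subset (suc n) → ℤ) →
  ∑ (subsets (suc n)) f ≡
  ∑ (subsets n) (λ s → f (outside ∷ s)) ℤ.+ ∑ (subsets n) (λ s → f (inside ∷ s))
∑-subsets-suc {n} f = trans (∑-++ (List.map (outside ∷_) (subsets n)) _ f)
  (cong₂ ℤ._+_ (∑-map (outside ∷_) (subsets n) f) (∑-map (inside ∷_) (subsets n) f))

-- This is (-1)^(k-1), the sign belonging to the dimension of a simplex with k vertices. Starting at
-- -1 keeps the recursion uniform for `∑-toggle`, where the empty set is also summed over.
sign : ℕ → ℤ
sign zero    = -1ℤ
sign (suc k) = ℤ.- sign k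

-- Toggling an element of σ pairs off the summands with opposite signs.
∑-toggle : {σ : Subset n} (g : Subset n → ℤ) → Nonempty σ →
           ∑ (subsets n) (λ s → g (σ ∪ s) ℤ.* sign ∣ s ∣) ≡ 0ℤ
∑-toggle {suc n} {inside ∷ σ} g (zero , here) = begin
  ∑ (subsets (suc n)) _
    ≡⟨ ∑-subsets-suc (λ s → g ((inside ∷ σ) ∪ s) ℤ.* sign ∣ s ∣) ⟩
  ∑ (subsets n) (λ s → h s ℤ.* sign ∣ s ∣) ℤ.+ ∑ (subsets n) (λ s → h s ℤ.* (ℤ.- sign ∣ s ∣))
    ≡⟨ ∑-+ (subsets n) _ _ ⟨
  ∑ (subsets n) (λ s → (h s ℤ.* sign ∣ s ∣) ℤ.+ (h s ℤ.* (ℤ.- sign ∣ s ∣)))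
    ≡⟨ ∑-cong (subsets n) (λ s → solve 2 (λ x y → x :* y :+ x :* (:- y) := con 0ℤ) refl
                                   (h s) (sign ∣ s ∣)) ⟩
  ∑ (subsets n) (λ _ → 0ℤ)
    ≡⟨ ∑-zero (subsets n) ⟩
  0ℤ ∎
  where
  open ≡-Reasoning
  open +-*-Solver
  h : Subset n → ℤ
  h s = g (inside ∷ (σ ∪ s))
∑-toggle {suc n} {b ∷ σ} g (suc v , there v∈σ) = trans (∑-subsets-suc (λ s → g ((b ∷ σ) ∪ s) ℤ.* sign ∣ s ∣))
  (cong₂ ℤ._+_ (∑-toggle (λ s → g (_ ∷ s)) (v , v∈σ))
    -- Subsets containing 0 have the opposite sign; moving the minus into `g` makes the induction
    -- hypothesis applicable to them.
    (trans (∑-cong (subsets n) λ s → trans (sym (ℤ.neg-distribʳ-* (h s) (sign ∣ s ∣)))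
                                           (ℤ.neg-distribˡ-* (h s) (sign ∣ s ∣)))
           (∑-toggle (λ s → ℤ.- g (_ ∷ s)) (v , v∈σ))))
  where
  h : Subset n → ℤ
  h s = g ((b ∨ inside) ∷ (σ ∪ s))

nonemptyFace? : (K : SimplicialComplex n) (s : Subset n) → Dec (Face K s × Nonempty s)
nonemptyFace? K s = face? K s ×-dec nonempty? s

χ : SimplicialComplex n → ℤ
χ {n} K = ∑ (subsets n) λ s → 𝟙 (nonemptyFace? K s) ℤ.* sign ∣ s ∣

-- For each `s` the contributions before and after differ by the indicator of "σ ∪ s is a face": if
-- σ ⊆ s the face s is lost, and otherwise the cone over s is gained, with the opposite sign. For
-- empty `s` the gain is the new vertex itself. The difference depends on `s` only through σ ∪ s, so
-- its signed sum vanishes by `∑-toggle`.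
χ-subdivide : (K : SimplicialComplex n) (σ : Subset n) → Nonempty σ →
              χ K ≡ χ (subdivide K σ)
χ-subdivide {n} K σ (v , v∈σ) = begin
  χ K
    ≡⟨ ∑-cong (subsets n) split ⟩
  ∑ (subsets n) (λ s → (old s ℤ.+ new s) ℤ.+ star s)
    ≡⟨ ∑-+ (subsets n) (λ s → old s ℤ.+ new s) star ⟩
  ∑ (subsets n) (λ s → old s ℤ.+ new s) ℤ.+ ∑ (subsets n) star
    ≡⟨ cong₂ ℤ._+_ (∑-+ (subsets n) old new) (∑-toggle (λ s → 𝟙 (face? K s)) (v , v∈σ)) ⟩
  (∑ (subsets n) old ℤ.+ ∑ (subsets n) new) ℤ.+ 0ℤ
    ≡⟨ ℤ.+-identityʳ _ ⟩
  ∑ (subsets n) old ℤ.+ ∑ (subsets n) new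
    ≡⟨ ∑-subsets-suc (λ s → 𝟙 (nonemptyFace? (subdivide K σ) s) ℤ.* sign ∣ s ∣) ⟨
  χ (subdivide K σ) ∎
  where
  open ≡-Reasoning
  old new star : Subset n → ℤ
  old s  = 𝟙 (nonemptyFace? (subdivide K σ) (outside ∷ s)) ℤ.* sign ∣ s ∣
  new s  = 𝟙 (nonemptyFace? (subdivide K σ) (inside ∷ s)) ℤ.* ℤ.- sign ∣ s ∣
  star s = 𝟙 (face? K (σ ∪ s)) ℤ.* sign ∣ s ∣

  split : ∀ s → 𝟙 (nonemptyFace? K s) ℤ.* sign ∣ s ∣ ≡ (old s ℤ.+ new s) ℤ.+ star s
  split s = go (σ ⊆? s)
    where
    open +-*-Solver
    w p q : ℤ
    w = sign ∣ s ∣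
    p = 𝟙 (nonemptyFace? K s)
    q = 𝟙 (face? K (σ ∪ s))
    combine : ∀ {x y} → 𝟙 (nonemptyFace? (subdivide K σ) (outside ∷ s)) ≡ x →
              𝟙 (nonemptyFace? (subdivide K σ) (inside ∷ s)) ≡ y →
              p ℤ.* w ≡ (x ℤ.* w ℤ.+ y ℤ.* (ℤ.- w)) ℤ.+ q ℤ.* w →
              p ℤ.* w ≡ (old s ℤ.+ new s) ℤ.+ star s
    combine refl refl eq = eq
    go : Dec (σ ⊆ s) → p ℤ.* w ≡ (old s ℤ.+ new s) ℤ.+ star s
    go (yes σ⊆s) = combine
      (𝟙-no (nonemptyFace? (subdivide K σ) (outside ∷ s)) λ ((σ⊈s , _) , _) → σ⊈s σ⊆s)
      (𝟙-no (nonemptyFace? (subdivide K σ) (inside ∷ s)) λ ((σ⊈s , _) , _) → σ⊈s σ⊆s)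
      (trans
        (cong (ℤ._* w) (𝟙-cong (nonemptyFace? K s) (face? K (σ ∪ s))
          (λ (face , _) → closed K ([ σ⊆s , id ]′ ∘ x∈p∪q⁻ σ s) face)
          (λ face → closed K (x∈p∪q⁺ ∘ inj₂) face , v , σ⊆s v∈σ)))
        (solve 2 (λ q w → q :* w := (con 0ℤ :* w :+ con 0ℤ :* (:- w)) :+ q :* w) refl q w))
    go (no σ⊈s) = combine
      (𝟙-cong (nonemptyFace? (subdivide K σ) (outside ∷ s)) (nonemptyFace? K s)
        (λ { ((_ , face) , suc u , there u∈s) → face , u , u∈s })
        (λ (face , u , u∈s) → (σ⊈s , face) , suc u , there u∈s))
      (𝟙-cong (nonemptyFace? (subdivide K σ) (inside ∷ s)) (face? K (σ ∪ s))
        (λ ((_ , face) , _) → face) (λ face → (σ⊈s , face) , zero , here))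
      (solve 3 (λ p q w → p :* w := (p :* w :+ q :* (:- w)) :+ q :* w) refl p q w)

-- Both sums are rewritten as one sum over the graph of the isomorphism: each face of `K` has one
-- partner in `L` and conversely, and partners have equal signs.
χ-iso : {K : SimplicialComplex m} {L : SimplicialComplex n} →
        simplicialCells K ≅ simplicialCells L → χ K ≡ χ L
χ-iso {m} {n} {K} {L} K≅L = begin
  ∑ (subsets m) (λ s → 𝟙 (nonemptyFace? K s) ℤ.* sign ∣ s ∣)
    ≡⟨ ∑-cong (subsets m) (λ s → cong (ℤ._* sign ∣ s ∣)
         (∑-𝟙 (R? s) (nonemptyFace? K s) (enumerates-subsets n)
           (λ _ → proj₁) λ face → _ , (face , refl) , λ t (face′ , eq) →
             trans (sym eq) (irr face′ face))) ⟨
  ∑ (subsets m) (λ s → ∑ (subsets n) (λ t → 𝟙 (R? s t)) ℤ.* sign ∣ s ∣)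
    ≡⟨ ∑-cong (subsets m) (λ s → ∑-*ʳ (subsets n) (sign ∣ s ∣) _) ⟨
  ∑ (subsets m) (λ s → ∑ (subsets n) (λ t → 𝟙 (R? s t) ℤ.* sign ∣ s ∣))
    ≡⟨ ∑-cong (subsets m) (λ s → ∑-cong (subsets n) (same s)) ⟩
  ∑ (subsets m) (λ s → ∑ (subsets n) (λ t → 𝟙 (R? s t) ℤ.* sign ∣ t ∣))
    ≡⟨ ∑-swap (subsets m) (subsets n) _ ⟩
  ∑ (subsets n) (λ t → ∑ (subsets m) (λ s → 𝟙 (R? s t) ℤ.* sign ∣ t ∣))
    ≡⟨ ∑-cong (subsets n) (λ t → ∑-*ʳ (subsets m) (sign ∣ t ∣) _) ⟩
  ∑ (subsets n) (λ t → ∑ (subsets m) (λ s → 𝟙 (R? s t)) ℤ.* sign ∣ t ∣)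
    ≡⟨ ∑-cong (subsets n) (λ t → cong (ℤ._* sign ∣ t ∣)
         (∑-𝟙 (λ s → R? s t) (nonemptyFace? L t) (enumerates-subsets m)
           (λ s (face , eq) → subst (λ t → Face L t × Nonempty t) eq (proj₂ (to (s , face))))
           λ face → let (s , sface) , eq = Iso.surjective (t , face) in
             s , (sface , eq refl) , λ s′ (face′ , eq′) →
               Iso.injective (trans eq′ (sym (eq {s , sface} refl))))) ⟩
  χ L ∎
  where
  open ≡-Reasoning
  open _≅_ K≅L
  module Iso = IsOrderIsomorphism isIso
  R : Subset m → Subset n → Set
  R s t = Σ (Face K s × Nonempty s) λ face → proj₁ (to (s , face)) ≡ t
  -- A cell contains a proof of being a face, on which `to` might depend; congruence for `≈`, which
  -- compares only the vertex sets, excludes this.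
  irr : ∀ {s} (face face′ : Face K s × Nonempty s) → proj₁ (to (s , face)) ≡ proj₁ (to (s , face′))
  irr {s} face face′ = Iso.cong {s , face} {s , face′} refl
  R? : ∀ s t → Dec (R s t)
  R? s t with nonemptyFace? K s
  ... | no ¬face = no (¬face ∘ proj₁)
  ... | yes face = Dec.map′ (face ,_) (λ (face′ , eq) → trans (irr face face′) eq)
                            (proj₁ (to (s , face)) ≟ₛ t)
  -- The dimension is a truncated difference, so equal dimensions give equal sizes only for nonempty
  -- sets.
  ∸1-injective : ∀ {i j} → 1 ℕ.≤ i → 1 ℕ.≤ j → i ∸ 1 ≡ j ∸ 1 → i ≡ j
  ∸1-injective (s≤s _) (s≤s _) = cong suc
  same : ∀ s t → 𝟙 (R? s t) ℤ.* sign ∣ s ∣ ≡ 𝟙 (R? s t) ℤ.* sign ∣ t ∣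
  same s t with R? s t
  ... | no  _             = refl
  ... | yes (face , refl) = cong (λ k → 1ℤ ℤ.* sign k)
        (∸1-injective (nonempty⇒1≤∣p∣ (proj₂ face)) (nonempty⇒1≤∣p∣ (proj₂ (proj₂ (to (s , face)))))
                      (sym (dim≡ (s , face))))

χ-invariant : {K : SimplicialComplex m} {L : SimplicialComplex n} → K ∼ L → χ K ≡ χ L
χ-invariant (iso {K = K} {L} K≅L)         = χ-iso {K = K} {L} K≅L
χ-invariant (stellar {K = K} σ ne _)      = χ-subdivide K σ ne
χ-invariant (∼-sym K∼L)                   = sym (χ-invariant K∼L)
χ-invariant (∼-trans K∼L L∼N)             = trans (χ-invariant K∼L) (χ-invariant L∼N)

-- Connectedness

module _ (X : CellComplex ℓ ℓ₁ ℓ₂) where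
  open CellComplex X

  Zigzag : Carrier → Carrier → Set _
  Zigzag = Star (λ x y → x ≤ y ⊎ y ≤ x)

  IsConnected : Set _
  IsConnected = ∀ x y → Zigzag x y

zigzag-sym : (X : CellComplex ℓ ℓ₁ ℓ₂) → ∀ {x y} → Zigzag X x y → Zigzag X y x
zigzag-sym X = Star.reverse Sum.swap

-- Weaker than a monotone surjection on purpose: `expand` below sends comparable faces to faces
-- joined by a path, and it meets every component without being onto.
connected-transfer : (X : CellComplex ℓ ℓ₁ ℓ₂) (Y : CellComplex c′ ℓ₁′ ℓ₂′) →
  let module X = CellComplex X ; module Y = CellComplex Y in
  (f : X.Carrier → Y.Carrier) → (∀ {x y} → x X.≤ y → Zigzag Y (f x) (f y)) →
  (∀ y → ∃ λ x → Zigzag Y (f x) y) → IsConnected X → IsConnected Y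
connected-transfer X Y f mono onto conn y y′ =
  let x , fx~y = onto y ; x′ , fx′~y′ = onto y′ in
  zigzag-sym Y fx~y ◅◅ Star.kleisliStar f [ mono , zigzag-sym Y ∘ mono ]′ (conn x x′) ◅◅ fx′~y′

module _ (K : SimplicialComplex n) (σ : Subset n) (σ-nonempty : Nonempty σ) (σ-face : Face K σ) where
  private
    module K  = CellComplex (simplicialCells K)
    module K′ = CellComplex (simplicialCells (subdivide K σ))

    -- The carrier map: each simplex of the subdivision goes to the smallest face of `K` that
    -- contains it geometrically, the new vertex lying inside σ.
    collapse : K′.Carrier → K.Carrier
    collapse (outside ∷ s , (_ , face) , suc v , there v∈s) = s , face , v , v∈s
    collapse (inside  ∷ s , (_ , face) , _) = σ ∪ s , face , proj₁ σ-nonempty ,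
                                              x∈p∪q⁺ (inj₁ (proj₂ σ-nonempty))

    apex : K′.Carrier
    apex = inside ∷ ⊥ ,
      ((λ σ⊆⊥ → ∉⊥ (σ⊆⊥ (proj₂ σ-nonempty))) ,
       closed K ([ id , (λ x∈⊥ → contradiction x∈⊥ ∉⊥) ]′ ∘ x∈p∪q⁻ σ ⊥) σ-face) ,
      zero , here

    keep : ∀ s → Face K s → Nonempty s → ¬ (σ ⊆ s) → K′.Carrier
    keep s face (v , v∈s) σ⊈s = outside ∷ s , (σ⊈s , face) , suc v , there v∈s

    expand : K.Carrier → K′.Carrier
    expand (s , face , ne) with σ ⊆? s
    ... | yes _  = apex
    ... | no σ⊈s = keep s face ne σ⊈s

    collapse-mono : ∀ {x y} → x K′.≤ y → collapse x K.≤ collapse y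
    collapse-mono {outside ∷ s , _ , suc _ , there _} {outside ∷ t , _ , suc _ , there _} s⊆t =
      drop-∷-⊆ s⊆t
    collapse-mono {outside ∷ s , _ , suc _ , there _} {inside ∷ t , _} s⊆t =
      x∈p∪q⁺ ∘ inj₂ ∘ drop-∷-⊆ s⊆t
    collapse-mono {inside ∷ s , _} {inside ∷ t , _} s⊆t =
      x∈p∪q⁺ ∘ Sum.map₂ (drop-∷-⊆ s⊆t) ∘ x∈p∪q⁻ σ s
    collapse-mono {inside ∷ s , _} {outside ∷ t , _} s⊆t with s⊆t here
    ... | ()

    expand-mono : ∀ {x y} → x K.≤ y → Zigzag (simplicialCells (subdivide K σ)) (expand x) (expand y)
    expand-mono {s , sface , sne} {t , tface , tne} s⊆t with σ ⊆? s | σ ⊆? t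
    ... | yes σ⊆s | yes σ⊆t = ε
    ... | yes σ⊆s | no σ⊈t = contradiction (λ {x} x∈σ → s⊆t (σ⊆s {x} x∈σ)) σ⊈t
    ... | no σ⊈s | no σ⊈t = inj₁ (s⊆s s⊆t) ◅ ε
    -- The path runs through the cone over `s`, which contains both `s` and the apex.
    ... | no σ⊈s | yes σ⊆t =
      _◅_ {j = inside ∷ s , (σ⊈s , closed K ([ σ⊆t , s⊆t ]′ ∘ x∈p∪q⁻ σ s) tface) , zero , here}
        (inj₁ (out⊆ id)) (inj₂ (in⊆in ⊥⊆) ◅ ε)

    collapse-onto : ∀ y → ∃ λ x → Zigzag (simplicialCells K) (collapse x) y
    collapse-onto (s , face , ne) with σ ⊆? s
    ... | yes σ⊆s = apex , inj₁ ([ σ⊆s , (λ x∈⊥ → contradiction x∈⊥ ∉⊥) ]′ ∘ x∈p∪q⁻ σ ⊥) ◅ ε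
    ... | no σ⊈s = keep s face ne σ⊈s , inj₁ id ◅ ε

    expand-onto : ∀ y → ∃ λ x → Zigzag (simplicialCells (subdivide K σ)) (expand x) y
    expand-onto (outside ∷ s , (σ⊈s , face) , suc v , there v∈s) = (s , face , v , v∈s) , path
      where
      path : Zigzag (simplicialCells (subdivide K σ)) (expand (s , face , v , v∈s)) _
      path with σ ⊆? s
      ... | yes σ⊆s = contradiction (λ {x} → σ⊆s {x}) σ⊈s
      ... | no _    = inj₁ id ◅ ε
    expand-onto (inside ∷ s , _) = (σ , σ-face , σ-nonempty) , path
      where
      path : Zigzag (simplicialCells (subdivide K σ)) (expand (σ , σ-face , σ-nonempty)) _
      path with σ ⊆? σ
      ... | yes _  = inj₁ (in⊆in ⊥⊆) ◅ ε
      ... | no σ⊈σ = contradiction (λ {x} → id {A = x ∈ σ}) σ⊈σ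

  connected-subdivide⁺ : IsConnected (simplicialCells K) → IsConnected (simplicialCells (subdivide K σ))
  connected-subdivide⁺ = connected-transfer (simplicialCells K) (simplicialCells (subdivide K σ))
    expand expand-mono expand-onto

  connected-subdivide⁻ : IsConnected (simplicialCells (subdivide K σ)) → IsConnected (simplicialCells K)
  connected-subdivide⁻ = connected-transfer (simplicialCells (subdivide K σ)) (simplicialCells K) collapse
    (λ x≤y → inj₁ (collapse-mono x≤y) ◅ ε) collapse-onto

module _ {K : SimplicialComplex m} {L : SimplicialComplex n}
         (K≅L : simplicialCells K ≅ simplicialCells L) where
  open _≅_ K≅L
  private
    module Iso = IsOrderIsomorphism isIso

  connected-iso⁺ : IsConnected (simplicialCells K) → IsConnected (simplicialCells L)
  connected-iso⁺ = connected-transfer (simplicialCells K) (simplicialCells L) to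
    (λ x≤y → inj₁ (Iso.mono x≤y) ◅ ε) λ y →
    let x , eq = Iso.surjective y in x , inj₁ (⊆-reflexive (eq {x} refl)) ◅ ε

  connected-iso⁻ : IsConnected (simplicialCells L) → IsConnected (simplicialCells K)
  connected-iso⁻ = connected-transfer (simplicialCells L) (simplicialCells K) (proj₁ ∘ Iso.surjective)
    (λ {y} {y′} y≤y′ → inj₁ (Iso.cancel (⊆-trans (⊆-reflexive (to∘from y))
      (⊆-trans y≤y′ (⊆-reflexive (sym (to∘from y′)))))) ◅ ε)
    λ x → to x , inj₁ (Iso.cancel (⊆-reflexive (to∘from (to x)))) ◅ ε
    where
    to∘from : ∀ y → proj₁ (to (proj₁ (Iso.surjective y))) ≡ proj₁ y
    to∘from y = proj₂ (Iso.surjective y) {proj₁ (Iso.surjective y)} refl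

mutual
  -- The two directions are proved together because `∼-sym` exchanges them.
  connected-∼⁺ : {K : SimplicialComplex m} {L : SimplicialComplex n} → K ∼ L →
                 IsConnected (simplicialCells K) → IsConnected (simplicialCells L)
  connected-∼⁺ (iso {K = K} {L} K≅L) = connected-iso⁺ {K = K} {L} K≅L
  connected-∼⁺ (stellar σ ne face) = connected-subdivide⁺ _ σ ne face
  connected-∼⁺ (∼-sym K∼L)         = connected-∼⁻ K∼L
  connected-∼⁺ (∼-trans K∼L L∼N)   = connected-∼⁺ L∼N ∘ connected-∼⁺ K∼L

  connected-∼⁻ : {K : SimplicialComplex m} {L : SimplicialComplex n} → K ∼ L →
                 IsConnected (simplicialCells L) → IsConnected (simplicialCells K)
  connected-∼⁻ (iso {K = K} {L} K≅L) = connected-iso⁻ {K = K} {L} K≅L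
  connected-∼⁻ (stellar σ ne face) = connected-subdivide⁻ _ σ ne face
  connected-∼⁻ (∼-sym K∼L)         = connected-∼⁺ K∼L
  connected-∼⁻ (∼-trans K∼L L∼N)   = connected-∼⁻ K∼L ∘ connected-∼⁻ L∼N

-- Any two vertices span a face: two vertices stay within the bound `suc (suc d)`.
connected-∂Δ : ∀ d → IsConnected (simplicialCells (∂Δ (suc (suc d))))
connected-∂Δ d (s , _ , v , v∈s) (t , _ , w , w∈t) =
  _◅_ {j = ⁅ v ⁆ , ℕ.≤-trans (ℕ.≤-reflexive (∣⁅x⁆∣≡1 v)) (s≤s z≤n) , v , x∈⁅x⁆ v} (inj₂ (⁅⁆⊆ v∈s))
  (_◅_ {j = ⁅ v ⁆ ∪ ⁅ w ⁆ , size , v , x∈p∪q⁺ (inj₁ (x∈⁅x⁆ v))} (inj₁ (x∈p∪q⁺ ∘ inj₁))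
  (_◅_ {j = ⁅ w ⁆ , ℕ.≤-trans (ℕ.≤-reflexive (∣⁅x⁆∣≡1 w)) (s≤s z≤n) , w , x∈⁅x⁆ w}
    (inj₂ (x∈p∪q⁺ ∘ inj₂)) (inj₁ (⁅⁆⊆ w∈t) ◅ ε)))
  where
  ⁅⁆⊆ : ∀ {x : Fin (suc (suc (suc d)))} {p} → x ∈ p → ⁅ x ⁆ ⊆ p
  ⁅⁆⊆ {x} {p} x∈p y∈ = subst (_∈ p) (sym (x∈⁅y⁆⇒x≡y x y∈)) x∈p
  size : ∣ ⁅ v ⁆ ∪ ⁅ w ⁆ ∣ ℕ.≤ suc (suc d)
  size with v ∈? ⁅ w ⁆
  ... | no v∉ = ℕ.≤-trans (ℕ.≤-reflexive (trans (∣⁅x⁆∪p∣ v∉) (cong suc (∣⁅x⁆∣≡1 w)))) (s≤s (s≤s z≤n))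
  ... | yes v∈ = ℕ.≤-trans (p⊆q⇒∣p∣≤∣q∣ ([ ⁅⁆⊆ v∈ , id ]′ ∘ x∈p∪q⁻ ⁅ v ⁆ ⁅ w ⁆))
                   (ℕ.≤-trans (ℕ.≤-reflexive (∣⁅x⁆∣≡1 w)) (s≤s z≤n))

-- Crossing faces

pattern i₀ = here refl
pattern i₁ = there i₀
pattern i₂ = there i₁
pattern i₃ = there i₂

≢⇒≡⊎≡ : {x y : Bool} → x ≢ y → ∀ z → z ≡ x ⊎ z ≡ y
≢⇒≡⊎≡ {false} {false} x≢y z     = contradiction refl x≢y
≢⇒≡⊎≡ {false} {true}  x≢y false = inj₁ refl
≢⇒≡⊎≡ {false} {true}  x≢y true  = inj₂ refl
≢⇒≡⊎≡ {true}  {false} x≢y false = inj₂ refl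
≢⇒≡⊎≡ {true}  {false} x≢y true  = inj₁ refl
≢⇒≡⊎≡ {true}  {true}  x≢y z     = contradiction refl x≢y

-- The cells of Δ^(p-1) × Δ^(q-1) selected by `Good`. All three targets have this form, with (p, q)
-- = (1, 4), (2, 3) and (3, 3), where p and q are the numbers of vertices on the two sides of the
-- level.
productCells : (p q : ℕ) → (Subset p → Subset q → Set) → CellComplex 0ℓ 0ℓ 0ℓ
productCells p q Good = record
  { cells = On.poset
      {B = Σ (Subset p × Subset q) λ (s , t) → Nonempty s × Nonempty t × Good s t}
      (×-poset (⊆-poset p) (⊆-poset q)) proj₁
  ; dim   = λ ((s , t) , _) → (∣ s ∣ ∸ 1) ℕ.+ (∣ t ∣ ∸ 1)
  }

module _ (M : SimplicialComplex n) (side : Fin n → Bool) where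

  infix 4 _⋈_
  _⋈_ : Fin n → Fin n → Set
  v ⋈ w = side v ≢ side w

  Crossing : Subset n → Set
  Crossing s = ∃₂ λ v w → v ∈ s × w ∈ s × v ⋈ w

  crossingCells : CellComplex 0ℓ 0ℓ 0ℓ
  crossingCells = record
    { cells = On.poset {B = Σ (Subset n) λ s → Face M s × Crossing s} (⊆-poset n) proj₁
    ; dim   = λ s → ∣ proj₁ s ∣ ∸ 2
    }

  -- A record rather than an abbreviation, so that xs can be inferred.
  record IsFace (xs : List (Fin n)) : Set where
    constructor is-face
    field face : Face M ⟦ xs ⟧

  -- The properties of the slicing restated in M. For x ⋈ y the triangle xyz is an edge of the
  -- slicing and the tetrahedra containing it are its facets; `another` and `at-most-two` together
  -- say that there are exactly two of them.
  record IsNeighborlySurface : Set where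
    field
      crossing-face : ∃ λ s → Face M s × Crossing s
      size≤4        : ∀ {s} → Face M s → Crossing s → ∣ s ∣ ℕ.≤ 4
      neighborly    : ∀ {u v u′ v′} → u ⋈ v → IsFace (u ∷ v ∷ []) → u′ ⋈ v′ → IsFace (u′ ∷ v′ ∷ []) →
                      ∃ λ t → Face M t × ∣ t ∣ ≡ 4 × All (_∈ t) (u ∷ v ∷ u′ ∷ v′ ∷ [])
      another       : ∀ {c x y z} → x ⋈ y → Unique (c ∷ x ∷ y ∷ z ∷ []) →
                      IsFace (c ∷ x ∷ y ∷ z ∷ []) →
                      ∃ λ d → Unique (d ∷ c ∷ x ∷ y ∷ z ∷ []) × IsFace (d ∷ x ∷ y ∷ z ∷ [])
      at-most-two   : ∀ {c d e x y z} → x ⋈ y → Unique (c ∷ d ∷ e ∷ x ∷ y ∷ z ∷ []) →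
                      IsFace (c ∷ x ∷ y ∷ z ∷ []) → IsFace (d ∷ x ∷ y ∷ z ∷ []) →
                      ¬ IsFace (e ∷ x ∷ y ∷ z ∷ [])

module Classification {M : SimplicialComplex n} {side : Fin n → Bool}
                      (S : IsNeighborlySurface M side) where
  open IsNeighborlySurface S public

  infix 4 _~_
  _~_ _≁_ : Fin n → Fin n → Set
  v ~ w = side v ≡ side w
  _≁_ = _⋈_ M side

  F : List (Fin n) → Set
  F = IsFace M side

  -- A vertex on no crossing edge is invisible in the slicing; the sets A and B of the overview
  -- consist of the active vertices of each side.
  Active : Fin n → Set
  Active v = ∃ λ w → v ≁ w × F (v ∷ w ∷ [])

  active? : ∀ v → Dec (Active v)
  active? v = any? λ w → ¬? (side v Bool.≟ side w) ×-dec Dec.map′ is-face IsFace.face (face? M _)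

  ≁⇒≢ : ∀ {v w} → v ≁ w → v ≢ w
  ≁⇒≢ v≁w refl = v≁w refl

  ~≁ : ∀ {u v w} → u ~ v → v ≁ w → u ≁ w
  ~≁ u~v v≁w u~w = v≁w (trans (sym u~v) u~w)

  ≁~ : ∀ {u v w} → u ≁ v → v ~ w → u ≁ w
  ≁~ u≁v v~w u~w = u≁v (trans u~w (sym v~w))

  ≁≁⇒~ : ∀ {u v w} → u ≁ v → w ≁ v → u ~ w
  ≁≁⇒~ {u} {v} {w} u≁v w≁v with ≢⇒≡⊎≡ u≁v (side w)
  ... | inj₁ w~u = sym w~u
  ... | inj₂ w~v = contradiction w~v w≁v

  ∈face : ∀ {s xs} → All (_∈ s) xs → Face M s → F xs
  ∈face xs∈s face = is-face (closed M (⟦⟧⊆ xs∈s) face)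

  subface : ∀ {xs ys} → All (_∈ₗ ys) xs → F ys → F xs
  subface xs∈ys (is-face face) = ∈face (All.map ∈⟦⟧⁺ xs∈ys) face

  active-∈ : ∀ {s v} → Face M s → Crossing M side s → v ∈ s → Active v
  active-∈ {v = v} face (x , y , x∈s , y∈s , x≁y) v∈s with ≢⇒≡⊎≡ x≁y (side v)
  ... | inj₁ v~x = y , ~≁ v~x x≁y , ∈face (v∈s ∷ y∈s ∷ []) face
  ... | inj₂ v~y = x , ~≁ v~y (≢-sym x≁y) , ∈face (v∈s ∷ x∈s ∷ []) face

  active-∈ₗ : ∀ {xs x y v} → F xs → x ∈ₗ xs → y ∈ₗ xs → x ≁ y → v ∈ₗ xs → Active v
  active-∈ₗ (is-face face) x∈ y∈ x≁y v∈ = active-∈ face (_ , _ , ∈⟦⟧⁺ x∈ , ∈⟦⟧⁺ y∈ , x≁y) (∈⟦⟧⁺ v∈)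

  -- Each of `v`, `w` has a crossing edge of its own; a tetrahedron containing both of these
  -- contains vw as well.
  edge : ∀ {v w} → Active v → Active w → v ≁ w → F (v ∷ w ∷ [])
  edge (v′ , v≁v′ , fv) (w′ , w≁w′ , fw) v≁w
    with _ , face , _ , v∈ ∷ _ ∷ w∈ ∷ _ ← neighborly v≁v′ fv w≁w′ fw
    = ∈face (v∈ ∷ w∈ ∷ []) face

  -- The diagonal vertices ab and a′b′ of the quadrilateral lie in a common tetrahedron.
  -- Coincidences a = a′ or b = b′ are allowed, so the statement also yields crossing triangles and
  -- edges.
  quadrilateral : ∀ {a a′ b b′} → Active a → Active a′ → Active b → Active b′ →
                  a ~ a′ → b ~ b′ → a ≁ b → F (a ∷ a′ ∷ b ∷ b′ ∷ [])
  quadrilateral act act′ bct bct′ a~a′ b~b′ a≁b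
    with a′≁b′ ← ~≁ (sym a~a′) (≁~ a≁b b~b′)
    with _ , face , _ , a∈ ∷ b∈ ∷ a′∈ ∷ b′∈ ∷ [] ←
           neighborly a≁b (edge act bct a≁b) a′≁b′ (edge act′ bct′ a′≁b′)
    = ∈face (a∈ ∷ a′∈ ∷ b∈ ∷ b′∈ ∷ []) face

  record SideOf (r : Fin n) (xs : Vec (Fin n) m) : Set where
    field
      same-side : ∀ i → lookup xs i ~ r
      is-active : ∀ i → Active (lookup xs i)
      unique    : Vec.Unique xs
      complete  : ∀ v → Active v → v ~ r → ∃ λ i → lookup xs i ≡ v

  module Product {p q : ℕ} {a b : Fin n} {as : Vec (Fin n) p} {bs : Vec (Fin n) q}
                 (a≁b : a ≁ b) (A : SideOf a as) (B : SideOf b bs) where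
    private
      module A = SideOf A
      module B = SideOf B

    covered : ∀ {v} → Active v → (∃ λ i → lookup as i ≡ v) ⊎ (∃ λ j → lookup bs j ≡ v)
    covered {v} act = Sum.map (A.complete v act) (B.complete v act) (≢⇒≡⊎≡ a≁b (side v))

    as≁bs : ∀ i j → lookup as i ≁ lookup bs j
    as≁bs i j = ~≁ (A.same-side i) (≁~ a≁b (sym (B.same-side j)))

    -- Every vertex of a crossing face is active, hence listed in `as` or `bs`, so the two traces
    -- lose nothing.
    image-restrict : ∀ {s} → Face M s → Crossing M side s →
                     image as (restrict as s) ∪ image bs (restrict bs s) ≡ s
    image-restrict {s} face cross = ⊆-antisym
      ([ back as , back bs ]′ ∘ x∈p∪q⁻ (image as (restrict as s)) _)
      λ v∈s → x∈p∪q⁺ (Sum.map (forth as v∈s) (forth bs v∈s) (covered (active-∈ face cross v∈s)))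
      where
      back : ∀ {m} (xs : Vec (Fin n) m) {v} → v ∈ image xs (restrict xs s) → v ∈ s
      back xs v∈ with _ , i∈ , refl ← ∈image⁻ xs (restrict xs s) v∈ = ∈restrict⁻ xs i∈
      forth : ∀ {m} (xs : Vec (Fin n) m) {v} → v ∈ s → (∃ λ i → lookup xs i ≡ v) →
              v ∈ image xs (restrict xs s)
      forth xs v∈s (i , refl) = ∈image⁺ xs (∈restrict⁺ xs v∈s)

    ∣image∪image∣ : (t : Subset p) (u : Subset q) → ∣ image as t ∪ image bs u ∣ ≡ ∣ t ∣ ℕ.+ ∣ u ∣
    ∣image∪image∣ t u = trans
      (∣image∪p∣ A.unique t λ i i∈ → let j , _ , eq = ∈image⁻ bs u i∈ in ≁⇒≢ (as≁bs i j) (sym eq))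
      (cong (∣ t ∣ ℕ.+_) (trans (cong ∣_∣ (sym (∪-identityʳ (image bs u))))
        (trans (∣image∪p∣ B.unique u λ _ → ∉⊥) (trans (cong (∣ u ∣ ℕ.+_) (∣⊥∣≡0 n)) (ℕ.+-identityʳ _)))))

    size : ∀ {s} → Face M s → Crossing M side s →
           ∣ restrict as s ∣ ℕ.+ ∣ restrict bs s ∣ ≡ ∣ s ∣
    size face cross = trans (sym (∣image∪image∣ _ _)) (cong ∣_∣ (image-restrict face cross))

    restrict-nonempty : ∀ {s} → Face M s → Crossing M side s →
                        Nonempty (restrict as s) × Nonempty (restrict bs s)
    restrict-nonempty {s} face cross@(v , w , v∈s , w∈s , v≁w) =
      meets A , meets B
      where
      meets : ∀ {m r} {xs : Vec (Fin n) m} → SideOf r xs → Nonempty (restrict xs s)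
      meets {r = r} {xs} R with ≢⇒≡⊎≡ v≁w (side r)
      ... | inj₁ r~v with i , refl ← SideOf.complete R v (active-∈ face cross v∈s) (sym r~v) =
        i , ∈restrict⁺ xs v∈s
      ... | inj₂ r~w with i , refl ← SideOf.complete R w (active-∈ face cross w∈s) (sym r~w) =
        i , ∈restrict⁺ xs w∈s

    -- A crossing face is the join of its traces on the two sides. The hypotheses say that `Good`
    -- describes exactly which joins are faces, and dimensions match because (i - 1) + (j - 1) = (i
    -- + j) - 2 for nonempty traces.
    crossing≅product : {Good : Subset p → Subset q → Set} →
      (∀ {s} → Face M s → Crossing M side s → Good (restrict as s) (restrict bs s)) →
      (∀ t u → Good t u → Face M (image as t ∪ image bs u)) →
      crossingCells M side ≅ productCells p q Good
    crossing≅product {Good} good face-of = order-iso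
      (λ (s , face , cross) → let ne , ne′ = restrict-nonempty face cross in
        (restrict as s , restrict bs s) , ne , ne′ , good face cross)
      (λ s⊆s′ → (∈restrict⁺ as ∘ s⊆s′ ∘ ∈restrict⁻ as) , (∈restrict⁺ bs ∘ s⊆s′ ∘ ∈restrict⁻ bs))
      (λ {(s , face , cross)} {(s′ , _)} (t⊆t′ , u⊆u′) {v} v∈s → cancel face cross t⊆t′ u⊆u′ v∈s)
      (λ ((t , u) , (i , i∈t) , (j , j∈u) , g) →
        (image as t ∪ image bs u , face-of t u g ,
         lookup as i , lookup bs j ,
         x∈p∪q⁺ (inj₁ (∈image⁺ as i∈t)) , x∈p∪q⁺ (inj₂ (∈image⁺ bs j∈u)) , as≁bs i j) ,
        restrict-imageˡ t u , restrict-imageʳ t u)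
      (λ (s , face , cross) → let ne , ne′ = restrict-nonempty face cross in
        trans (∸1+∸1 (nonempty⇒1≤∣p∣ ne) (nonempty⇒1≤∣p∣ ne′)) (cong (_∸ 2) (size face cross)))
      where
      cancel : ∀ {s s′ v} → Face M s → Crossing M side s → restrict as s ⊆ restrict as s′ →
               restrict bs s ⊆ restrict bs s′ → v ∈ s → v ∈ s′
      cancel face cross t⊆t′ u⊆u′ v∈s with covered (active-∈ face cross v∈s)
      ... | inj₁ (i , refl) = ∈restrict⁻ as (t⊆t′ (∈restrict⁺ as v∈s))
      ... | inj₂ (j , refl) = ∈restrict⁻ bs (u⊆u′ (∈restrict⁺ bs v∈s))
      ∸1+∸1 : ∀ {i j} → 1 ℕ.≤ i → 1 ℕ.≤ j → (i ∸ 1) ℕ.+ (j ∸ 1) ≡ (i ℕ.+ j) ∸ 2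
      ∸1+∸1 {suc i} {suc j} _ _ = cong (_∸ 1) (sym (ℕ.+-suc i j))
      restrict-imageˡ : ∀ t u → restrict as (image as t ∪ image bs u) ≡ t
      restrict-imageˡ t u = ⊆-antisym
        (λ {i} i∈ → case (x∈p∪q⁻ (image as t) _ (∈restrict⁻ as i∈)))
        (λ {i} i∈ → ∈restrict⁺ as (x∈p∪q⁺ {p = image as t} (inj₁ (∈image⁺ as i∈))))
        where
        case : ∀ {i} → lookup as i ∈ image as t ⊎ lookup as i ∈ image bs u → i ∈ t
        case {i} (inj₁ ∈t) with i′ , i′∈t , eq ← ∈image⁻ as t ∈t =
          subst (_∈ t) (Vec.lookup-injective A.unique i′ i eq) i′∈t
        case {i} (inj₂ ∈u) with j , _ , eq ← ∈image⁻ bs u ∈u = contradiction (sym eq) (≁⇒≢ (as≁bs i j))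
      restrict-imageʳ : ∀ t u → restrict bs (image as t ∪ image bs u) ≡ u
      restrict-imageʳ t u = ⊆-antisym
        (λ {i} i∈ → case (x∈p∪q⁻ (image as t) _ (∈restrict⁻ bs i∈)))
        (λ {i} i∈ → ∈restrict⁺ bs (x∈p∪q⁺ {p = image as t} (inj₂ (∈image⁺ bs i∈))))
        where
        case : ∀ {j} → lookup bs j ∈ image as t ⊎ lookup bs j ∈ image bs u → j ∈ u
        case {j} (inj₂ ∈u) with j′ , j′∈u , eq ← ∈image⁻ bs u ∈u =
          subst (_∈ u) (Vec.lookup-injective B.unique j′ j eq) j′∈u
        case {j} (inj₁ ∈t) with i , _ , eq ← ∈image⁻ as t ∈t = contradiction eq (≁⇒≢ (as≁bs i j))

-- The grid torus as a product of two 3-cycles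

TorusFace : Subset 3 → Subset 3 → Set
TorusFace s t = s ≢ ⊤ × t ≢ ⊤

-- The nonempty proper subsets of ℤ₃ are the cells of a 3-cycle: the flag `false` stands for the
-- vertex i, `true` for the edge from i to i + 1.
Arc : Set
Arc = ℤ₃ × Bool

infix 4 _∈arc_
_∈arc_ : ℤ₃ → Arc → Set
k ∈arc (i , false) = k ≡ i
k ∈arc (i , true)  = k ≡ i ⊎ k ≡ 1+ i

gridCell : Arc → Arc → GridCell
gridCell (i , false) (j , false) = vertex i j
gridCell (i , true)  (j , false) = horizontal i j
gridCell (i , false) (j , true)  = vertical i j
gridCell (i , true)  (j , true)  = quad i j

∈gridCell⁺ : ∀ {k l} α β → k ∈arc α → l ∈arc β → (k , l) ∈ₗ gridVertices (gridCell α β)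
∈gridCell⁺ (i , false) (j , false) refl        refl        = i₀
∈gridCell⁺ (i , true)  (j , false) (inj₁ refl) refl        = i₀
∈gridCell⁺ (i , true)  (j , false) (inj₂ refl) refl        = i₁
∈gridCell⁺ (i , false) (j , true)  refl        (inj₁ refl) = i₀
∈gridCell⁺ (i , false) (j , true)  refl        (inj₂ refl) = i₁
∈gridCell⁺ (i , true)  (j , true)  (inj₁ refl) (inj₁ refl) = i₀
∈gridCell⁺ (i , true)  (j , true)  (inj₂ refl) (inj₁ refl) = i₁
∈gridCell⁺ (i , true)  (j , true)  (inj₂ refl) (inj₂ refl) = i₂
∈gridCell⁺ (i , true)  (j , true)  (inj₁ refl) (inj₂ refl) = i₃

∈gridCell⁻ : ∀ {k l} α β → (k , l) ∈ₗ gridVertices (gridCell α β) → k ∈arc α × l ∈arc β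
∈gridCell⁻ (i , false) (j , false) i₀ = refl , refl
∈gridCell⁻ (i , true)  (j , false) i₀ = inj₁ refl , refl
∈gridCell⁻ (i , true)  (j , false) i₁ = inj₂ refl , refl
∈gridCell⁻ (i , false) (j , true)  i₀ = refl , inj₁ refl
∈gridCell⁻ (i , false) (j , true)  i₁ = refl , inj₂ refl
∈gridCell⁻ (i , true)  (j , true)  i₀ = inj₁ refl , inj₁ refl
∈gridCell⁻ (i , true)  (j , true)  i₁ = inj₂ refl , inj₁ refl
∈gridCell⁻ (i , true)  (j , true)  i₂ = inj₂ refl , inj₂ refl
∈gridCell⁻ (i , true)  (j , true)  i₃ = inj₁ refl , inj₂ refl

arcLength : Arc → ℕ
arcLength (_ , false) = 0
arcLength (_ , true)  = 1

gridDim-gridCell : ∀ α β → gridDim (gridCell α β) ≡ arcLength α ℕ.+ arcLength β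
gridDim-gridCell (_ , false) (_ , false) = refl
gridDim-gridCell (_ , true)  (_ , false) = refl
gridDim-gridCell (_ , false) (_ , true)  = refl
gridDim-gridCell (_ , true)  (_ , true)  = refl

arcSubset : Arc → Subset 3
arcSubset (i , false) = ⁅ i ⁆
arcSubset (i , true)  = ⁅ i ⁆ ∪ ⁅ 1+ i ⁆

∈arcSubset⁺ : ∀ {k} α → k ∈arc α → k ∈ arcSubset α
∈arcSubset⁺ (i , false) refl        = x∈⁅x⁆ i
∈arcSubset⁺ (i , true)  (inj₁ refl) = x∈p∪q⁺ (inj₁ (x∈⁅x⁆ i))
∈arcSubset⁺ (i , true)  (inj₂ refl) = x∈p∪q⁺ {p = ⁅ i ⁆} (inj₂ (x∈⁅x⁆ (1+ i)))

∈arcSubset⁻ : ∀ {k} α → k ∈ arcSubset α → k ∈arc α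
∈arcSubset⁻ (i , false) k∈ = x∈⁅y⁆⇒x≡y i k∈
∈arcSubset⁻ (i , true)  k∈ = Sum.map (x∈⁅y⁆⇒x≡y i) (x∈⁅y⁆⇒x≡y (1+ i)) (x∈p∪q⁻ ⁅ i ⁆ _ k∈)

arc : ∀ s → Nonempty s → s ≢ ⊤ → ∃ λ α → s ≡ arcSubset α × arcLength α ≡ ∣ s ∣ ∸ 1
arc (inside  ∷ inside  ∷ inside  ∷ []) _ s≢⊤ = contradiction refl s≢⊤
arc (inside  ∷ inside  ∷ outside ∷ []) _ _ = (zero , true) , refl , refl
arc (inside  ∷ outside ∷ inside  ∷ []) _ _ = (suc (suc zero) , true) , refl , refl
arc (inside  ∷ outside ∷ outside ∷ []) _ _ = (zero , false) , refl , refl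
arc (outside ∷ inside  ∷ inside  ∷ []) _ _ = (suc zero , true) , refl , refl
arc (outside ∷ inside  ∷ outside ∷ []) _ _ = (suc zero , false) , refl , refl
arc (outside ∷ outside ∷ inside  ∷ []) _ _ = (suc (suc zero) , false) , refl , refl
arc (outside ∷ outside ∷ outside ∷ []) (_ , there (there (there ()))) _

arcSubset-nonempty : ∀ α → Nonempty (arcSubset α)
arcSubset-nonempty α@(i , false) = i , ∈arcSubset⁺ α refl
arcSubset-nonempty α@(i , true)  = i , ∈arcSubset⁺ α (inj₁ refl)

arcSubset≢⊤ : ∀ α → arcSubset α ≢ ⊤
arcSubset≢⊤ (zero , false) ()
arcSubset≢⊤ (zero , true)  ()
arcSubset≢⊤ (suc zero , false) ()
arcSubset≢⊤ (suc zero , true)  ()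
arcSubset≢⊤ (suc (suc zero) , false) ()
arcSubset≢⊤ (suc (suc zero) , true)  ()

product≅gridTorus : productCells 3 3 TorusFace ≅ gridTorus
product≅gridTorus = order-iso {X = productCells 3 3 TorusFace} {Y = gridTorus} to
  (λ {x} {y} → mono x y) (λ {x} {y} → cancel x y) onto dim
  where
  open CellComplex (productCells 3 3 TorusFace) using (Carrier)
  module _ (x : Carrier) where
    α β : ∃ λ α → _
    α = let (s , t) , s-ne , t-ne , s≢⊤ , t≢⊤ = x in arc s s-ne s≢⊤
    β = let (s , t) , s-ne , t-ne , s≢⊤ , t≢⊤ = x in arc t t-ne t≢⊤
    to : GridCell
    to = gridCell (proj₁ α) (proj₁ β)
    Vertex : ℤ₃ × ℤ₃ → Set
    Vertex (k , l) = k ∈ proj₁ (proj₁ x) × l ∈ proj₂ (proj₁ x)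
    to⁺ : ∀ {v} → Vertex v → v ∈ₗ gridVertices to
    to⁺ (k∈ , l∈) = ∈gridCell⁺ (proj₁ α) (proj₁ β)
      (∈arcSubset⁻ _ (subst (_ ∈_) (proj₁ (proj₂ α)) k∈))
      (∈arcSubset⁻ _ (subst (_ ∈_) (proj₁ (proj₂ β)) l∈))
    to⁻ : ∀ {v} → v ∈ₗ gridVertices to → Vertex v
    to⁻ v∈ with k∈ , l∈ ← ∈gridCell⁻ (proj₁ α) (proj₁ β) v∈ =
      subst (_ ∈_) (sym (proj₁ (proj₂ α))) (∈arcSubset⁺ _ k∈) ,
      subst (_ ∈_) (sym (proj₁ (proj₂ β))) (∈arcSubset⁺ _ l∈)
    dim : gridDim to ≡ _
    dim = trans (gridDim-gridCell (proj₁ α) (proj₁ β))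
                (cong₂ ℕ._+_ (proj₂ (proj₂ α)) (proj₂ (proj₂ β)))
  mono : ∀ x y → proj₁ (proj₁ x) ⊆ proj₁ (proj₁ y) × proj₂ (proj₁ x) ⊆ proj₂ (proj₁ y) →
         ∀ {v} → v ∈ₗ gridVertices (to x) → v ∈ₗ gridVertices (to y)
  mono x y (s⊆ , t⊆) v∈ = let k∈ , l∈ = to⁻ x v∈ in to⁺ y (s⊆ k∈ , t⊆ l∈)
  cancel : ∀ x y → (∀ {v} → v ∈ₗ gridVertices (to x) → v ∈ₗ gridVertices (to y)) →
           proj₁ (proj₁ x) ⊆ proj₁ (proj₁ y) × proj₂ (proj₁ x) ⊆ proj₂ (proj₁ y)
  -- Both factors are nonempty, and a fixed element of one completes any element of the other to a
  -- vertex of the cell.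
  cancel x@(_ , (k , k∈) , (l , l∈) , _) y ⊆y =
    (λ k′∈ → proj₁ (to⁻ y (⊆y (to⁺ x (k′∈ , l∈))))) , (λ l′∈ → proj₂ (to⁻ y (⊆y (to⁺ x (k∈ , l′∈)))))
  preimage : Arc → Arc → Carrier
  preimage α β = (arcSubset α , arcSubset β) ,
    arcSubset-nonempty α , arcSubset-nonempty β , arcSubset≢⊤ α , arcSubset≢⊤ β
  to-preimage : ∀ α β → ∃ λ x → CellComplex._≈_ gridTorus (to x) (gridCell α β)
  to-preimage α β = preimage α β , record
    { lhs≤rhs = λ v∈ → let k∈ , l∈ = to⁻ (preimage α β) v∈ in
                ∈gridCell⁺ α β (∈arcSubset⁻ α k∈) (∈arcSubset⁻ β l∈)
    ; rhs≤lhs = λ v∈ → let k∈ , l∈ = ∈gridCell⁻ α β v∈ in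
                to⁺ (preimage α β) (∈arcSubset⁺ α k∈ , ∈arcSubset⁺ β l∈) }
  onto : ∀ y → ∃ λ x → CellComplex._≈_ gridTorus (to x) y
  onto (vertex i j)     = to-preimage (i , false) (j , false)
  onto (horizontal i j) = to-preimage (i , true)  (j , false)
  onto (vertical i j)   = to-preimage (i , false) (j , true)
  onto (quad i j)       = to-preimage (i , true)  (j , true)

-- At least two active vertices on each side: prism and grid

two-of-three : {t : Subset 3} → t ≢ ⊤ → ∃₂ λ k l → ∀ {i} → i ∈ t → i ≡ k ⊎ i ≡ l
two-of-three {outside ∷ _ ∷ _ ∷ []} _ = suc zero , suc (suc zero) , λ
  { {suc zero} _ → inj₁ refl ; {suc (suc zero)} _ → inj₂ refl }
two-of-three {inside ∷ outside ∷ _ ∷ []} _ = zero , suc (suc zero) , λ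
  { {zero} _ → inj₁ refl ; {suc zero} (there ()) ; {suc (suc zero)} _ → inj₂ refl }
two-of-three {inside ∷ inside ∷ outside ∷ []} _ = zero , suc zero , λ
  { {zero} _ → inj₁ refl ; {suc zero} _ → inj₂ refl ; {suc (suc zero)} (there (there ())) }
two-of-three {inside ∷ inside ∷ inside ∷ []} t≢⊤ = contradiction refl t≢⊤

one-of-two : {t : Subset 2} → t ≢ ⊤ → ∃ λ k → ∀ {i} → i ∈ t → i ≡ k
one-of-two {outside ∷ _ ∷ []}      _ = suc zero , λ { {suc zero} _ → refl }
one-of-two {inside ∷ outside ∷ []} _ = zero , λ { {zero} _ → refl ; {suc zero} (there ()) }
one-of-two {inside ∷ inside ∷ []}  t≢⊤ = contradiction refl t≢⊤

PrismFace : Subset 2 → Subset 3 → Set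
PrismFace s t = ¬ (s ≡ ⊤ × t ≡ ⊤)

module Quadrangulated {M : SimplicialComplex n} {side : Fin n → Bool}
                      (S : IsNeighborlySurface M side) where
  open Classification S

  -- The edge of the slicing to look at is the triangle a b b₁: each of a₁, a₂, a₃ completes it to a
  -- tetrahedron.
  at-most-three : ∀ {a a₁ a₂ a₃ b b₁} → Unique (a ∷ a₁ ∷ a₂ ∷ a₃ ∷ []) → b ≢ b₁ → a ≁ b →
    Active a → Active b → Active b₁ → b₁ ~ b → All (λ v → Active v × v ~ a) (a₁ ∷ a₂ ∷ a₃ ∷ []) → Empty.⊥
  at-most-three {a} {a₁} {a₂} {a₃} {b} {b₁}
    ((a≢a₁ ∷ a≢a₂ ∷ a≢a₃ ∷ []) ∷ (a₁≢a₂ ∷ a₁≢a₃ ∷ []) ∷ (a₂≢a₃ ∷ []) ∷ [] ∷ [])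
    b≢b₁ a≁b act bct bct₁ b₁~b ((act₁ , a₁~a) ∷ (act₂ , a₂~a) ∷ (act₃ , a₃~a) ∷ []) =
    at-most-two a≁b
      ((a₁≢a₂ ∷ a₁≢a₃ ∷ ≢-sym a≢a₁ ∷ ≢b a₁~a ∷ ≢b₁ a₁~a ∷ []) ∷
       (a₂≢a₃ ∷ ≢-sym a≢a₂ ∷ ≢b a₂~a ∷ ≢b₁ a₂~a ∷ []) ∷
       (≢-sym a≢a₃ ∷ ≢b a₃~a ∷ ≢b₁ a₃~a ∷ []) ∷
       (≢b refl ∷ ≢b₁ refl ∷ []) ∷ (b≢b₁ ∷ []) ∷ [] ∷ [])
      (quad′ act₁ a₁~a) (quad′ act₂ a₂~a) (quad′ act₃ a₃~a)
    where
    ≢b : ∀ {v} → v ~ a → v ≢ b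
    ≢b v~a = ≁⇒≢ (~≁ v~a a≁b)
    ≢b₁ : ∀ {v} → v ~ a → v ≢ b₁
    ≢b₁ v~a = ≁⇒≢ (~≁ v~a (≁~ a≁b (sym b₁~b)))
    quad′ : ∀ {v} → Active v → v ~ a → F (v ∷ a ∷ b ∷ b₁ ∷ [])
    quad′ vct v~a = quadrilateral vct act bct bct₁ v~a (sym b₁~b) (~≁ v~a a≁b)

  lookup-≢ : ∀ {r} {xs : Vec (Fin n) m} → SideOf r xs → ∀ {i j} → i ≢ j → lookup xs i ≢ lookup xs j
  lookup-≢ R i≢j = i≢j ∘ Vec.lookup-injective (SideOf.unique R) _ _

  -- With at least three vertices on either side both facets at every edge
  -- are quadrilaterals already.
  ¬triangle : ∀ {a b} {as bs : Vec (Fin n) 3} → a ≁ b → SideOf a as → SideOf b bs →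
              ∀ {s} → Face M s → Crossing M side s → restrict as s ≢ ⊤
  ¬triangle {as = as} {bs} a≁b A B {s} face cross eq =
    let j , j∈ = proj₂ (Product.restrict-nonempty a≁b A B face cross) in
    absurd j (∈restrict⁻ bs j∈)
    where
    module A = SideOf A
    module B = SideOf B
    as≁bs = Product.as≁bs a≁b A B
    others : (j : Fin 3) → ∃₂ λ k l → k ≢ l × k ≢ j × l ≢ j
    others zero             = suc zero , suc (suc zero) , (λ ()) , (λ ()) , (λ ())
    others (suc zero)       = zero , suc (suc zero) , (λ ()) , (λ ()) , (λ ())
    others (suc (suc zero)) = zero , suc zero , (λ ()) , (λ ()) , (λ ())
    ∈s : ∀ i → lookup as i ∈ s
    ∈s i = ∈restrict⁻ as (subst (i ∈_) (sym eq) ∈⊤)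
    absurd : ∀ j → ¬ lookup bs j ∈ s
    -- The triangle on `as` 0, `as` 1 and `bs` j would lie in three tetrahedra, completed by `as` 2
    -- and by the two other elements of `bs`.
    absurd j j∈s with k , l , k≢l , k≢j , l≢j ← others j =
      at-most-two {c = lookup as two} {d = lookup bs k} {e = lookup bs l}
        {x = lookup as zero} {y = lookup bs j} {z = lookup as one} (as≁bs zero j)
        ((≁⇒≢ (as≁bs two k) ∷ ≁⇒≢ (as≁bs two l) ∷ lookup-≢ A (λ ()) ∷ ≁⇒≢ (as≁bs two j) ∷
            lookup-≢ A (λ ()) ∷ []) ∷
         (lookup-≢ B k≢l ∷ ≢-sym (≁⇒≢ (as≁bs zero k)) ∷ lookup-≢ B k≢j ∷ ≢-sym (≁⇒≢ (as≁bs one k)) ∷ []) ∷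
         (≢-sym (≁⇒≢ (as≁bs zero l)) ∷ lookup-≢ B l≢j ∷ ≢-sym (≁⇒≢ (as≁bs one l)) ∷ []) ∷
         (≁⇒≢ (as≁bs zero j) ∷ lookup-≢ A (λ ()) ∷ []) ∷ (≢-sym (≁⇒≢ (as≁bs one j)) ∷ []) ∷ [] ∷ [])
        (∈face (∈s two ∷ ∈s zero ∷ j∈s ∷ ∈s one ∷ []) face)
        (quad′ k) (quad′ l)
      where
      one two : Fin 3
      one = suc zero
      two = suc (suc zero)
      quad′ : ∀ k → F (lookup bs k ∷ lookup as zero ∷ lookup bs j ∷ lookup as one ∷ [])
      quad′ k = subface (i₂ ∷ i₀ ∷ i₃ ∷ i₁ ∷ [])
        (quadrilateral (A.is-active zero) (A.is-active one) (B.is-active k) (B.is-active j)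
          (trans (A.same-side zero) (sym (A.same-side one)))
          (trans (B.same-side k) (sym (B.same-side j))) (as≁bs zero k))

  SideOf-quadrilateral : ∀ {p q a b} {as : Vec (Fin n) p} {bs : Vec (Fin n) q} → a ≁ b →
    SideOf a as → SideOf b bs → ∀ i i′ j j′ →
    F (lookup as i ∷ lookup as i′ ∷ lookup bs j ∷ lookup bs j′ ∷ [])
  SideOf-quadrilateral a≁b A B i i′ j j′ = quadrilateral
    (A.is-active i) (A.is-active i′) (B.is-active j) (B.is-active j′)
    (trans (A.same-side i) (sym (A.same-side i′))) (trans (B.same-side j) (sym (B.same-side j′)))
    (Product.as≁bs a≁b A B i j)
    where
    module A = SideOf A
    module B = SideOf B

  image∪image-face : ∀ {p q} (as : Vec (Fin n) p) (bs : Vec (Fin n) q) (t : Subset p) (u : Subset q) →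
    ∀ {xs} → (∀ {i} → i ∈ t → lookup as i ∈ₗ xs) → (∀ {j} → j ∈ u → lookup bs j ∈ₗ xs) →
    F xs → Face M (image as t ∪ image bs u)
  image∪image-face as bs t u {xs} as∈ bs∈ (is-face face) = closed M
    (∈⟦⟧⁺ ∘ [ in-list as t as∈ , in-list bs u bs∈ ]′ ∘ x∈p∪q⁻ (image as t) _) face
    where
    in-list : ∀ {m} (ys : Vec (Fin n) m) t → (∀ {i} → i ∈ t → lookup ys i ∈ₗ xs) →
              ∀ {v} → v ∈ image ys t → v ∈ₗ xs
    in-list ys t ys∈ v∈ with _ , i∈ , refl ← ∈image⁻ ys t v∈ = ys∈ i∈

  grid : ∀ {a b} {as bs : Vec (Fin n) 3} → a ≁ b → SideOf a as → SideOf b bs →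
         crossingCells M side ≅ gridTorus
  grid {as = as} {bs} a≁b A B = ≅-trans
    (Product.crossing≅product a≁b A B {TorusFace}
      (λ face cross → ¬triangle a≁b A B face cross , ¬triangle (≢-sym a≁b) B A face cross)
      faces)
    product≅gridTorus
    where
    faces : ∀ t u → TorusFace t u → Face M (image as t ∪ image bs u)
    faces t u (t≢⊤ , u≢⊤) with k , l , t⊆ ← two-of-three t≢⊤ | k′ , l′ , u⊆ ← two-of-three u≢⊤ =
      image∪image-face as bs t u
        ([ (λ { refl → i₀ }) , (λ { refl → i₁ }) ]′ ∘ t⊆)
        ([ (λ { refl → i₂ }) , (λ { refl → i₃ }) ]′ ∘ u⊆)
        (SideOf-quadrilateral a≁b A B k l k′ l′)

  -- All five vertices together exceed a tetrahedron, which is the only exclusion. Of the remaining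
  -- joins, `quadrilateral` supplies those with at most two vertices from `bs`, and `end` the two
  -- triangles.
  prism : ∀ {a b} {as : Vec (Fin n) 2} {bs : Vec (Fin n) 3} → a ≁ b → SideOf a as → SideOf b bs →
          crossingCells M side ≅ prismBoundary
  prism {a} {b} {as} {bs} a≁b A B = P.crossing≅product {PrismFace} ≤4 faces
    where
    module A = SideOf A
    module B = SideOf B
    module P = Product a≁b A B
    ≤4 : ∀ {s} → Face M s → Crossing M side s → PrismFace (restrict as s) (restrict bs s)
    ≤4 {s} face cross (eq , eq′) = contradiction (size≤4 face cross) (subst (ℕ._≰ 4)
      (trans (cong₂ (λ t u → ∣ t ∣ ℕ.+ ∣ u ∣) (sym eq) (sym eq′)) (P.size face cross))
      λ { (s≤s (s≤s (s≤s (s≤s ())))) })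
    other : Fin 2 → Fin 2
    other zero       = suc zero
    other (suc zero) = zero
    other-≢ : ∀ k → other k ≢ k
    other-≢ zero       ()
    other-≢ (suc zero) ()
    is-other : ∀ {k i} → i ≢ other k → i ≡ k
    is-other {zero}     {zero}     _ = refl
    is-other {suc zero} {suc zero} _ = refl
    is-other {zero}     {suc zero} i≢ = contradiction refl i≢
    is-other {suc zero} {zero}     i≢ = contradiction refl i≢
    end : ∀ k → F (lookup as k ∷ lookup bs zero ∷ lookup bs (suc zero) ∷ lookup bs (suc (suc zero)) ∷ [])
    -- The triangle on `as` k, `bs` 0 and `bs` 1 lies in the tetrahedron with the other element of
    -- `as`. Its second tetrahedron needs a further active vertex, and only `bs` 2 is left.
    end k with d , ((d≢a′ ∷ d≢a ∷ d≢b ∷ d≢b₁ ∷ []) ∷ _) , face ←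
      another {c = lookup as (other k)} {x = lookup as k} {y = lookup bs zero} {z = lookup bs (suc zero)}
        (P.as≁bs k zero)
        ((lookup-≢ A (other-≢ k) ∷ ≁⇒≢ (P.as≁bs (other k) zero) ∷ ≁⇒≢ (P.as≁bs (other k) (suc zero)) ∷ []) ∷
         (≁⇒≢ (P.as≁bs k zero) ∷ ≁⇒≢ (P.as≁bs k (suc zero)) ∷ []) ∷ (lookup-≢ B (λ ()) ∷ []) ∷ [] ∷ [])
        (SideOf-quadrilateral a≁b A B (other k) k zero (suc zero))
      with P.covered (active-∈ₗ face i₁ i₂ (P.as≁bs k zero) i₀)
    ... | inj₁ (i , refl) = contradiction (cong (lookup as) (is-other λ { refl → d≢a′ refl })) d≢a
    ... | inj₂ (zero , refl) = contradiction refl d≢b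
    ... | inj₂ (suc zero , refl) = contradiction refl d≢b₁
    ... | inj₂ (suc (suc zero) , refl) = subface (i₁ ∷ i₂ ∷ i₃ ∷ i₀ ∷ []) face
    faces : ∀ t u → PrismFace t u → Face M (image as t ∪ image bs u)
    faces t u t∪u≢⊤ with Vec.≡-dec Bool._≟_ t ⊤
    ... | no t≢⊤ with k , t⊆ ← one-of-two t≢⊤ = image∪image-face as bs t u
      ((λ { refl → i₀ }) ∘ t⊆)
      (λ { {zero} _ → i₁ ; {suc zero} _ → i₂ ; {suc (suc zero)} _ → i₃ })
      (end k)
    ... | yes t≡⊤ with k , l , u⊆ ← two-of-three (λ u≡⊤ → t∪u≢⊤ (t≡⊤ , u≡⊤)) = image∪image-face as bs t u
      (λ { {zero} _ → i₀ ; {suc zero} _ → i₁ })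
      ([ (λ { refl → i₂ }) , (λ { refl → i₃ }) ]′ ∘ u⊆)
      (SideOf-quadrilateral a≁b A B zero (suc zero) k l)

  complete-if : ∀ {r} (xs : Vec (Fin n) m) →
    ¬ (∃ λ v → (Active v × v ~ r) × ∀ i → lookup xs i ≢ v) →
    ∀ v → Active v → v ~ r → ∃ λ i → lookup xs i ≡ v
  complete-if xs none v act v~r with any? (λ i → lookup xs i ≟ v)
  ... | yes found = found
  ... | no ¬found = contradiction (v , (act , v~r) , λ i eq → ¬found (i , eq)) none

  record Pair (r r₁ : Fin n) : Set where
    field
      active₀   : Active r
      active₁   : Active r₁
      same-side : r₁ ~ r
      distinct  : r ≢ r₁

  Third : Fin n → Fin n → Fin n → Set
  Third r r₁ v = Active v × v ~ r × r ≢ v × r₁ ≢ v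

  third? : ∀ r r₁ → Dec (∃ (Third r r₁))
  third? r r₁ = any? λ v →
    active? v ×-dec (side v Bool.≟ side r) ×-dec ¬? (r ≟ v) ×-dec ¬? (r₁ ≟ v)

  two-on-side : ∀ {r r₁} → Pair r r₁ → ¬ ∃ (Third r r₁) → SideOf r (r ∷ r₁ ∷ [])
  two-on-side {r} {r₁} R none = record
    { same-side = λ { zero → refl ; (suc zero) → R.same-side }
    ; is-active = λ { zero → R.active₀ ; (suc zero) → R.active₁ }
    ; unique    = (R.distinct ∷ []) ∷ [] ∷ []
    ; complete  = complete-if (r ∷ r₁ ∷ []) λ (v , (act , v~r) , ≢v) →
        none (v , act , v~r , ≢v zero , ≢v (suc zero))
    }
    where module R = Pair R

  three-on-side : ∀ {r r₁ r₂ s s₁} → r ≁ s → Pair r r₁ → Pair s s₁ → Third r r₁ r₂ →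
                  SideOf r (r ∷ r₁ ∷ r₂ ∷ [])
  three-on-side {r} {r₁} {r₂} r≁s R S (act₂ , r₂~r , r≢r₂ , r₁≢r₂) = record
    { same-side = λ { zero → refl ; (suc zero) → R.same-side ; (suc (suc zero)) → r₂~r }
    ; is-active = λ { zero → R.active₀ ; (suc zero) → R.active₁ ; (suc (suc zero)) → act₂ }
    ; unique    = (R.distinct ∷ r≢r₂ ∷ []) ∷ (r₁≢r₂ ∷ []) ∷ [] ∷ []
    ; complete  = complete-if (r ∷ r₁ ∷ r₂ ∷ []) λ (v , (act , v~r) , ≢v) → at-most-three
        ((R.distinct ∷ r≢r₂ ∷ ≢v zero ∷ []) ∷ (r₁≢r₂ ∷ ≢v (suc zero) ∷ []) ∷
         (≢v (suc (suc zero)) ∷ []) ∷ [] ∷ [])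
        S.distinct r≁s R.active₀ S.active₀ S.active₁ S.same-side
        ((R.active₁ , R.same-side) ∷ (act₂ , r₂~r) ∷ (act , v~r) ∷ [])
    }
    where
    module R = Pair R
    module S = Pair S

  -- This excludes 2 × 2: the triangle a b a₁ lies in the tetrahedron with b₁, and its second
  -- tetrahedron brings in a new vertex, active because it lies in a crossing face.
  third-exists : ∀ {a a₁ b b₁} → a ≁ b → Pair a a₁ → Pair b b₁ → ∃ (Third a a₁) ⊎ ∃ (Third b b₁)
  third-exists {a} {a₁} {b} {b₁} a≁b A B = classify (another {c = b₁} {a} {b} {a₁} a≁b
      ((≢-sym (≁⇒≢ a≁b₁) ∷ ≢-sym B.distinct ∷ ≢-sym (≁⇒≢ (~≁ A.same-side a≁b₁)) ∷ []) ∷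
       (≁⇒≢ a≁b ∷ A.distinct ∷ []) ∷ (≢-sym (≁⇒≢ (~≁ A.same-side a≁b)) ∷ []) ∷ [] ∷ [])
      (subface (i₃ ∷ i₀ ∷ i₂ ∷ i₁ ∷ [])
        (quadrilateral A.active₀ A.active₁ B.active₀ B.active₁ (sym A.same-side) (sym B.same-side) a≁b)))
    where
    module A = Pair A
    module B = Pair B
    a≁b₁ : a ≁ b₁
    a≁b₁ = ≁~ a≁b (sym B.same-side)
    classify : (∃ λ d → Unique (d ∷ b₁ ∷ a ∷ b ∷ a₁ ∷ []) × F (d ∷ a ∷ b ∷ a₁ ∷ [])) →
               ∃ (Third a a₁) ⊎ ∃ (Third b b₁)
    classify (d , ((d≢b₁ ∷ d≢a ∷ d≢b ∷ d≢a₁ ∷ []) ∷ _) , face)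
      with act ← active-∈ₗ face i₁ i₂ a≁b i₀ | ≢⇒≡⊎≡ a≁b (side d)
    ... | inj₁ d~a = inj₁ (d , act , d~a , ≢-sym d≢a , ≢-sym d≢a₁)
    ... | inj₂ d~b = inj₂ (d , act , d~b , ≢-sym d≢b , ≢-sym d≢b₁)

  prism-or-grid : ∀ {a a₁ b b₁} → a ≁ b → Pair a a₁ → Pair b b₁ →
                  (crossingCells M side ≅ prismBoundary) ⊎ (crossingCells M side ≅ gridTorus)
  prism-or-grid {a} {a₁} {b} {b₁} a≁b A B with third? a a₁ | third? b b₁
  ... | yes (_ , third) | yes (_ , third′) =
    inj₂ (grid a≁b (three-on-side a≁b A B third) (three-on-side (≢-sym a≁b) B A third′))
  ... | yes (_ , third) | no none =
    inj₁ (prism (≢-sym a≁b) (two-on-side B none) (three-on-side a≁b A B third))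
  ... | no none | yes (_ , third) =
    inj₁ (prism a≁b (two-on-side A none) (three-on-side (≢-sym a≁b) B A third))
  ... | no none | no none′ = contradiction (third-exists a≁b A B) [ none , none′ ]′

-- Neighborly spheres

𝟙-× : {P : Set} {Q : Set} (P? : Dec P) (Q? : Dec Q) → 𝟙 (P? ×-dec Q?) ≡ 𝟙 P? ℤ.* 𝟙 Q?
𝟙-× (yes _) (yes _) = refl
𝟙-× (yes _) (no _)  = refl
𝟙-× (no _)  (yes _) = refl
𝟙-× (no _)  (no _)  = refl

-- The counterpart of `∑-𝟙` for the two triangles at an edge of a closed surface.
∑-𝟙-two : {P : A → Set} {Q : Set} (_≟′_ : (x y : A) → Dec (x ≡ y))
  (P? : ∀ x → Dec (P x)) (Q? : Dec Q) {xs : List A} →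
  Enumerates xs → (∀ x → P x → Q) →
  (Q → ∃₂ λ x y → x ≢ y × P x × P y × ∀ z → P z → z ≡ x ⊎ z ≡ y) →
  ∑ xs (𝟙 ∘ P?) ≡ 𝟙 Q? ℤ.+ 𝟙 Q?
∑-𝟙-two _≟′_ P? (no ¬q) {xs} _ P⇒Q Q⇒P = ∑-𝟙-none P? xs λ x _ → ¬q ∘ P⇒Q x
∑-𝟙-two {A = A} {P = P} _≟′_ P? (yes q) {xs} (uniq , all) P⇒Q Q⇒P
  with x , y , x≢y , px , py , only ← Q⇒P q = begin
  ∑ xs (𝟙 ∘ P?)                                   ≡⟨ ∑-cong xs split ⟩
  ∑ xs (λ z → 𝟙 (z ≟′ x) ℤ.+ 𝟙 (z ≟′ y))          ≡⟨ ∑-+ xs _ _ ⟩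
  ∑ xs (λ z → 𝟙 (z ≟′ x)) ℤ.+ ∑ xs (λ z → 𝟙 (z ≟′ y))
    ≡⟨ cong₂ ℤ._+_ (∑-𝟙-one (_≟′ x) uniq (all x) refl λ _ → id)
                   (∑-𝟙-one (_≟′ y) uniq (all y) refl λ _ → id) ⟩
  1ℤ ℤ.+ 1ℤ ∎
  where
  open ≡-Reasoning
  split : ∀ z → 𝟙 (P? z) ≡ 𝟙 (z ≟′ x) ℤ.+ 𝟙 (z ≟′ y)
  split z with z ≟′ x | z ≟′ y
  ... | yes refl | yes refl = contradiction refl x≢y
  ... | yes refl | no _     = 𝟙-yes (P? z) px
  ... | no _     | yes refl = 𝟙-yes (P? z) py
  ... | no z≢x   | no z≢y   = 𝟙-no (P? z) λ pz → [ z≢x , z≢y ]′ (only z pz)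


enumerates-allFin : ∀ n → Enumerates (allFin n)
enumerates-allFin n = Unique.allFin⁺ n , ∈-allFin

∑-∈ : (s : Subset n) → ∑ (allFin n) (λ v → 𝟙 (v ∈? s)) ≡ + ∣ s ∣
∑-∈ []      = refl
∑-∈ {suc n} (x ∷ s) = trans
  (cong (λ vs → 𝟙 (zero ∈? (x ∷ s)) ℤ.+ ∑ vs (λ v → 𝟙 (v ∈? (x ∷ s)))) (sym (List.map-tabulate id suc)))
  (trans (cong (ℤ._+_ (𝟙 (zero ∈? (x ∷ s)))) (trans (∑-map suc (allFin n) _) (∑-∈ s))) (head x))
  where
  head : ∀ x → 𝟙 (zero ∈? (x ∷ s)) ℤ.+ + ∣ s ∣ ≡ + ∣ x ∷ s ∣
  head inside  = refl
  head outside = refl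

module _ {P : Fin n → Set} (P? : ∀ v → Dec (P v)) where

  DistinctPair : Fin n → Fin n → Set
  DistinctPair u v = u ≢ v × P u × P v

  distinctPair? : ∀ u v → Dec (DistinctPair u v)
  distinctPair? u v = ¬? (u ≟ v) ×-dec P? u ×-dec P? v

  -- Adding the diagonal turns the double sum into a product of two single sums. Counting ordered
  -- pairs avoids division by 2.
  ∑-distinctPair : let V = ∑ (allFin n) (𝟙 ∘ P?) in
    ∑ (allFin n) (λ u → ∑ (allFin n) (λ v → 𝟙 (distinctPair? u v))) ≡ V ℤ.* V ℤ.- V
  ∑-distinctPair = trans (solve 2 (λ x y → x := (x :+ y) :- y) refl X V) (cong (ℤ._- V) X+V)
    where
    open +-*-Solver using (solve; _:+_; _:-_; _:=_)
    open ≡-Reasoning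
    vs = allFin n
    V = ∑ vs (𝟙 ∘ P?)
    X = ∑ vs (λ u → ∑ vs (λ v → 𝟙 (distinctPair? u v)))
    diagonal? : ∀ u v → Dec (v ≡ u × P u)
    diagonal? u v = (v ≟ u) ×-dec P? u
    split : ∀ u v → 𝟙 (distinctPair? u v) ℤ.+ 𝟙 (diagonal? u v) ≡ 𝟙 (P? u) ℤ.* 𝟙 (P? v)
    split u v with u ≟ v
    split u u | yes refl with u ≟ u | P? u
    ... | yes _  | yes _ = refl
    ... | yes _  | no _  = refl
    ... | no u≢u | _     = contradiction refl u≢u
    split u v | no u≢v with v ≟ u | P? u | P? v
    ... | yes v≡u | _     | _     = contradiction (sym v≡u) u≢v
    ... | no _    | yes _ | yes _ = refl
    ... | no _    | yes _ | no _  = refl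
    ... | no _    | no _  | yes _ = refl
    ... | no _    | no _  | no _  = refl
    X+V : X ℤ.+ V ≡ V ℤ.* V
    X+V = begin
      X ℤ.+ V
        ≡⟨ cong (ℤ._+_ X) (∑-cong vs λ u → ∑-𝟙 (diagonal? u) (P? u) (enumerates-allFin n)
             (λ _ → proj₂) (λ pu → u , (refl , pu) , λ _ → proj₁)) ⟨
      X ℤ.+ ∑ vs (λ u → ∑ vs (λ v → 𝟙 (diagonal? u v)))
        ≡⟨ ∑-+ vs _ _ ⟨
      ∑ vs (λ u → ∑ vs (λ v → 𝟙 (distinctPair? u v)) ℤ.+ ∑ vs (λ v → 𝟙 (diagonal? u v)))
        ≡⟨ ∑-cong vs (λ u → sym (∑-+ vs _ _)) ⟩
      ∑ vs (λ u → ∑ vs (λ v → 𝟙 (distinctPair? u v) ℤ.+ 𝟙 (diagonal? u v)))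
        ≡⟨ ∑-cong vs (λ u → trans (∑-cong vs (split u)) (∑-*ˡ vs (𝟙 (P? u)) (𝟙 ∘ P?))) ⟩
      ∑ vs (λ u → 𝟙 (P? u) ℤ.* V)
        ≡⟨ ∑-*ʳ vs V (𝟙 ∘ P?) ⟩
      V ℤ.* V ∎

module _ {P : Subset n → Set} (P? : ∀ s → Dec (P s)) (size : ∀ {s} → P s → ∣ s ∣ ≡ k) where
  private
    vs = allFin n
    ss = subsets n

    at-size : (g : ℕ → ℤ) → ∀ s → 𝟙 (P? s) ℤ.* g ∣ s ∣ ≡ 𝟙 (P? s) ℤ.* g k
    at-size g s with P? s
    ... | yes ps = cong (λ k → 1ℤ ℤ.* g k) (size ps)
    ... | no _   = refl

  ∑-incident : ∑ vs (λ v → ∑ ss (λ s → 𝟙 (P? s ×-dec (v ∈? s)))) ≡ ∑ ss (𝟙 ∘ P?) ℤ.* + k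
  ∑-incident = begin
    ∑ vs (λ v → ∑ ss (λ s → 𝟙 (P? s ×-dec (v ∈? s))))
      ≡⟨ ∑-swap vs ss _ ⟩
    ∑ ss (λ s → ∑ vs (λ v → 𝟙 (P? s ×-dec (v ∈? s))))
      ≡⟨ ∑-cong ss (λ s → trans (∑-cong vs λ v → 𝟙-× (P? s) (v ∈? s)) (∑-*ˡ vs (𝟙 (P? s)) _)) ⟩
    ∑ ss (λ s → 𝟙 (P? s) ℤ.* ∑ vs (λ v → 𝟙 (v ∈? s)))
      ≡⟨ ∑-cong ss (λ s → trans (cong (ℤ._*_ (𝟙 (P? s))) (∑-∈ s)) (at-size +_ s)) ⟩
    ∑ ss (λ s → 𝟙 (P? s) ℤ.* + k)
      ≡⟨ ∑-*ʳ ss (+ k) (𝟙 ∘ P?) ⟩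
    ∑ ss (𝟙 ∘ P?) ℤ.* + k ∎
    where open ≡-Reasoning

  -- After exchanging the sums, the inner one counts the ordered pairs within a single set, which
  -- `∑-distinctPair` evaluates.
  ∑-incident-pair :
    ∑ vs (λ u → ∑ vs (λ v → ∑ ss (λ s → 𝟙 (P? s ×-dec distinctPair? (_∈? s) u v)))) ≡
    ∑ ss (𝟙 ∘ P?) ℤ.* (+ k ℤ.* + k ℤ.- + k)
  ∑-incident-pair = begin
    ∑ vs (λ u → ∑ vs (λ v → ∑ ss (λ s → 𝟙 (P? s ×-dec distinctPair? (_∈? s) u v))))
      ≡⟨ ∑-cong vs (λ u → ∑-swap vs ss _) ⟩
    ∑ vs (λ u → ∑ ss (λ s → ∑ vs (λ v → 𝟙 (P? s ×-dec distinctPair? (_∈? s) u v))))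
      ≡⟨ ∑-swap vs ss _ ⟩
    ∑ ss (λ s → ∑ vs (λ u → ∑ vs (λ v → 𝟙 (P? s ×-dec distinctPair? (_∈? s) u v))))
      ≡⟨ ∑-cong ss (λ s → trans
           (∑-cong vs λ u → trans (∑-cong vs λ v → 𝟙-× (P? s) (distinctPair? (_∈? s) u v))
                                  (∑-*ˡ vs (𝟙 (P? s)) _))
           (∑-*ˡ vs (𝟙 (P? s)) _)) ⟩
    ∑ ss (λ s → 𝟙 (P? s) ℤ.* ∑ vs (λ u → ∑ vs (λ v → 𝟙 (distinctPair? (_∈? s) u v))))
      ≡⟨ ∑-cong ss (λ s → cong (ℤ._*_ (𝟙 (P? s)))
           (trans (∑-distinctPair (_∈? s)) (cong (λ z → z ℤ.* z ℤ.- z) (∑-∈ s)))) ⟩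
    ∑ ss (λ s → 𝟙 (P? s) ℤ.* (+ ∣ s ∣ ℤ.* + ∣ s ∣ ℤ.- + ∣ s ∣))
      ≡⟨ ∑-cong ss (at-size λ k → + k ℤ.* + k ℤ.- + k) ⟩
    ∑ ss (λ s → 𝟙 (P? s) ℤ.* (+ k ℤ.* + k ℤ.- + k))
      ≡⟨ ∑-*ʳ ss (+ k ℤ.* + k ℤ.- + k) (𝟙 ∘ P?) ⟩
    ∑ ss (𝟙 ∘ P?) ℤ.* (+ k ℤ.* + k ℤ.- + k) ∎
    where open ≡-Reasoning

comprehension : {P : Fin n → Set} → (∀ v → Dec (P v)) → Subset n
comprehension P? = Vec.tabulate (does ∘ P?)

∈comprehension⁺ : {P : Fin n → Set} (P? : ∀ v → Dec (P v)) → ∀ {v} → P v → v ∈ comprehension P?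
∈comprehension⁺ P? {v} pv = lookup⇒[]= v _
  (trans (Vec.lookup∘tabulate (does ∘ P?) v) (Dec.dec-true (P? v) pv))

∈comprehension⁻ : {P : Fin n → Set} (P? : ∀ v → Dec (P v)) → ∀ {v} → v ∈ comprehension P? → P v
∈comprehension⁻ P? {v} v∈ with P? v | trans (sym (Vec.lookup∘tabulate (does ∘ P?) v)) ([]=⇒lookup v∈)
... | yes pv | _ = pv

-- The equation is (m - 3) (m - 4) = 0. For m = 5 + k the left side exceeds the right by (k + 1) (k
-- + 2) = 2 + 3 k + k², which is positive.
no-large-solution : ∀ m → 5 ℕ.≤ m → + m ℤ.* + m ℤ.+ + 12 ≢ + 7 ℤ.* + m
no-large-solution m 5≤m eq with k , refl ← ℕ.m≤n⇒∃[o]m+o≡n 5≤m =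
  ℕ.m+1+n≢m (7 ℕ.* (5 ℕ.+ k)) (trans (expand k) (ℤ.+-injective (begin
    + ((5 ℕ.+ k) ℕ.* (5 ℕ.+ k) ℕ.+ 12)             ≡⟨ ℤ.pos-+ ((5 ℕ.+ k) ℕ.* (5 ℕ.+ k)) 12 ⟩
    + ((5 ℕ.+ k) ℕ.* (5 ℕ.+ k)) ℤ.+ + 12           ≡⟨ cong (ℤ._+ + 12) (ℤ.pos-* (5 ℕ.+ k) (5 ℕ.+ k)) ⟩
    + (5 ℕ.+ k) ℤ.* + (5 ℕ.+ k) ℤ.+ + 12           ≡⟨ eq ⟩
    + 7 ℤ.* + (5 ℕ.+ k)                            ≡⟨ ℤ.pos-* 7 (5 ℕ.+ k) ⟨
    + (7 ℕ.* (5 ℕ.+ k))                            ∎)))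
  where
  open ≡-Reasoning
  expand : ∀ k → 7 ℕ.* (5 ℕ.+ k) ℕ.+ suc (1 ℕ.+ (3 ℕ.* k ℕ.+ k ℕ.* k)) ≡ (5 ℕ.+ k) ℕ.* (5 ℕ.+ k) ℕ.+ 12
  expand = solve 1 (λ k → con 7 :* (con 5 :+ k) :+ (con 2 :+ (con 3 :* k :+ k :* k)) :=
                          (con 5 :+ k) :* (con 5 :+ k) :+ con 12) refl
    where open Data.Nat.Solver.+-*-Solver

SphereFace : Subset 1 → Subset 4 → Set
SphereFace s t = ∣ t ∣ ℕ.≤ 3

product≅simplexBoundary : productCells 1 4 SphereFace ≅ simplexBoundary
product≅simplexBoundary = order-iso {X = productCells 1 4 SphereFace} {Y = simplexBoundary}
  (λ ((_ , t) , _ , ne , le) → t , le , ne)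
  proj₂
  (λ { {(inside ∷ [] , _) , _} {(inside ∷ [] , _) , _} t⊆t′ → id , t⊆t′
     ; {(outside ∷ [] , _) , (_ , there ()) , _}
     ; {_} {(outside ∷ [] , _) , (_ , there ()) , _} })
  (λ (t , le , ne) → ((inside ∷ [] , t) , (zero , here) , ne , le) , refl)
  (λ { ((inside ∷ [] , _) , _) → refl ; ((outside ∷ [] , _) , (_ , there ()) , _) })

module Cone {M : SimplicialComplex n} {side : Fin n → Bool} (S : IsNeighborlySurface M side) where
  open Classification S
  open Quadrangulated S using (complete-if; image∪image-face)

  module _ {a b : Fin n} (a≁b : a ≁ b) (act : Active a) (bct : Active b)
           (sole : ∀ v → Active v → v ~ a → v ≡ a) (sphere : IsCombinatorialSphere 2 (link M a)) where
    private
      L : SimplicialComplex n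
      L = link M a

      vs = allFin n
      ss = subsets n

    ab : F (a ∷ b ∷ [])
    ab = edge act bct a≁b

    singleton : CellComplex.Carrier (simplicialCells L)
    singleton = ⁅ b ⁆ ,
      ((λ a∈ → ≁⇒≢ a≁b (x∈⁅y⁆⇒x≡y b a∈)) ,
       closed M (λ x∈ → [ (λ x∈ → x∈p∪q⁺ (inj₁ x∈)) ,
                          (λ x∈ → subst (_∈ ⟦ a ∷ b ∷ [] ⟧) (sym (x∈⁅y⁆⇒x≡y b x∈)) (∈⟦⟧⁺ {xs = a ∷ b ∷ []} i₁)) ]′
                        (x∈p∪q⁻ ⁅ a ⁆ ⁅ b ⁆ x∈)) (IsFace.face ab)) ,
      b , x∈⁅x⁆ b

    -- The link is connected and contains b, so the side cannot change along it.
    opposite : ∀ {s v} → Face L s → v ∈ s → a ≁ v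
    opposite {s} {v} face v∈s = walk (connected-∼⁻ sphere (connected-∂Δ 1) singleton (s , face , v , v∈s))
      (λ x∈ → subst (a ≁_) (sym (x∈⁅y⁆⇒x≡y b x∈)) a≁b) v∈s
      where
      module L = CellComplex (simplicialCells L)
      AllOpposite : L.Carrier → Set
      AllOpposite (s , _) = ∀ {v} → v ∈ s → a ≁ v
      step : ∀ {x y} → x L.≤ y ⊎ y L.≤ x → AllOpposite x → AllOpposite y
      step (inj₂ y≤x) opp v∈ = opp (y≤x v∈)
      -- If `v` were on the side of `a`, the edge uv would cross the level and make `v` active, so v
      -- = a by `sole`; but no face of the link contains `a`.
      step {_ , _ , u , u∈} {_ , (a∉ , face) , _} (inj₁ x≤y) opp {v} v∈ a~v =
        a∉ (subst (_∈ _) (sole v (u , ~≁ (sym a~v) (opp u∈) , ∈face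
          (x∈p∪q⁺ (inj₂ v∈) ∷ x∈p∪q⁺ (inj₂ (x≤y u∈)) ∷ []) face) (sym a~v)) v∈)
      walk : ∀ {x y} → Star (λ x y → x L.≤ y ⊎ y L.≤ x) x y → AllOpposite x → AllOpposite y
      walk ε        = id
      walk {x} (_◅_ {j = y} xy yz) = walk yz ∘ step {x} {y} xy

    Vertex : Fin n → Set
    Vertex v = a ≁ v × Active v

    vertex? : ∀ v → Dec (Vertex v)
    vertex? v = ¬? (side a Bool.≟ side v) ×-dec active? v

    link-vertex : ∀ {s v} → Face L s → v ∈ s → Vertex v
    link-vertex {s} {v} l@(_ , face) v∈s = a≁v ,
      a , ≢-sym a≁v , ∈face (x∈p∪q⁺ (inj₂ v∈s) ∷ x∈p∪q⁺ (inj₁ (x∈⁅x⁆ a)) ∷ []) face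
      where a≁v = opposite l v∈s

    ∉link : ∀ {xs} → All Vertex xs → ¬ a ∈ ⟦ xs ⟧
    ∉link {xs} vxs a∈ = proj₁ (All.lookup vxs (∈⟦⟧⁻ xs a∈)) refl

    link-face : ∀ {xs} → All Vertex xs → F (a ∷ xs) → Face L ⟦ xs ⟧
    link-face vxs (is-face face) = ∉link vxs , face

    -- A degenerate quadrilateral, both of whose vertices on the side of `a` are `a` itself; it
    -- makes the graph of the link complete.
    edge-face : ∀ {u v} → Vertex u → Vertex v → F (a ∷ u ∷ v ∷ [])
    edge-face (a≁u , uct) (a≁v , vct) = subface (i₀ ∷ i₂ ∷ i₃ ∷ [])
      (quadrilateral act act uct vct refl (≁≁⇒~ (≢-sym a≁u) (≢-sym a≁v)) a≁u)

    active-vertex : ∀ {v} → Active v → v ≢ a → Vertex v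
    active-vertex {v} vct v≢a = (λ a~v → v≢a (sole v vct (sym a~v))) , vct

    link-size : ∀ {s} → Face L s → Nonempty s → ∣ s ∣ ℕ.≤ 3
    link-size {s} l@(a∉s , face) (v , v∈s) = ℕ.s≤s⁻¹ (subst (ℕ._≤ 4) (∣⁅x⁆∪p∣ a∉s)
      (size≤4 face (a , v , x∈p∪q⁺ (inj₁ (x∈⁅x⁆ a)) , x∈p∪q⁺ (inj₂ v∈s) , opposite l v∈s)))

    record Triangles (u v : Fin n) : Set where
      field
        {c d}  : Fin n
        c≢d    : c ≢ d
        c-new  : All (c ≢_) (u ∷ v ∷ [])
        d-new  : All (d ≢_) (u ∷ v ∷ [])
        c-vert : Vertex c
        d-vert : Vertex d
        c-face : F (a ∷ u ∷ v ∷ c ∷ [])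
        d-face : F (a ∷ u ∷ v ∷ d ∷ [])
        only   : ∀ e → Vertex e → All (e ≢_) (u ∷ v ∷ []) → F (a ∷ u ∷ v ∷ e ∷ []) → e ≡ c ⊎ e ≡ d

    -- Neighborliness for the crossing edges au and av gives a tetrahedron whose fourth vertex is
    -- `c`. Then `another` gives `d`, and `at-most-two` excludes any further vertex.
    triangles : ∀ {u v} → u ≢ v → Vertex u → Vertex v → Triangles u v
    triangles {u} {v} u≢v U@(a≁u , uct) V@(a≁v , vct)
      with t , face , size , a∈ ∷ u∈ ∷ _ ∷ v∈ ∷ [] ← neighborly a≁u (edge act uct a≁u) a≁v (edge act vct a≁v)
      with c , c∈ , c∉ ← ∣p∣<∣q∣⇒q⊈p {p = ⟦ a ∷ u ∷ v ∷ [] ⟧} {q = t}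
             (subst (∣ ⟦ a ∷ u ∷ v ∷ [] ⟧ ∣ ℕ.<_) (sym size) (s≤s (ℕ.≤-reflexive
               (∣⟦⟧∣ ((≁⇒≢ a≁u ∷ ≁⇒≢ a≁v ∷ []) ∷ (u≢v ∷ []) ∷ [] ∷ [])))))
      with cauv ← ∈face (c∈ ∷ a∈ ∷ u∈ ∷ v∈ ∷ []) face
      with c≢a ∷ c≢u ∷ c≢v ∷ [] ← ∉⟦⟧⇒fresh {xs = a ∷ u ∷ v ∷ []} c∉
      with d , ((d≢c ∷ d≢a ∷ d≢u ∷ d≢v ∷ []) ∷ _ ∷ a∉uv ∷ uv) , dauv ←
             another {z = v} a≁u ((c≢a ∷ c≢u ∷ c≢v ∷ []) ∷ (≁⇒≢ a≁u ∷ ≁⇒≢ a≁v ∷ []) ∷ (u≢v ∷ []) ∷ [] ∷ []) cauv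
      = record
        { c≢d = ≢-sym d≢c ; c-new = c≢u ∷ c≢v ∷ [] ; d-new = d≢u ∷ d≢v ∷ []
        ; c-vert = active-vertex (active-∈ₗ cauv i₁ i₂ a≁u i₀) c≢a
        ; d-vert = active-vertex (active-∈ₗ dauv i₁ i₂ a≁u i₀) d≢a
        ; c-face = subface (i₁ ∷ i₂ ∷ i₃ ∷ i₀ ∷ []) cauv
        ; d-face = subface (i₁ ∷ i₂ ∷ i₃ ∷ i₀ ∷ []) dauv
        ; only = λ { e (a≁e , _) (e≢u ∷ e≢v ∷ []) auve → one-of e (≢-sym (≁⇒≢ a≁e)) e≢u e≢v
                     (subface (i₃ ∷ i₀ ∷ i₁ ∷ i₂ ∷ []) auve) }
        }
      where
      one-of : ∀ e → e ≢ a → e ≢ u → e ≢ v → F (e ∷ a ∷ u ∷ v ∷ []) → e ≡ c ⊎ e ≡ d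
      one-of e e≢a e≢u e≢v eauv with e ≟ c | e ≟ d
      ... | yes e≡c | _       = inj₁ e≡c
      ... | no _    | yes e≡d = inj₂ e≡d
      ... | no e≢c  | no e≢d  = contradiction eauv (at-most-two a≁u
        ((≢-sym d≢c ∷ ≢-sym e≢c ∷ c≢a ∷ c≢u ∷ c≢v ∷ []) ∷
         (≢-sym e≢d ∷ d≢a ∷ d≢u ∷ d≢v ∷ []) ∷ (e≢a ∷ e≢u ∷ e≢v ∷ []) ∷ a∉uv ∷ uv)
        cauv dauv)

    Sized : ℕ → Subset n → Set
    Sized k s = (Face L s × Nonempty s) × ∣ s ∣ ≡ k

    sized? : ∀ k s → Dec (Sized k s)
    sized? k s = nonemptyFace? L s ×-dec (∣ s ∣ ℕ.≟ k)

    -- The index counts vertices, so `f k` is the number of faces of dimension k - 1.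
    f : ℕ → ℤ
    f k = ∑ ss (𝟙 ∘ sized? k)

    V : ℤ
    V = ∑ vs (𝟙 ∘ vertex?)

    exactly : {xs : List (Fin n)} {s : Subset n} → Unique xs → All (_∈ s) xs → ∣ s ∣ ≡ length xs → s ≡ ⟦ xs ⟧
    exactly uniq xs∈s size = sym (p⊆q∧∣q∣≤∣p∣⇒p≡q (⟦⟧⊆ xs∈s)
      (ℕ.≤-reflexive (trans size (sym (∣⟦⟧∣ uniq)))))

    -- A nonempty face of the link together with `a` is a crossing face, of size at most 4; so only
    -- the sizes 1, 2 and 3 contribute.
    χ-f : χ L ≡ (f 1 ℤ.+ ℤ.-1ℤ ℤ.* f 2) ℤ.+ f 3
    χ-f = begin
      χ L
        ≡⟨ ∑-cong ss split ⟩
      ∑ ss (λ s → (𝟙 (sized? 1 s) ℤ.+ ℤ.-1ℤ ℤ.* 𝟙 (sized? 2 s)) ℤ.+ 𝟙 (sized? 3 s))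
        ≡⟨ trans (∑-+ ss _ _) (cong (ℤ._+ f 3) (∑-+ ss _ _)) ⟩
      (f 1 ℤ.+ ∑ ss (λ s → ℤ.-1ℤ ℤ.* 𝟙 (sized? 2 s))) ℤ.+ f 3
        ≡⟨ cong (λ z → (f 1 ℤ.+ z) ℤ.+ f 3) (∑-*ˡ ss ℤ.-1ℤ (𝟙 ∘ sized? 2)) ⟩
      (f 1 ℤ.+ ℤ.-1ℤ ℤ.* f 2) ℤ.+ f 3 ∎
      where
      open ≡-Reasoning
      weight : ∀ k → 1 ℕ.≤ k → k ℕ.≤ 3 → 1ℤ ℤ.* sign k ≡
               (𝟙 (k ℕ.≟ 1) ℤ.+ ℤ.-1ℤ ℤ.* 𝟙 (k ℕ.≟ 2)) ℤ.+ 𝟙 (k ℕ.≟ 3)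
      weight 1 _ _ = refl
      weight 2 _ _ = refl
      weight 3 _ _ = refl
      weight (suc (suc (suc (suc _)))) _ (s≤s (s≤s (s≤s ())))
      split : ∀ s → 𝟙 (nonemptyFace? L s) ℤ.* sign ∣ s ∣ ≡
              (𝟙 (sized? 1 s) ℤ.+ ℤ.-1ℤ ℤ.* 𝟙 (sized? 2 s)) ℤ.+ 𝟙 (sized? 3 s)
      split s = go (nonemptyFace? L s)
        where
        go : (d : Dec (Face L s × Nonempty s)) → 𝟙 d ℤ.* sign ∣ s ∣ ≡
             (𝟙 (d ×-dec (∣ s ∣ ℕ.≟ 1)) ℤ.+ ℤ.-1ℤ ℤ.* 𝟙 (d ×-dec (∣ s ∣ ℕ.≟ 2))) ℤ.+
             𝟙 (d ×-dec (∣ s ∣ ℕ.≟ 3))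
        go (no _)           = ℤ.*-zeroˡ (sign ∣ s ∣)
        go (yes (face , ne)) = weight ∣ s ∣ (nonempty⇒1≤∣p∣ ne) (link-size face ne)

    f₁ : f 1 ℤ.* + 1 ≡ V
    f₁ = trans (sym (∑-incident (sized? 1) proj₂))
      (∑-cong vs λ v → ∑-𝟙 (λ s → sized? 1 s ×-dec (v ∈? s)) (vertex? v) (enumerates-subsets n)
        (λ s (((face , _) , _) , v∈s) → link-vertex face v∈s)
        λ V@(a≁v , vct) → ⟦ v ∷ [] ⟧ ,
          (((link-face (V ∷ []) (edge act vct a≁v) , v , ∈⟦⟧⁺ {xs = v ∷ []} i₀) ,
            ∣⟦⟧∣ {xs = v ∷ []} ([] ∷ [])) , ∈⟦⟧⁺ {xs = v ∷ []} i₀) ,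
          λ s ((_ , size) , v∈s) → exactly {v ∷ []} ([] ∷ []) (v∈s ∷ []) size)

    -- Incidences of ordered pairs with edges, counted twice: an edge contains 2 · 2 - 2 pairs, and
    -- each pair of distinct vertices spans exactly one edge by `edge-face`.
    f₂ : f 2 ℤ.* (+ 2 ℤ.* + 2 ℤ.- + 2) ≡ V ℤ.* V ℤ.- V
    f₂ = trans (sym (∑-incident-pair (sized? 2) proj₂)) (trans
      (∑-cong vs λ u → ∑-cong vs λ v → ∑-𝟙
        (λ s → sized? 2 s ×-dec distinctPair? (_∈? s) u v) (distinctPair? vertex? u v) (enumerates-subsets n)
        (λ s (((face , _) , _) , u≢v , u∈s , v∈s) → u≢v , link-vertex face u∈s , link-vertex face v∈s)
        λ (u≢v , U , V) → let uniq = (u≢v ∷ []) ∷ [] ∷ [] in ⟦ u ∷ v ∷ [] ⟧ ,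
          (((link-face (U ∷ V ∷ []) (edge-face U V) , u , ∈⟦⟧⁺ {xs = u ∷ v ∷ []} i₀) , ∣⟦⟧∣ uniq) ,
            u≢v , ∈⟦⟧⁺ {xs = u ∷ v ∷ []} i₀ , ∈⟦⟧⁺ {xs = u ∷ v ∷ []} i₁) ,
          λ s ((_ , size) , _ , u∈s , v∈s) → exactly uniq (u∈s ∷ v∈s ∷ []) size)
      (∑-distinctPair vertex?))

    -- A triangle contains 3 · 3 - 3 ordered pairs, and each pair of distinct vertices lies in
    -- exactly two triangles.
    f₃ : f 3 ℤ.* (+ 3 ℤ.* + 3 ℤ.- + 3) ≡ (V ℤ.* V ℤ.- V) ℤ.+ (V ℤ.* V ℤ.- V)
    f₃ = trans (sym (∑-incident-pair (sized? 3) proj₂)) (trans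
      (∑-cong vs λ u → trans
        (∑-cong vs λ v → ∑-𝟙-two _≟ₛ_
          (λ s → sized? 3 s ×-dec distinctPair? (_∈? s) u v) (distinctPair? vertex? u v) (enumerates-subsets n)
          (λ s (((face , _) , _) , u≢v , u∈s , v∈s) → u≢v , link-vertex face u∈s , link-vertex face v∈s)
          (both u v))
        (∑-+ vs _ _))
      (trans (∑-+ vs _ _) (cong (λ z → z ℤ.+ z) (∑-distinctPair vertex?))))
      where
      both : ∀ u v → DistinctPair vertex? u v → ∃₂ λ x y → x ≢ y ×
             (Sized 3 x × DistinctPair (_∈? x) u v) × (Sized 3 y × DistinctPair (_∈? y) u v) ×
             (∀ z → Sized 3 z × DistinctPair (_∈? z) u v → z ≡ x ⊎ z ≡ y)
      both u v (u≢v , U , V) = ⟦ u ∷ v ∷ c ∷ [] ⟧ , ⟦ u ∷ v ∷ d ∷ [] ⟧ ,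
        (λ eq → c∉uvd (subst (c ∈_) eq (∈⟦⟧⁺ {xs = u ∷ v ∷ c ∷ []} i₂))) ,
        triangle c-vert c-new c-face , triangle d-vert d-new d-face , others
        where
        open Triangles (triangles u≢v U V)
        uniq : ∀ {e} → All (e ≢_) (u ∷ v ∷ []) → Unique (u ∷ v ∷ e ∷ [])
        uniq (e≢u ∷ e≢v ∷ []) = (u≢v ∷ ≢-sym e≢u ∷ []) ∷ (≢-sym e≢v ∷ []) ∷ [] ∷ []
        c∉uvd : ¬ c ∈ ⟦ u ∷ v ∷ d ∷ [] ⟧
        c∉uvd c∈ with ∈⟦⟧⁻ (u ∷ v ∷ d ∷ []) c∈ | c-new
        ... | here c≡u                 | c≢u ∷ _     = c≢u c≡u
        ... | there (here c≡v)         | _ ∷ c≢v ∷ _ = c≢v c≡v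
        ... | there (there (here c≡d)) | _           = c≢d c≡d
        triangle : ∀ {e} → Vertex e → All (e ≢_) (u ∷ v ∷ []) → F (a ∷ u ∷ v ∷ e ∷ []) →
                   Sized 3 ⟦ u ∷ v ∷ e ∷ [] ⟧ × DistinctPair (_∈? ⟦ u ∷ v ∷ e ∷ [] ⟧) u v
        triangle {e} E e-new face =
          ((link-face (U ∷ V ∷ E ∷ []) face , u , ∈⟦⟧⁺ {xs = u ∷ v ∷ e ∷ []} i₀) , ∣⟦⟧∣ (uniq e-new)) ,
          u≢v , ∈⟦⟧⁺ {xs = u ∷ v ∷ e ∷ []} i₀ , ∈⟦⟧⁺ {xs = u ∷ v ∷ e ∷ []} i₁
        others : ∀ z → Sized 3 z × DistinctPair (_∈? z) u v → z ≡ ⟦ u ∷ v ∷ c ∷ [] ⟧ ⊎ z ≡ ⟦ u ∷ v ∷ d ∷ [] ⟧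
        others z (((face , ne) , size) , _ , u∈z , v∈z)
          with e , e∈z , e∉ ← ∣p∣<∣q∣⇒q⊈p {p = ⟦ u ∷ v ∷ [] ⟧} {q = z}
                 (subst (∣ ⟦ u ∷ v ∷ [] ⟧ ∣ ℕ.<_) (sym size)
                   (s≤s (ℕ.≤-reflexive (∣⟦⟧∣ ((u≢v ∷ []) ∷ [] ∷ [])))))
          with e-new ← ∉⟦⟧⇒fresh {xs = u ∷ v ∷ []} e∉
          = Sum.map (trans z≡ ∘ cong λ e → ⟦ u ∷ v ∷ e ∷ [] ⟧) (trans z≡ ∘ cong λ e → ⟦ u ∷ v ∷ e ∷ [] ⟧)
              (only e (link-vertex face e∈z) e-new (∈face
                (x∈p∪q⁺ (inj₁ (x∈⁅x⁆ a)) ∷ x∈p∪q⁺ (inj₂ u∈z) ∷ x∈p∪q⁺ (inj₂ v∈z) ∷ x∈p∪q⁺ (inj₂ e∈z) ∷ [])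
                (proj₂ face)))
          where
          z≡ : z ≡ ⟦ u ∷ v ∷ e ∷ [] ⟧
          z≡ = exactly {u ∷ v ∷ e ∷ []} (uniq e-new) (u∈z ∷ v∈z ∷ e∈z ∷ []) size

    -- By f₂ and f₃, 6 χ = 6 f 1 - 3 (2 f 2) + 6 f 3 = 6 V - V (V - 1), and χ = 2.
    V-quadratic : V ℤ.* V ℤ.+ + 12 ≡ + 7 ℤ.* V
    V-quadratic = begin
      V ℤ.* V ℤ.+ + 12
        -- The constant 12 is 6 χ (∂Δ 3), where χ (∂Δ 3) evaluates to 4 - 6 + 4 = 2.
        ≡⟨ cong (λ z → V ℤ.* V ℤ.+ + 6 ℤ.* z) (trans (sym (χ-invariant sphere)) χ-f) ⟩
      V ℤ.* V ℤ.+ + 6 ℤ.* ((f 1 ℤ.+ ℤ.-1ℤ ℤ.* f 2) ℤ.+ f 3)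
        ≡⟨ solve 4 (λ v x y z → v :* v :+ con (+ 6) :* ((x :+ con ℤ.-1ℤ :* y) :+ z) :=
             v :* v :+ ((con (+ 6) :* (x :* con (+ 1)) :-
                         con (+ 3) :* (y :* (con (+ 2) :* con (+ 2) :- con (+ 2)))) :+
             z :* (con (+ 3) :* con (+ 3) :- con (+ 3)))) refl V (f 1) (f 2) (f 3) ⟩
      V ℤ.* V ℤ.+ ((+ 6 ℤ.* (f 1 ℤ.* + 1) ℤ.- + 3 ℤ.* (f 2 ℤ.* (+ 2 ℤ.* + 2 ℤ.- + 2))) ℤ.+
        f 3 ℤ.* (+ 3 ℤ.* + 3 ℤ.- + 3))
        ≡⟨ cong₂ (λ x y → V ℤ.* V ℤ.+ (x ℤ.+ y))
             (cong₂ (λ x y → + 6 ℤ.* x ℤ.- + 3 ℤ.* y) f₁ f₂) f₃ ⟩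
      V ℤ.* V ℤ.+ ((+ 6 ℤ.* V ℤ.- + 3 ℤ.* (V ℤ.* V ℤ.- V)) ℤ.+ ((V ℤ.* V ℤ.- V) ℤ.+ (V ℤ.* V ℤ.- V)))
        ≡⟨ solve 1 (λ v → v :* v :+ ((con (+ 6) :* v :- con (+ 3) :* (v :* v :- v)) :+
             ((v :* v :- v) :+ (v :* v :- v))) := con (+ 7) :* v) refl V ⟩
      + 7 ℤ.* V ∎
      where
      open ≡-Reasoning
      open +-*-Solver

    -- The integer `V` is identified with the size of a subset, which turns five distinct vertices
    -- into the bound 5 ≤ V.
    at-most-four : ∀ {xs} → Unique xs → All Vertex xs → length xs ≢ 5
    at-most-four {xs} uniq vxs len = no-large-solution ∣ W ∣
      (subst (ℕ._≤ ∣ W ∣) (trans (∣⟦⟧∣ uniq) len)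
        (p⊆q⇒∣p∣≤∣q∣ (⟦⟧⊆ (All.map (∈comprehension⁺ vertex?) vxs))))
      (subst (λ z → z ℤ.* z ℤ.+ + 12 ≡ + 7 ℤ.* z) V≡∣W∣ V-quadratic)
      where
      W : Subset n
      W = comprehension vertex?
      V≡∣W∣ : V ≡ + ∣ W ∣
      V≡∣W∣ = trans
        (∑-cong vs λ v → 𝟙-cong (vertex? v) (v ∈? W) (∈comprehension⁺ vertex?) (∈comprehension⁻ vertex?))
        (∑-∈ W)

    -- Neighborliness of ab with itself yields a tetrahedron on ab and thus a second vertex `c` of
    -- the link. The two triangles at the edge bc supply `d` and `e`, which disposes of the root 3.
    four : ∃₂ λ c d → ∃ λ e → Unique (b ∷ c ∷ d ∷ e ∷ []) × All Vertex (b ∷ c ∷ d ∷ e ∷ [])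
    four
      with t , face , size , a∈ ∷ b∈ ∷ _ ← neighborly a≁b ab a≁b ab
      with c , c∈ , c∉ ← ∣p∣<∣q∣⇒q⊈p {p = ⟦ a ∷ b ∷ [] ⟧} {q = t}
             (subst (∣ ⟦ a ∷ b ∷ [] ⟧ ∣ ℕ.<_) (sym size) (s≤s (ℕ.≤-trans (ℕ.≤-reflexive
               (∣⟦⟧∣ ((≁⇒≢ a≁b ∷ []) ∷ [] ∷ []))) (s≤s (s≤s z≤n)))))
      with c≢a ∷ c≢b ∷ [] ← ∉⟦⟧⇒fresh {xs = a ∷ b ∷ []} c∉
      with C ← active-vertex (active-∈ face (a , b , a∈ , b∈ , a≁b) c∈) c≢a
      with record { c = d ; d = e ; c≢d = d≢e ; c-vert = D ; d-vert = E
                  ; c-new = d≢b ∷ d≢c ∷ [] ; d-new = e≢b ∷ e≢c ∷ [] }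
             ← triangles (≢-sym c≢b) (a≁b , bct) C
      = c , d , e ,
        ((≢-sym c≢b ∷ ≢-sym d≢b ∷ ≢-sym e≢b ∷ []) ∷ (≢-sym d≢c ∷ ≢-sym e≢c ∷ []) ∷ (d≢e ∷ []) ∷ [] ∷ []) ,
        (a≁b , bct) ∷ C ∷ D ∷ E ∷ []

    -- Two distinct triangles at uv compete for the two candidates `x` and `y`, so both candidates
    -- occur.
    forced : ∀ {u v x y} → u ≢ v → Vertex u → Vertex v →
             (∀ w → Vertex w → All (w ≢_) (u ∷ v ∷ []) → w ≡ x ⊎ w ≡ y) → F (a ∷ u ∷ v ∷ y ∷ [])
    forced {u} {v} u≢v U V covers = go (covers c c-vert c-new) (covers d d-vert d-new)
      where
      open Triangles (triangles u≢v U V)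
      go : ∀ {x y} → c ≡ x ⊎ c ≡ y → d ≡ x ⊎ d ≡ y → F (a ∷ u ∷ v ∷ y ∷ [])
      go (inj₂ c≡y) _          = subst (λ y → F (a ∷ u ∷ v ∷ y ∷ [])) c≡y c-face
      go _          (inj₂ d≡y) = subst (λ y → F (a ∷ u ∷ v ∷ y ∷ [])) d≡y d-face
      go (inj₁ c≡x) (inj₁ d≡x) = contradiction (trans c≡x (sym d≡x)) c≢d

    crossing≅simplexBoundary : crossingCells M side ≅ simplexBoundary
    crossing≅simplexBoundary
      with c , d , e , uniq@((b≢c ∷ b≢d ∷ b≢e ∷ []) ∷ (c≢d ∷ c≢e ∷ []) ∷ (d≢e ∷ []) ∷ [] ∷ []) ,
           allv@(B ∷ C ∷ D ∷ E ∷ []) ← four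
      = ≅-trans (P.crossing≅product {SphereFace} ≤3 faces) product≅simplexBoundary
      where
      bs : Vec (Fin n) 4
      bs = b ∷ c ∷ d ∷ e ∷ []
      fifth : ∀ {v} → Vertex v → All (v ≢_) (b ∷ c ∷ d ∷ e ∷ []) → Empty.⊥
      fifth V new = at-most-four (new ∷ uniq) (V ∷ allv) refl
      apexSide : SideOf a (a ∷ [])
      apexSide = record
        { same-side = λ { zero → refl } ; is-active = λ { zero → act }
        ; unique = [] ∷ [] ; complete = λ v vct v~a → zero , sym (sole v vct v~a) }
      baseSide : SideOf b bs
      baseSide = record
        { same-side = λ
          { zero → refl
          ; (suc zero) → ≁≁⇒~ (≢-sym (proj₁ C)) (≢-sym a≁b)
          ; (suc (suc zero)) → ≁≁⇒~ (≢-sym (proj₁ D)) (≢-sym a≁b)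
          ; (suc (suc (suc zero))) → ≁≁⇒~ (≢-sym (proj₁ E)) (≢-sym a≁b) }
        ; is-active = λ
          { zero → bct ; (suc zero) → proj₂ C ; (suc (suc zero)) → proj₂ D ; (suc (suc (suc zero))) → proj₂ E }
        ; unique = (b≢c ∷ b≢d ∷ b≢e ∷ []) ∷ (c≢d ∷ c≢e ∷ []) ∷ (d≢e ∷ []) ∷ [] ∷ []
        ; complete = complete-if bs λ (v , (vct , v~b) , new) →
            fifth (≁~ a≁b (sym v~b) , vct)
              (≢-sym (new zero) ∷ ≢-sym (new (suc zero)) ∷ ≢-sym (new (suc (suc zero))) ∷
               ≢-sym (new (suc (suc (suc zero)))) ∷ [])
        }
      module P = Product a≁b apexSide baseSide
      ≤3 : ∀ {s} → Face M s → Crossing M side s → SphereFace (restrict (a ∷ []) s) (restrict bs s)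
      ≤3 {s} face cross = ℕ.s≤s⁻¹ (ℕ.≤-trans
        (ℕ.+-monoˡ-≤ ∣ restrict bs s ∣ (nonempty⇒1≤∣p∣ (proj₁ (P.restrict-nonempty face cross))))
        (subst (ℕ._≤ 4) (sym (P.size face cross)) (size≤4 face cross)))
      remaining : ∀ {u v x y} →
        (∀ {w} → All (w ≢_) (u ∷ v ∷ x ∷ y ∷ []) → All (w ≢_) (b ∷ c ∷ d ∷ e ∷ [])) →
                  ∀ w → Vertex w → All (w ≢_) (u ∷ v ∷ []) → w ≡ x ⊎ w ≡ y
      remaining {x = x} {y} permute w W (w≢u ∷ w≢v ∷ []) with w ≟ x | w ≟ y
      ... | yes w≡x | _       = inj₁ w≡x
      ... | no _    | yes w≡y = inj₂ w≡y
      ... | no w≢x  | no w≢y  = contradiction (permute (w≢u ∷ w≢v ∷ w≢x ∷ w≢y ∷ [])) (fifth W)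
      bcd : F (a ∷ b ∷ c ∷ d ∷ [])
      -- The order of the last two names selects the third vertex: `forced` returns the triangle on
      -- the last one. In the pattern the names denote inequality proofs and shadow the vertices.
      bcd = forced b≢c B C (remaining λ { (b ∷ c ∷ e ∷ d ∷ []) → b ∷ c ∷ d ∷ e ∷ [] })
      bce : F (a ∷ b ∷ c ∷ e ∷ [])
      bce = forced b≢c B C (remaining λ { (b ∷ c ∷ d ∷ e ∷ []) → b ∷ c ∷ d ∷ e ∷ [] })
      bde : F (a ∷ b ∷ d ∷ e ∷ [])
      bde = forced b≢d B D (remaining λ { (b ∷ d ∷ c ∷ e ∷ []) → b ∷ c ∷ d ∷ e ∷ [] })
      cde : F (a ∷ c ∷ d ∷ e ∷ [])
      cde = forced c≢d C D (remaining λ { (c ∷ d ∷ b ∷ e ∷ []) → b ∷ c ∷ d ∷ e ∷ [] })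
      faces : ∀ t u → SphereFace t u → Face M (image (a ∷ []) t ∪ image bs u)
      faces t u@(outside ∷ _ ∷ _ ∷ _ ∷ []) _ =
        image∪image-face (a ∷ []) bs t u (λ { {zero} _ → i₀ })
        (λ { {suc zero} _ → i₁ ; {suc (suc zero)} _ → i₂ ; {suc (suc (suc zero))} _ → i₃ }) cde
      faces t u@(inside ∷ outside ∷ _ ∷ _ ∷ []) _ =
        image∪image-face (a ∷ []) bs t u (λ { {zero} _ → i₀ })
        (λ { {zero} _ → i₁ ; {suc zero} (there ())
           ; {suc (suc zero)} _ → i₂ ; {suc (suc (suc zero))} _ → i₃ }) bde
      faces t u@(inside ∷ inside ∷ outside ∷ _ ∷ []) _ =
        image∪image-face (a ∷ []) bs t u (λ { {zero} _ → i₀ })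
        (λ { {zero} _ → i₁ ; {suc zero} _ → i₂
           ; {suc (suc zero)} (there (there ())) ; {suc (suc (suc zero))} _ → i₃ }) bce
      faces t u@(inside ∷ inside ∷ inside ∷ outside ∷ []) _ =
        image∪image-face (a ∷ []) bs t u (λ { {zero} _ → i₀ })
        (λ { {zero} _ → i₁ ; {suc zero} _ → i₂
           ; {suc (suc zero)} _ → i₃ ; {suc (suc (suc zero))} (there (there (there ()))) }) bcd
      faces t (inside ∷ inside ∷ inside ∷ inside ∷ []) (s≤s (s≤s (s≤s ())))

-- Case distinction on the sizes of the two sides

module _ {M : SimplicialComplex n} {side : Fin n → Bool} (S : IsNeighborlySurface M side)
         (spheres : ∀ v → Face M ⁅ v ⁆ → IsCombinatorialSphere 2 (link M v)) where
  open Classification S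
  open Quadrangulated S using (Pair; prism-or-grid)

  private
    Partner : Fin n → Fin n → Set
    Partner r v = Active v × v ~ r × r ≢ v

    partner? : ∀ r → Dec (∃ (Partner r))
    partner? r = any? λ v → active? v ×-dec (side v Bool.≟ side r) ×-dec ¬? (r ≟ v)

    pair : ∀ {r v} → Active r → Partner r v → Pair r v
    pair act (act₁ , v~r , r≢v) = record
      { active₀ = act ; active₁ = act₁ ; same-side = v~r ; distinct = r≢v }

    cone : ∀ {r s} → r ≁ s → Active r → Active s → ¬ ∃ (Partner r) → crossingCells M side ≅ simplexBoundary
    cone {r} r≁s act@(_ , _ , is-face face) bct none = Cone.crossing≅simplexBoundary S r≁s act bct
      (λ v vct v~r → decidable-stable (v ≟ r) λ v≢r → none (v , vct , v~r , ≢-sym v≢r))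
      (spheres r (closed M (λ x∈ → x∈p∪q⁺ (inj₁ x∈)) face))

  classification : (crossingCells M side ≅ simplexBoundary) ⊎
                   (crossingCells M side ≅ prismBoundary) ⊎ (crossingCells M side ≅ gridTorus)
  classification
    with s , face , cross@(a , b , a∈ , b∈ , a≁b) ← crossing-face
    with act ← active-∈ face cross a∈ | bct ← active-∈ face cross b∈
    with partner? a | partner? b
  ... | no none          | _               = inj₁ (cone a≁b act bct none)
  ... | yes _            | no none         = inj₁ (cone (≢-sym a≁b) bct act none)
  ... | yes (_ , partner) | yes (_ , partner′) =
    inj₂ (prism-or-grid a≁b (pair act partner) (pair bct partner′))

-- Level sets of simplexwise linear functions

-- For an edge with values y < x < z, put p = x - y and q = z - x. Writing x as y + p and z as (y +
-- p) + q removes subtraction, so the identities hold in any commutative semiring.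
module Interpolation (R : CommutativeSemiring ℓ₁ ℓ₂) where
  open CommutativeSemiring R using (_≈_; _+_; _*_) renaming (refl to ≈-refl)
  open SemiringSolver R

  weights-total : ∀ p q i → q * i + p * i ≈ (p + q) * i
  weights-total = solve 3 (λ p q i → q :* i :+ p :* i := (p :+ q) :* i) ≈-refl

  distribute : ∀ d d′ m m′ y → (d * m + d′ * m′) * y ≈ d * (m * y) + d′ * (m′ * y)
  distribute = solve 5 (λ d d′ m m′ y → (d :* m :+ d′ :* m′) :* y := d :* (m :* y) :+ d′ :* (m′ :* y)) ≈-refl

  interpolate : ∀ p q i y → (q * i) * y + (p * i) * ((y + p) + q) ≈ ((p + q) * i) * (y + p)
  interpolate = solve 4 (λ p q i y → (q :* i) :* y :+ (p :* i) :* ((y :+ p) :+ q) :=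
                                     ((p :+ q) :* i) :* (y :+ p)) ≈-refl

module OrderedFieldProperties (𝕂 : OrderedField ℓ ℓ₁ ℓ₂) where
  open OrderedField 𝕂 hiding (zero) renaming (refl to ≈-refl; sym to ≈-sym; trans to ≈-trans)
  open IsStrictTotalOrder isStrictTotalOrder using (compare; <-respʳ-≈; <-respˡ-≈)
    renaming (trans to <-trans; irrefl to <-irrefl)
  open GroupProperties +-group using () renaming (∙-cancelʳ to +-cancelʳ)
  open CommutativeMonoidSum +-commutativeMonoid using (∑-distrib-+; sum-cong-≋; sum-replicate-zero)
  open SemiringSum semiring using (*-distribʳ-sum)
  open SetoidReasoning setoid
  open Interpolation commutativeSemiring

  <⇒0<- : ∀ {x y} → x < y → 0# < (- x + y)
  <⇒0<- {x} x<y = <-respˡ-≈ (-‿inverseˡ x) (+-monoʳ-< (- x) x<y)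

  x+[-x+y]≈y : ∀ x y → x + (- x + y) ≈ y
  x+[-x+y]≈y x y = ≈-trans (≈-sym (+-assoc x (- x) y)) (≈-trans (+-congʳ (-‿inverseʳ x)) (+-identityˡ y))

  0<+ : ∀ {x y} → 0# < x → 0# ≤ y → 0# < (x + y)
  0<+ {x} {y} 0<x (inj₁ 0<y) = <-trans 0<x (<-respˡ-≈ (+-identityʳ x) (+-monoʳ-< x 0<y))
  0<+ {x} {y} 0<x (inj₂ 0≈y) = <-respʳ-≈ (≈-trans (≈-sym (+-identityʳ x)) (+-congˡ 0≈y)) 0<x

  0≤+ : ∀ {x y} → 0# ≤ x → 0# ≤ y → 0# ≤ (x + y)
  0≤+ (inj₁ 0<x) 0≤y = inj₁ (0<+ 0<x 0≤y)
  0≤+ {x} {y} (inj₂ 0≈x) 0≤y = Sum.map (<-respʳ-≈ y≈x+y) (λ 0≈y → ≈-trans 0≈y y≈x+y) 0≤y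
    where y≈x+y = ≈-trans (≈-sym (+-identityˡ y)) (+-congʳ 0≈x)

  0≤sum : ∀ {n} (p : Fin n → Carrier) → (∀ v → 0# ≤ p v) → 0# ≤ sum p
  0≤sum {zero}  p 0≤p = inj₂ ≈-refl
  0≤sum {suc n} p 0≤p = 0≤+ (0≤p zero) (0≤sum (p ∘ suc) (0≤p ∘ suc))

  0<sum : ∀ {n} (p : Fin n → Carrier) → (∀ v → 0# ≤ p v) → ∀ v → 0# < p v → 0# < sum p
  0<sum p 0≤p zero    0<pv = 0<+ 0<pv (0≤sum (p ∘ suc) (0≤p ∘ suc))
  0<sum p 0≤p (suc v) 0<pv = <-respʳ-≈ (+-comm _ _) (0<+ (0<sum (p ∘ suc) (0≤p ∘ suc) v 0<pv) (0≤p zero))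

  0<inverse : ∀ {x y} → 0# < x → x * y ≈ 1# → 0# < y
  0<inverse {x} {y} 0<x xy≈1 with compare 0# y
  ... | tri< 0<y _ _ = 0<y
  ... | tri≈ _ 0≈y _ = contradiction 0<1
    (<-irrefl (≈-trans (≈-sym (zeroʳ x)) (≈-trans (*-congˡ 0≈y) xy≈1)))
  ... | tri> _ _ y<0 = contradiction (0<+ 0<1 (inj₁ (*-positive 0<x 0<-y)))
    (<-irrefl (≈-sym (≈-trans (+-congʳ (≈-sym xy≈1)) (≈-trans (≈-sym (distribˡ x y (- y)))
      (≈-trans (*-congˡ (-‿inverseʳ y)) (zeroʳ x))))))
    where
    0<-y : 0# < (- y)
    0<-y = <-respʳ-≈ (+-identityʳ (- y)) (<⇒0<- y<0)

  δ : Fin n → Fin n → Carrier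
  δ v i = if does (i ≟ v) then 1# else 0#

  sum-δ : (v : Fin n) (g : Fin n → Carrier) → sum (λ i → δ v i * g i) ≈ g v
  sum-δ {suc n} zero g = begin
    1# * g zero + sum (λ i → 0# * g (suc i)) ≈⟨ +-cong (*-identityˡ _) (sum-cong-≋ {n} λ i → zeroˡ (g (suc i))) ⟩
    g zero + sum {n} (λ _ → 0#)              ≈⟨ +-congˡ (sum-replicate-zero n) ⟩
    g zero + 0#                              ≈⟨ +-identityʳ _ ⟩
    g zero                                   ∎
  sum-δ (suc v) g = begin
    0# * g zero + sum (λ i → δ v i * g (suc i)) ≈⟨ +-cong (zeroˡ _) (sum-δ v (g ∘ suc)) ⟩
    0# + g (suc v)                              ≈⟨ +-identityˡ _ ⟩
    g (suc v)                                   ∎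

  δ-nonneg : (v i : Fin n) → ∀ {s} → 0# < s → 0# ≤ (δ v i * s)
  δ-nonneg v i {s} 0<s with i ≟ v
  ... | yes _ = inj₁ (<-respʳ-≈ (≈-sym (*-identityˡ s)) 0<s)
  ... | no _  = inj₂ (≈-sym (zeroˡ s))

  δ-pos : (v : Fin n) → ∀ {s} → 0# < s → 0# < (δ v v * s)
  δ-pos v {s} 0<s with v ≟ v
  ... | yes _  = <-respʳ-≈ (≈-sym (*-identityˡ s)) 0<s
  ... | no v≢v = contradiction refl v≢v

  δ-zero : {v i : Fin n} → i ≢ v → ∀ s → δ v i * s ≈ 0#
  δ-zero {v = v} {i} i≢v s with i ≟ v
  ... | yes i≡v = contradiction i≡v i≢v
  ... | no _    = zeroˡ s

  -- If the sum were 0, no weight could be positive, because a single positive term makes a sum of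
  -- nonnegative terms positive; but the weights add up to 1.
  weighted-sum≉0 : {σ : Subset n} {a g : Fin n → Carrier} → _∈∣_∣ 𝕂 a σ → (∀ v → v ∈ σ → 0# < g v) →
                   ¬ sum (λ v → a v * g v) ≈ 0#
  weighted-sum≉0 {n} {σ} {a} {g} a∈σ 0<g ≈0 = <-irrefl (≈-trans (≈-sym sum≈0) total) 0<1
    where
    open _∈∣_∣ a∈σ
    0≤ag : ∀ v → 0# ≤ (a v * g v)
    0≤ag v with v ∈? σ | nonneg v
    ... | no v∉σ | _ = inj₂ (≈-sym (≈-trans (*-congʳ (support v v∉σ)) (zeroˡ (g v))))
    ... | yes v∈σ | inj₁ 0<av = inj₁ (*-positive 0<av (0<g v v∈σ))
    ... | yes v∈σ | inj₂ 0≈av = inj₂ (≈-sym (≈-trans (*-congʳ (≈-sym 0≈av)) (zeroˡ (g v))))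
    a≈0 : ∀ v → a v ≈ 0#
    a≈0 v with v ∈? σ | nonneg v
    ... | no v∉σ  | _         = support v v∉σ
    ... | yes _   | inj₂ 0≈av = ≈-sym 0≈av
    ... | yes v∈σ | inj₁ 0<av = contradiction
      (0<sum (λ v → a v * g v) 0≤ag v (*-positive 0<av (0<g v v∈σ))) (<-irrefl (≈-sym ≈0))
    sum≈0 : sum a ≈ 0#
    sum≈0 = ≈-trans (sum-cong-≋ {n} a≈0) (sum-replicate-zero n)

  module Slice {M : SimplicialComplex n} (f : RSL 𝕂 M) (x : Carrier)
               (regular-value : IsRegularValue 𝕂 f x) where
    open RSL f

    side : Fin n → Bool
    side v = does (IsStrictTotalOrder._<?_ isStrictTotalOrder (value v) x)

    Below Above : Fin n → Set ℓ₂
    Below v = value v < x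
    Above v = x < value v

    OnLevel : Subset n → (Fin n → Carrier) → Set _
    OnLevel = InLevel 𝕂 f x

    vertex-face : ∀ {s v} → Face M s → v ∈ s → Face M ⁅ v ⁆
    vertex-face {s} {v} face v∈s = closed M (λ u∈ → subst (_∈ s) (sym (x∈⁅y⁆⇒x≡y v u∈)) v∈s) face

    below-or-above : ∀ {s v} → Face M s → v ∈ s → (side v ≡ true × Below v) ⊎ (side v ≡ false × Above v)
    below-or-above {v = v} face v∈s with compare (value v) x
    ... | tri< below _ _ = inj₁ (refl , below)
    ... | tri≈ _ eq _    = contradiction (≈-sym eq) (regular-value v (vertex-face face v∈s))
    ... | tri> _ _ above = inj₂ (refl , above)

    below-above : ∀ {s} → Face M s → Crossing M side s → ∃₂ λ v w → v ∈ s × w ∈ s × Below v × Above w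
    below-above face (v , w , v∈ , w∈ , v⋈w) with below-or-above face v∈ | below-or-above face w∈
    ... | inj₁ (_ , below) | inj₂ (_ , above) = v , w , v∈ , w∈ , below , above
    ... | inj₂ (_ , above) | inj₁ (_ , below) = w , v , w∈ , v∈ , below , above
    ... | inj₁ (eq , _)    | inj₁ (eq′ , _)   = contradiction (trans eq (sym eq′)) v⋈w
    ... | inj₂ (eq , _)    | inj₂ (eq′ , _)   = contradiction (trans eq (sym eq′)) v⋈w

    -- μ and ν are the barycentric coordinates of the intersection of the edge vw
    -- with the level x.
    module EdgePoint (v w : Fin n) (below : Below v) (above : Above w) where
      p q i μ ν : Carrier
      p = - value v + x
      q = - x + value w
      0<p : 0# < p
      0<p = <⇒0<- below
      0<q : 0# < q
      0<q = <⇒0<- above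
      0<p+q : 0# < (p + q)
      0<p+q = 0<+ 0<p (inj₁ 0<q)
      p+q⁻¹ : ∃ λ i → ((p + q) * i) ≈ 1#
      p+q⁻¹ = inverse (p + q) (λ eq → <-irrefl (≈-sym eq) 0<p+q)
      i = proj₁ p+q⁻¹
      μ = q * i
      ν = p * i
      [p+q]i≈1 : (p + q) * i ≈ 1#
      [p+q]i≈1 = proj₂ p+q⁻¹
      0<i : 0# < i
      0<i = 0<inverse 0<p+q [p+q]i≈1
      0<μ : 0# < μ
      0<μ = *-positive 0<q 0<i
      0<ν : 0# < ν
      0<ν = *-positive 0<p 0<i
      point : Fin n → Carrier
      point j = δ v j * μ + δ w j * ν

      point-total : sum point ≈ 1#
      point-total = begin
        sum point                                     ≈⟨ ∑-distrib-+ (λ j → δ v j * μ) (λ j → δ w j * ν) ⟩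
        sum (λ j → δ v j * μ) + sum (λ j → δ w j * ν) ≈⟨ +-cong (sum-δ v (λ _ → μ)) (sum-δ w (λ _ → ν)) ⟩
        q * i + p * i                                 ≈⟨ weights-total p q i ⟩
        (p + q) * i                                   ≈⟨ [p+q]i≈1 ⟩
        1#                                            ∎

      y+p≈x : value v + p ≈ x
      y+p≈x = x+[-x+y]≈y (value v) x

      point-level : sum (λ j → point j * value j) ≈ x
      point-level = begin
        sum (λ j → point j * value j)
          ≈⟨ sum-cong-≋ {n} (λ j → distribute (δ v j) (δ w j) μ ν (value j)) ⟩
        sum (λ j → δ v j * (μ * value j) + δ w j * (ν * value j))
          ≈⟨ ∑-distrib-+ (λ j → δ v j * (μ * value j)) (λ j → δ w j * (ν * value j)) ⟩
        sum (λ j → δ v j * (μ * value j)) + sum (λ j → δ w j * (ν * value j))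
          ≈⟨ +-cong (sum-δ v (λ j → μ * value j)) (sum-δ w (λ j → ν * value j)) ⟩
        μ * value v + ν * value w
          ≈⟨ +-congˡ (*-congˡ (≈-trans (+-congʳ y+p≈x) (x+[-x+y]≈y x (value w)))) ⟨
        μ * value v + ν * ((value v + p) + q)
          ≈⟨ interpolate p q i (value v) ⟩
        ((p + q) * i) * (value v + p)
          ≈⟨ *-cong [p+q]i≈1 y+p≈x ⟩
        1# * x
          ≈⟨ *-identityˡ x ⟩
        x ∎

    abstract
      -- The positive coordinates at both ends are what later recovers the vertices of a face from
      -- its level set.
      edge-point : ∀ {s v w} → v ∈ s → w ∈ s → Below v → Above w →
                   ∃ λ a → OnLevel s a × 0# < a v × 0# < a w
      edge-point {s} {v} {w} v∈ w∈ below above = point , (record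
        { nonneg  = λ j → 0≤+ (δ-nonneg v j 0<μ) (δ-nonneg w j 0<ν)
        ; total   = point-total
        ; support = λ u u∉s → ≈-trans (+-cong (δ-zero (λ u≡v → u∉s (subst (_∈ s) (sym u≡v) v∈)) μ)
                                              (δ-zero (λ u≡w → u∉s (subst (_∈ s) (sym u≡w) w∈)) ν))
                                      (+-identityˡ 0#)
        } , point-level) ,
        0<+ (δ-pos v 0<μ) (δ-nonneg w v 0<ν) ,
        <-respʳ-≈ (+-comm (δ w w * ν) (δ v w * μ)) (0<+ (δ-pos w 0<ν) (δ-nonneg v w 0<μ))
        where open EdgePoint v w below above

    -- Kept symmetric in `g` and `h`, because faces wholly above and wholly below the level need the
    -- difference of `value` and `x` with opposite signs.
    shifted-sum : (a g h : Fin n → Carrier) →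
                  sum (λ v → a v * g v) ≈ x → sum (λ v → a v * h v) ≈ x →
                  sum (λ v → a v * (- g v + h v)) ≈ 0#
    shifted-sum a g h g≈x h≈x = +-cancelʳ x _ _ (begin
      sum (λ v → a v * (- g v + h v)) + x
        ≈⟨ +-congˡ g≈x ⟨
      sum (λ v → a v * (- g v + h v)) + sum (λ v → a v * g v)
        ≈⟨ ∑-distrib-+ (λ v → a v * (- g v + h v)) (λ v → a v * g v) ⟨
      sum (λ v → a v * (- g v + h v) + a v * g v)
        ≈⟨ sum-cong-≋ {n} (λ v → ≈-trans (≈-sym (distribˡ (a v) _ _))
             (*-congˡ (≈-trans (+-comm _ _) (x+[-x+y]≈y (g v) (h v))))) ⟩
      sum (λ v → a v * h v)
        ≈⟨ h≈x ⟩
      x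
        ≈⟨ +-identityˡ x ⟨
      0# + x ∎)

    constant-sum : ∀ {a : Fin n → Carrier} → sum a ≈ 1# → sum (λ v → a v * x) ≈ x
    constant-sum {a} total = ≈-trans (≈-sym (*-distribʳ-sum x a)) (≈-trans (*-congʳ total) (*-identityˡ x))

    -- If all vertices lay above the level, the positive numbers `value v` - x would have weighted
    -- mean 0, and similarly below; `weighted-sum≉0` excludes both.
    level⇒crossing : ∀ {s a} → Face M s → OnLevel s a → Crossing M side s
    level⇒crossing {s} {a} face (a∈s , level)
      with any? (λ v → (v ∈? s) ×-dec (side v Bool.≟ true))
         | any? (λ v → (v ∈? s) ×-dec (side v Bool.≟ false))
    ... | yes (v , v∈ , v-below) | yes (w , w∈ , w-above) =
      v , w , v∈ , w∈ , λ eq → contradiction (trans (sym v-below) (trans eq w-above)) λ ()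
    ... | no none | _ = contradiction
      (shifted-sum a (λ _ → x) value (constant-sum (_∈∣_∣.total a∈s)) level)
      (weighted-sum≉0 a∈s λ v v∈ → <⇒0<- (all-above v v∈))
      where
      all-above : ∀ v → v ∈ s → Above v
      all-above v v∈ with below-or-above face v∈
      ... | inj₁ (eq , _)    = contradiction (v , v∈ , eq) none
      ... | inj₂ (_ , above) = above
    ... | yes _ | no none = contradiction
      (shifted-sum a value (λ _ → x) level (constant-sum (_∈∣_∣.total a∈s)))
      (weighted-sum≉0 a∈s λ v v∈ → <⇒0<- (all-below v v∈))
      where
      all-below : ∀ v → v ∈ s → Below v
      all-below v v∈ with below-or-above face v∈
      ... | inj₁ (_ , below) = below
      ... | inj₂ (eq , _)    = contradiction (v , v∈ , eq) none

    ⊆⇒level : ∀ {s t} → s ⊆ t → ∀ a → OnLevel s a → OnLevel t a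
    ⊆⇒level s⊆t a (a∈s , level) = record
      { nonneg = nonneg ; total = total ; support = λ v v∉t → support v (v∉t ∘ s⊆t) } , level
      where open _∈∣_∣ a∈s

    -- Each vertex `u` of `s` lies on an edge of `s` that crosses the level. The point of that edge
    -- on the level has a positive coordinate at `u`, so it can lie in `t` only if u ∈ t.
    level⇒⊆ : ∀ {s t} → Face M s → Crossing M side s → (∀ a → OnLevel s a → OnLevel t a) → s ⊆ t
    level⇒⊆ {s} {t} face cross s⊑t {u} u∈ =
      let v , w , v∈ , w∈ , v-below , w-above = below-above face cross in
      [ (λ (_ , below) → let a , level , 0<au , _ = edge-point u∈ w∈ below w-above in in-t a level 0<au)
      , (λ (_ , above) → let a , level , _ , 0<au = edge-point v∈ u∈ v-below above in in-t a level 0<au)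
      ]′ (below-or-above face u∈)
      where
      in-t : ∀ a → OnLevel s a → 0# < a u → u ∈ t
      in-t a level 0<au = decidable-stable (u ∈? t) λ u∉t →
        <-irrefl (≈-sym (_∈∣_∣.support (proj₁ (s⊑t a level)) u u∉t)) 0<au

    module X = CellComplex (slicing 𝕂 f x)

    cell : ∀ s → Face M s → Crossing M side s → X.Carrier
    cell s face cross = let v , w , v∈ , w∈ , below , above = below-above face cross
                            a , level , _ = edge-point v∈ w∈ below above in
                        s , face , a , level

    slicing≅crossing : slicing 𝕂 f x ≅ crossingCells M side
    slicing≅crossing = order-iso (λ (s , face , a , level) → s , face , level⇒crossing face level)
      (λ { {s , face , a , level} {t , _} s⊑t {v} → level⇒⊆ {s} {t} face (level⇒crossing face level) s⊑t {v} })
      (λ s⊆t → ⊆⇒level s⊆t)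
      (λ (s , face , cross) → cell s face cross , refl)
      (λ _ → refl)

-- Polyhedral conditions on the slicing as conditions on faces of M

fresh-vertex : (M : SimplicialComplex n) (side : Fin n → Bool) → ∀ {s c x y z} → Face M s → ∣ s ∣ ≡ 4 →
  ⟦ x ∷ y ∷ z ∷ [] ⟧ ⊆ s → Unique (c ∷ x ∷ y ∷ z ∷ []) → ¬ (⟦ c ∷ x ∷ y ∷ z ∷ [] ⟧ ⊆ s) →
  ∃ λ d → Unique (d ∷ c ∷ x ∷ y ∷ z ∷ []) × IsFace M side (d ∷ x ∷ y ∷ z ∷ [])
fresh-vertex M side {s} {c} {x} {y} {z} face size xyz⊆s uniq@(_ ∷ uniq′) cxyz⊈s =
  -- A tetrahedron has a vertex outside its triangle xyz; were this vertex `c`, the whole of cxyz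
  -- would lie in `s`.
  let d , d∈s , d∉ = ∣p∣<∣q∣⇒q⊈p {p = ⟦ x ∷ y ∷ z ∷ [] ⟧} {q = s}
        (subst (∣ ⟦ x ∷ y ∷ z ∷ [] ⟧ ∣ ℕ.<_) (sym size) (s≤s (ℕ.≤-reflexive (∣⟦⟧∣ uniq′))))
  in d ,
     ((λ d≡c → cxyz⊈s (extend (subst (_∈ s) d≡c d∈s))) ∷ ∉⟦⟧⇒fresh d∉) ∷ uniq ,
     is-face (closed M (extend d∈s) face)
  where
  extend : ∀ {d} → d ∈ s → ⟦ d ∷ x ∷ y ∷ z ∷ [] ⟧ ⊆ s
  extend {d} d∈s = ⟦⟧⊆ {xs = d ∷ x ∷ y ∷ z ∷ []}
    (d∈s ∷ xyz⊆s (∈⟦⟧⁺ {xs = x ∷ y ∷ z ∷ []} i₀) ∷ xyz⊆s (∈⟦⟧⁺ {xs = x ∷ y ∷ z ∷ []} i₁) ∷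
     xyz⊆s (∈⟦⟧⁺ {xs = x ∷ y ∷ z ∷ []} i₂) ∷ [])

module _ (𝕂 : OrderedField ℓ ℓ₁ ℓ₂) {M : SimplicialComplex n} (f : RSL 𝕂 M)
         (x : OrderedField.Carrier 𝕂) (regular-value : IsRegularValue 𝕂 f x)
         (polyhedral : IsPolyhedralMap (slicing 𝕂 f x))
         (neighborly : WeaklyNeighborly (slicing 𝕂 f x)) where
  open OrderedFieldProperties.Slice 𝕂 f x regular-value
  open IsPolyhedralMap polyhedral
  private
    ⊑⇒⊆ : (s t : X.Carrier) → s X.≤ t → proj₁ s ⊆ proj₁ t
    ⊑⇒⊆ (s , face , a , level) (t , _) = level⇒⊆ {s} {t} face (level⇒crossing face level)

    crossing-of : ((s , _) : X.Carrier) → Crossing M side s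
    crossing-of (s , face , a , level) = level⇒crossing face level

    ≈⇒≡ : (s t : X.Carrier) → s X.≈ t → proj₁ s ≡ proj₁ t
    ≈⇒≡ s t s≈t = ⊆-antisym (⊑⇒⊆ s t (lhs≤rhs s≈t)) (⊑⇒⊆ t s (rhs≤lhs s≈t))

    facet-size : ∀ m → m ∸ 2 ≡ 2 → m ≡ 4
    facet-size (suc (suc m)) eq = cong (2 ℕ.+_) eq

    edge-cell : ∀ {d x y z} → _⋈_ M side x y → IsFace M side (d ∷ x ∷ y ∷ z ∷ []) → X.Carrier
    edge-cell {d} {x} {y} {z} x⋈y (is-face face) =
      cell ⟦ x ∷ y ∷ z ∷ [] ⟧ (closed M (λ x∈ → x∈p∪q⁺ (inj₂ x∈)) face)
        (x , y , ∈⟦⟧⁺ {xs = x ∷ y ∷ z ∷ []} i₀ , ∈⟦⟧⁺ {xs = x ∷ y ∷ z ∷ []} i₁ , x⋈y)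

    facet-cell : ∀ {d x y z} → _⋈_ M side x y → IsFace M side (d ∷ x ∷ y ∷ z ∷ []) → X.Carrier
    facet-cell {d} {x} {y} {z} x⋈y (is-face face) = cell ⟦ d ∷ x ∷ y ∷ z ∷ [] ⟧ face
      (x , y , ∈⟦⟧⁺ {xs = d ∷ x ∷ y ∷ z ∷ []} i₁ , ∈⟦⟧⁺ {xs = d ∷ x ∷ y ∷ z ∷ []} i₂ , x⋈y)

    facets-at : ∀ {d x y z} (x⋈y : _⋈_ M side x y) (face : IsFace M side (d ∷ x ∷ y ∷ z ∷ [])) →
      Unique (x ∷ y ∷ z ∷ []) → X.ExactlyTwo (λ t → X.IsFacet t × edge-cell x⋈y face X.≤ t)
    facets-at x⋈y face@(is-face _) uniq = edge-facets (edge-cell x⋈y face) (cong (_∸ 2) (∣⟦⟧∣ uniq))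

    facet-at : ∀ {d e x y z} (x⋈y : _⋈_ M side x y) (face : IsFace M side (d ∷ x ∷ y ∷ z ∷ []))
      (face′ : IsFace M side (e ∷ x ∷ y ∷ z ∷ [])) → Unique (e ∷ x ∷ y ∷ z ∷ []) →
      X.IsFacet (facet-cell x⋈y face′) × edge-cell x⋈y face X.≤ facet-cell x⋈y face′
    facet-at x⋈y (is-face _) (is-face _) uniq = cong (_∸ 2) (∣⟦⟧∣ uniq) , ⊆⇒level (λ x∈ → x∈p∪q⁺ (inj₂ x∈))

    ≤4 : ∀ m → m ∸ 2 ℕ.≤ 2 → m ℕ.≤ 4
    ≤4 m le = ℕ.≤-trans (ℕ.m≤n+m∸n m 2) (ℕ.+-monoʳ-≤ 2 le)

    neighbors : ∀ {u v u′ v′} → _⋈_ M side u v → IsFace M side (u ∷ v ∷ []) →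
      _⋈_ M side u′ v′ → IsFace M side (u′ ∷ v′ ∷ []) →
      ∃ λ t → Face M t × ∣ t ∣ ≡ 4 × All (_∈ t) (u ∷ v ∷ u′ ∷ v′ ∷ [])
    neighbors {u} {v} {u′} {v′} u⋈v (is-face uv) u′⋈v′ (is-face u′v′) =
      let T@(t , face , _) , facet , uv⊑t , u′v′⊑t = neighborly (vertexCell u⋈v uv) (vertexCell u′⋈v′ u′v′)
                                                     (size u⋈v) (size u′⋈v′)
          uv⊆t = ⊑⇒⊆ (vertexCell u⋈v uv) T uv⊑t
          u′v′⊆t = ⊑⇒⊆ (vertexCell u′⋈v′ u′v′) T u′v′⊑t
      in t , face , facet-size ∣ t ∣ facet ,
         uv⊆t (∈⟦⟧⁺ {xs = u ∷ v ∷ []} i₀) ∷ uv⊆t (∈⟦⟧⁺ {xs = u ∷ v ∷ []} i₁) ∷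
         u′v′⊆t (∈⟦⟧⁺ {xs = u′ ∷ v′ ∷ []} i₀) ∷ u′v′⊆t (∈⟦⟧⁺ {xs = u′ ∷ v′ ∷ []} i₁) ∷ []
      where
      vertexCell : ∀ {u v} → _⋈_ M side u v → Face M ⟦ u ∷ v ∷ [] ⟧ → X.Carrier
      vertexCell {u} {v} u⋈v face = cell ⟦ u ∷ v ∷ [] ⟧ face
        (u , v , ∈⟦⟧⁺ {xs = u ∷ v ∷ []} i₀ , ∈⟦⟧⁺ {xs = u ∷ v ∷ []} i₁ , u⋈v)
      size : ∀ {u v} → _⋈_ M side u v → ∣ ⟦ u ∷ v ∷ [] ⟧ ∣ ∸ 2 ≡ 0
      size {u} {v} u⋈v = cong (_∸ 2) (∣⟦⟧∣ {xs = u ∷ v ∷ []} (((λ eq → u⋈v (cong side eq)) ∷ []) ∷ [] ∷ []))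

    -- The given tetrahedron is one of the two facets at the edge. The other facet cannot contain
    -- it, since equal size would make them equal, so `fresh-vertex` applies.
    other-facet : ∀ {c x y z} → _⋈_ M side x y → Unique (c ∷ x ∷ y ∷ z ∷ []) →
      IsFace M side (c ∷ x ∷ y ∷ z ∷ []) →
      ∃ λ d → Unique (d ∷ c ∷ x ∷ y ∷ z ∷ []) × IsFace M side (d ∷ x ∷ y ∷ z ∷ [])
    other-facet {c} {x} {y} {z} x⋈y uniq@(_ ∷ uniq′) face@(is-face cxyz) =
      let p , q , (p-facet , e⊑p) , (q-facet , e⊑q) , p≉q , only = facets-at x⋈y face uniq′ in
      [ (λ t≈p → from q q-facet e⊑q λ q⊇t → p≉q (X.Eq.trans (X.Eq.sym t≈p) (same q q-facet q⊇t)))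
      , (λ t≈q → from p p-facet e⊑p λ p⊇t → p≉q (X.Eq.trans (X.Eq.sym (same p p-facet p⊇t)) t≈q))
      ]′ (only (facet-cell x⋈y face) (facet-at x⋈y face face uniq))
      where
      t = facet-cell x⋈y face
      same : ∀ q → X.IsFacet q → ⟦ c ∷ x ∷ y ∷ z ∷ [] ⟧ ⊆ proj₁ q → t X.≈ q
      same q@(s , _) q-facet t⊆q =
        let t≡q = p⊆q∧∣q∣≤∣p∣⇒p≡q t⊆q (ℕ.≤-reflexive (trans (facet-size ∣ s ∣ q-facet) (sym (∣⟦⟧∣ uniq)))) in
        record { lhs≤rhs = ⊆⇒level (⊆-reflexive t≡q) ; rhs≤lhs = ⊆⇒level (⊆-reflexive (sym t≡q)) }
      from : ∀ q → X.IsFacet q → edge-cell x⋈y face X.≤ q → ¬ (⟦ c ∷ x ∷ y ∷ z ∷ [] ⟧ ⊆ proj₁ q) →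
             ∃ λ d → Unique (d ∷ c ∷ x ∷ y ∷ z ∷ []) × IsFace M side (d ∷ x ∷ y ∷ z ∷ [])
      from q@(s , sface , _) q-facet e⊑q = fresh-vertex M side sface (facet-size ∣ s ∣ q-facet)
        (⊑⇒⊆ (edge-cell x⋈y face) q e⊑q) uniq

    -- Equal cells have equal underlying faces, so distinct fourth vertices give distinct facets,
    -- and three of them do not fit into the two classes allowed at an edge.
    no-third-facet : ∀ {c d e x y z} → _⋈_ M side x y → Unique (c ∷ d ∷ e ∷ x ∷ y ∷ z ∷ []) →
      IsFace M side (c ∷ x ∷ y ∷ z ∷ []) → IsFace M side (d ∷ x ∷ y ∷ z ∷ []) →
      ¬ IsFace M side (e ∷ x ∷ y ∷ z ∷ [])
    no-third-facet {c} {d} {e} {x} {y} {z} x⋈y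
      ((c≢d ∷ c≢e ∷ c-new) ∷ (d≢e ∷ d-new) ∷ e-new ∷ uniq) fc@(is-face _) fd@(is-face _) fe@(is-face _) =
      let p , q , _ , _ , _ , only = facets-at x⋈y fc uniq in
      pigeonhole p q (only (facet-cell x⋈y fc) (facet-at x⋈y fc fc (c-new ∷ uniq)))
        (only (facet-cell x⋈y fd) (facet-at x⋈y fc fd (d-new ∷ uniq)))
        (only (facet-cell x⋈y fe) (facet-at x⋈y fc fe (e-new ∷ uniq)))
      where
      distinct : ∀ {c d} → c ≢ d → All (c ≢_) (x ∷ y ∷ z ∷ []) →
        (fc : IsFace M side (c ∷ x ∷ y ∷ z ∷ [])) (fd : IsFace M side (d ∷ x ∷ y ∷ z ∷ [])) →
        ∀ p → facet-cell x⋈y fc X.≈ p → ¬ facet-cell x⋈y fd X.≈ p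
      distinct {c} {d} c≢d c-new fc@(is-face _) fd@(is-face _) p fc≈p fd≈p =
        All.lookup (c≢d ∷ c-new)
          (∈⟦⟧⁻ (d ∷ x ∷ y ∷ z ∷ []) (subst (c ∈_)
            (≈⇒≡ (facet-cell x⋈y fc) (facet-cell x⋈y fd) (X.Eq.trans fc≈p (X.Eq.sym fd≈p)))
            (∈⟦⟧⁺ {xs = c ∷ x ∷ y ∷ z ∷ []} i₀))) refl
      pigeonhole : ∀ p q →
        facet-cell x⋈y fc X.≈ p ⊎ facet-cell x⋈y fc X.≈ q →
        facet-cell x⋈y fd X.≈ p ⊎ facet-cell x⋈y fd X.≈ q →
        ¬ (facet-cell x⋈y fe X.≈ p ⊎ facet-cell x⋈y fe X.≈ q)
      pigeonhole p q (inj₁ c≈p) (inj₁ d≈p) _          = distinct c≢d c-new fc fd p c≈p d≈p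
      pigeonhole p q (inj₂ c≈q) (inj₂ d≈q) _          = distinct c≢d c-new fc fd q c≈q d≈q
      pigeonhole p q (inj₁ c≈p) (inj₂ _)   (inj₁ e≈p) = distinct c≢e c-new fc fe p c≈p e≈p
      pigeonhole p q (inj₁ _)   (inj₂ d≈q) (inj₂ e≈q) = distinct d≢e d-new fd fe q d≈q e≈q
      pigeonhole p q (inj₂ c≈q) (inj₁ _)   (inj₂ e≈q) = distinct c≢e c-new fc fe q c≈q e≈q
      pigeonhole p q (inj₂ _)   (inj₁ d≈p) (inj₁ e≈p) = distinct d≢e d-new fd fe p d≈p e≈p

  slicing-neighborly : IsNeighborlySurface M side
  slicing-neighborly = record
    { crossing-face = let s , face , _ = nonempty in s , face , crossing-of nonempty
    ; size≤4        = λ {s} face cross → ≤4 ∣ s ∣ (dim≤2 (cell s face cross))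
    ; neighborly    = neighbors
    ; another       = other-facet
    ; at-most-two   = no-third-facet
    }

theorem5p5 : {c ℓ₁ ℓ₂ : Level} (𝕂 : OrderedField c ℓ₁ ℓ₂) →
    (n : ℕ) (M : SimplicialComplex n) → IsCombinatorial3Manifold M →
    (f : RSL 𝕂 M) (x : OrderedField.Carrier 𝕂) → IsRegularValue 𝕂 f x →
    IsPolyhedralMap (slicing 𝕂 f x) → WeaklyNeighborly (slicing 𝕂 f x) →
    (slicing 𝕂 f x ≅ simplexBoundary) ⊎ (slicing 𝕂 f x ≅ prismBoundary) ⊎ (slicing 𝕂 f x ≅ gridTorus)
theorem5p5 𝕂 n M manifold f x regular-value polyhedral neighborly =
  Sum.map (≅-trans slicing≅crossing) (Sum.map (≅-trans slicing≅crossing) (≅-trans slicing≅crossing))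
    (classification (slicing-neighborly 𝕂 f x regular-value polyhedral neighborly)
                    (IsCombinatorial3Manifold.links manifold))
  where open OrderedFieldProperties.Slice 𝕂 f x regular-value
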